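{- Given an input data stream $\sigma=(\sigma_1,\dots,\sigma_n)\in U^n$ of length $n$ and a similarity function $f:U\times U\to[0,1]$, for any $\epsilon\in(0,1)$, Algorithm A (the explicit three-pass procedure written out in the context) computes a $(1+\epsilon,o(1))$-approximation of the diversity index $\mathrm{DI}(\sigma)=\sum_{i\in[n]} d_i^{ -1}$, using three passes and $O\left(\frac{1}{\epsilon^2}\sqrt{n}\log n\right)$ words of space.
   Context: Similarity graph. $U$ is a universe of items and $f:U\times U\to[0,1]$ is a symmetric similarity function with $f(x,x)=1$ for all $x\in U$. For a stream $\sigma=(\sigma_1,\dots,\sigma_n)\in U^n$, the similarity graph is the complete weighted graph (with self-loops) on node set $[n]=\{1,\dots,n\}$ with weights $w(i,j)=f(\sigma_i,\sigma_j)$. The degree of node $i$ is $d_i=\sum_{j\in[n]} f(\sigma_i,\sigma_j)$. Each stream position is a distinct node; node $i$ is represented by the pair $(i,\sigma_i)$. Node-arrival streaming model. The items $\sigma_1,\dots,\sigma_n$ arrive sequentially; a pass is one linear scan of the stream. Edge weights are not given; $f(x,y)$ is evaluated on demand, only when both items are in memory (the currently arriving item counts as being in memory). The length $n$ is known in advance. Space is measured in words in a unit-cost RAM model: each stream item, each value returned by $f$ and each arithmetic quantity maintained takes $O(1)$ words. Approximation. $\tilde X$ is a $(1+\epsilon,\delta)$-approximation of $X$ if $(1-\epsilon)X\le\tilde X\le(1+\epsilon)X$ with probability at least $1-\delta$. The $o(1)$ is as $n\to\infty$. Algorithm A (input: $\sigma$, $f$, $\epsilon$). All random choices are independent; $\log$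 is the natural logarithm; array sizes are rounded to integers. Set $t_1=\frac{48\sqrt n\log n}{\epsilon^2}$, $t_2=\frac{36\sqrt n\log n}{\epsilon^2}$, $\theta=\frac{96\log n}{\epsilon^2}$. Initialize $W_H=0$, $W_L=0$, $n_2=0$, an array $S_1$ of size $t_1$, and arrays $S_2$, $D$ of size $t_2$, all entries $0$. Pass 1: for each arriving $\sigma_j$ and each $i=1,\dots,t_1$, with probability $1/j$ set $S_1[i]\leftarrow\sigma_j$. Pass 2: for each arriving $\sigma_j$, compute $Y_j=\sum_{i\in[t_1]} f(S_1[i],\sigma_j)$. If $Y_j\ge\theta$, set $W_H\leftarrow W_H+\left(\frac{n}{t_1}Y_j\right)^{ -1}$. Otherwise set $n_2\leftarrow n_2+1$ and, for each $i=1,\dots,t_2$, with probability $1/n_2$ set $S_2[i]\leftarrow\sigma_j$. Pass 3: for each arriving $\sigma_j$ and each $i=1,\dots,t_2$, set $D[i]\leftarrow D[i]+f(S_2[i],\sigma_j)$. After Pass 3, set $W_L=\frac{n_2}{t_2}\sum_{i\in[t_2]}\frac{1}{D[i]}$ (with $W_L=0$ if $n_2=0$) and return $W_H+W_L$. -}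

module Defs where

open import Algebra.Bundles using (CommutativeRing; Semiring)
import Algebra.Definitions.RawMonoid as RawMonoidDefs
import Algebra.Definitions.RawSemiring as RawSemiringDefs
open import Data.Fin.Base using (Fin; toℕ) renaming (zero to fzero)
open import Data.List.Base using (List; []; _∷_)
open import Data.List.Membership.Propositional using (_∈_)
open import Data.List.Relation.Unary.All as All using (All)
open import Data.List.Relation.Unary.Any using (here; there)
open import Data.Maybe.Base using (Maybe; just; nothing)
import Data.Nat.Base as ℕ
open import Data.Nat.Base using (ℕ; _⊔_; _!)
open import Data.Product.Base using (Σ; ∃; _×_; _,_)
open import Data.Unit.Polymorphic.Base using (⊤; tt)
open import Data.Vec.Base as Vec using (Vec; lookup; replicate)
import Data.Vec.Functional as Vector
open import Level using (Level; suc)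
open import Relation.Binary.Core using (Rel)
open import Relation.Binary.PropositionalEquality.Core using (refl)
open import Relation.Binary.Structures using (IsDecTotalOrder)
import Relation.Binary.Construct.NonStrictToStrict as ToStrict
open import Relation.Nullary.Decidable.Core using (Dec; yes; no; _×-dec_)
open import Relation.Nullary.Negation.Core using (¬_)

private
  variable
    ℓ a b : Level

------------------------------------------------------------------------
-- The real line

-- Real numbers are not available, so everything below is stated for an
-- arbitrary complete ordered field.  Classically this determines ℝ up to
-- isomorphism.  The order is decidable because the algorithm branches on
-- comparisons of reals.  `archimedean` follows classically from
-- `supremum`, but its natural-number witness does not constructively.

record Reals (ℓ : Level) : Set (suc ℓ) where
  infix  4 _≤_
  infix  9 _⁻¹

  field
    commutativeRing : CommutativeRing ℓ ℓ

  open CommutativeRing commutativeRing public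

  field
    _≤_             : Rel Carrier ℓ
    isDecTotalOrder : IsDecTotalOrder _≈_ _≤_
    _⁻¹             : Carrier → Carrier
    0≉1             : ¬ (0# ≈ 1#)
    ⁻¹-cong         : ∀ {x y} → x ≈ y → x ⁻¹ ≈ y ⁻¹
    -- The value of 0# ⁻¹ is left unspecified.
    *-inverseʳ      : ∀ x → ¬ (x ≈ 0#) → x * x ⁻¹ ≈ 1#
    +-monoˡ-≤       : ∀ {x y} z → x ≤ y → x + z ≤ y + z
    *-nonNegative   : ∀ {x y} → 0# ≤ x → 0# ≤ y → 0# ≤ x * y

  open IsDecTotalOrder isDecTotalOrder public using (_≤?_)
  open ToStrict _≈_ _≤_ public using (_<_)
  open RawMonoidDefs +-rawMonoid public using (sum)
  open RawSemiringDefs (Semiring.rawSemiring semiring) public using (_^_)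

  fromℕ : ℕ → Carrier
  fromℕ n = RawMonoidDefs._×_ +-rawMonoid n 1#

  UpperBound : (Carrier → Set ℓ) → Carrier → Set ℓ
  UpperBound P u = ∀ x → P x → x ≤ u

  field
    archimedean : ∀ x → ∃ λ n → x ≤ fromℕ n
    supremum    : (P : Carrier → Set ℓ) → ∃ P → ∃ (UpperBound P) →
                  ∃ λ s → UpperBound P s × (∀ u → UpperBound P u → s ≤ u)

module Analysis (R : Reals ℓ) where
  open Reals R

  infix 4 _⟶_

  _⟶_ : (ℕ → Carrier) → Carrier → Set ℓ
  s ⟶ x = ∀ η → 0# < η → ∃ λ N → ∀ n → N ℕ.≤ n →
          s n - x ≤ η × x - s n ≤ η

  IsSqrt : Carrier → Carrier → Set ℓ
  IsSqrt x s = 0# ≤ s × s * s ≈ x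

  expPartialSum : Carrier → ℕ → Carrier
  expPartialSum x k = sum {k} λ i → x ^ toℕ i * fromℕ (toℕ i !) ⁻¹

  IsExp : Carrier → Carrier → Set ℓ
  IsExp x y = expPartialSum x ⟶ y

  IsLog : Carrier → Carrier → Set ℓ
  IsLog x l = IsExp l x

  -- Covers rounding down, up and to nearest.
  IsRounding : Carrier → ℕ → Set ℓ
  IsRounding x t = x - fromℕ t < 1# × fromℕ t - x < 1#

------------------------------------------------------------------------
-- Finite randomised computations

-- A computation is a finite tree of independent biased coins:
-- `coin p x y` continues as x with probability p, and as y otherwise.

module Probability (R : Reals ℓ) where
  open Reals R

  infixl 1 _>>=_

  data Rand (A : Set a) : Set (ℓ Level.⊔ a) where
    return : A → Rand A
    coin   : Carrier → Rand A → Rand A → Rand A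

  _>>=_ : {A : Set a} {B : Set b} → Rand A → (A → Rand B) → Rand B
  return x   >>= k = k x
  coin p x y >>= k = coin p (x >>= k) (y >>= k)

  Prob : {A : Set a} {P : A → Set b} → (∀ x → Dec (P x)) → Rand A → Carrier
  Prob P? (return x) with P? x
  ... | yes _ = 1#
  ... | no  _ = 0#
  Prob P? (coin p x y) = p * Prob P? x + (1# - p) * Prob P? y

  Within : Carrier → Carrier → Carrier → Set ℓ
  Within ε X X̃ = (1# - ε) * X ≤ X̃ × X̃ ≤ (1# + ε) * X

  within? : ∀ ε X X̃ → Dec (Within ε X X̃)
  within? ε X X̃ = (_ ≤? _) ×-dec (_ ≤? _)

  -- X̃ is a (1+ε,δ)-approximation of X.
  IsApproximation : (ε δ X : Carrier) → Rand Carrier → Set ℓ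
  IsApproximation ε δ X X̃ = 1# - δ ≤ Prob (within? ε X) X̃

------------------------------------------------------------------------
-- Similarity graphs

module Similarity (R : Reals ℓ) {U : Set ℓ} where
  open Reals R

  record IsSimilarity (f : U → U → Carrier) : Set ℓ where
    field
      nonNegative : ∀ x y → 0# ≤ f x y
      atMostOne   : ∀ x y → f x y ≤ 1#
      f-symmetric : ∀ x y → f x y ≈ f y x
      f-reflexive : ∀ x → f x x ≈ 1#

  degree : (U → U → Carrier) → ∀ {n} → Vec U n → Fin n → Carrier
  degree f σ i = sum λ j → f (lookup σ i) (lookup σ j)

  diversityIndex : (U → U → Carrier) → ∀ {n} → Vec U n → Carrier
  diversityIndex f σ = sum λ i → degree f σ i ⁻¹

------------------------------------------------------------------------
-- Streaming programs

-- Syntax of programs over a fixed collection of arrays.  A program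
-- mentions neither the universe nor f: items can only be copied from the
-- stream into memory, and f can only be applied (by `sim`) to items that
-- are in memory or are just arriving.

module Streaming (R : Reals ℓ) where
  open Reals R
  open Probability R

  data Kind : Set where
    item num : Kind

  Layout : Set
  Layout = List (Kind × ℕ)

  record Cell (Γ : Layout) (κ : Kind) : Set where
    constructor _[_]
    field
      {size} : ℕ
      array  : (κ , size) ∈ Γ
      index  : Fin size

  data Mode : Set where
    scan    : Mode   -- executed once for each arriving item
    offline : Mode   -- executed once, with no arriving item

  data Item (Γ : Layout) : Mode → Set where
    arriving : Item Γ scan
    stored   : ∀ {μ} → Cell Γ item → Item Γ μ

  infixl 6 _⊕_
  infixl 7 _⊗_

  data Expr (Γ : Layout) (μ : Mode) : Set ℓ where
    const   : Carrier → Expr Γ μ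
    get     : Cell Γ num → Expr Γ μ
    sim     : Item Γ μ → Item Γ μ → Expr Γ μ
    _⊕_ _⊗_ : Expr Γ μ → Expr Γ μ → Expr Γ μ
    recip   : Expr Γ μ → Expr Γ μ
    total   : ∀ {m} → (Fin m → Expr Γ μ) → Expr Γ μ

  infixr 2 _⨾_
  infix  3 _≔_ _≔ᵢ_ if_≼_then_else_ withProbability_perform_

  data Cmd (Γ : Layout) (μ : Mode) : Set ℓ where
    _≔_                 : Cell Γ num → Expr Γ μ → Cmd Γ μ
    _≔ᵢ_                : Cell Γ item → Item Γ μ → Cmd Γ μ
    _⨾_                 : Cmd Γ μ → Cmd Γ μ → Cmd Γ μ
    if_≼_then_else_     : Expr Γ μ → Expr Γ μ → Cmd Γ μ → Cmd Γ μ → Cmd Γ μ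
    withProbability_perform_ : Expr Γ μ → Cmd Γ μ → Cmd Γ μ
    for                 : ∀ {m} → (Fin m → Cmd Γ μ) → Cmd Γ μ

  record Program : Set ℓ where
    field
      layout : Layout
      stages : List (∃ (Cmd layout))
      output : Expr layout offline

  passes : Program → ℕ
  passes P = count (Program.stages P)
    where
    count : ∀ {Γ} → List (∃ (Cmd Γ)) → ℕ
    count []                   = 0
    count ((scan    , _) ∷ cs) = 1 ℕ.+ count cs
    count ((offline , _) ∷ cs) = count cs

  -- Space in words: one for each array cell, one for the arriving item,
  -- and the scratch space of the most demanding stage.  Scratch space
  -- holds one word for each intermediate value of an expression, a
  -- counter for each active loop, and also an accumulator for `total`.

  maximum : ∀ {m} → (Fin m → ℕ) → ℕ
  maximum = Vector.foldr _⊔_ 0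

  exprScratch : ∀ {Γ μ} → Expr Γ μ → ℕ
  exprScratch (const _)  = 1
  exprScratch (get _)    = 1
  exprScratch (sim _ _)  = 1
  exprScratch (e₁ ⊕ e₂)  = 1 ℕ.+ exprScratch e₁ ℕ.+ exprScratch e₂
  exprScratch (e₁ ⊗ e₂)  = 1 ℕ.+ exprScratch e₁ ℕ.+ exprScratch e₂
  exprScratch (recip e)  = 1 ℕ.+ exprScratch e
  exprScratch (total es) = 2 ℕ.+ maximum λ i → exprScratch (es i)

  cmdScratch : ∀ {Γ μ} → Cmd Γ μ → ℕ
  cmdScratch (_ ≔ e)                    = exprScratch e
  cmdScratch (_ ≔ᵢ _)                   = 0
  cmdScratch (c₁ ⨾ c₂)                  = cmdScratch c₁ ⊔ cmdScratch c₂
  cmdScratch (if e₁ ≼ e₂ then c₁ else c₂) =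
    (exprScratch e₁ ℕ.+ exprScratch e₂) ⊔ cmdScratch c₁ ⊔ cmdScratch c₂
  cmdScratch (withProbability e perform c)   = exprScratch e ⊔ cmdScratch c
  cmdScratch (for cs)                   = 1 ℕ.+ maximum λ i → cmdScratch (cs i)

  layoutWords : Layout → ℕ
  layoutWords []            = 0
  layoutWords ((_ , m) ∷ Γ) = m ℕ.+ layoutWords Γ

  space : Program → ℕ
  space P = layoutWords layout ℕ.+ 1 ℕ.+ (stagesScratch stages ⊔ exprScratch output)
    where
    open Program P
    stagesScratch : ∀ {Γ} → List (∃ (Cmd Γ)) → ℕ
    stagesScratch []             = 0
    stagesScratch ((_ , c) ∷ cs) = cmdScratch c ⊔ stagesScratch cs

  -- An item cell that has not been written yet holds `nothing`, the
  -- initial entry 0 of an array of items; similarities with it are 0#.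

  module Semantics {U : Set ℓ} (f : U → U → Carrier) where

    Value : Kind → Set ℓ
    Value item = Maybe U
    Value num  = Carrier

    initial : ∀ κ → Value κ
    initial item = nothing
    initial num  = 0#

    Memory : Layout → Set ℓ
    Memory = All λ (κ , m) → Vec (Value κ) m

    initialMemory : ∀ Γ → Memory Γ
    initialMemory Γ = All.universal (λ (κ , m) → replicate m (initial κ)) Γ

    read : ∀ {Γ κ} → Cell Γ κ → Memory Γ → Value κ
    read (x [ i ]) M = lookup (All.lookup M x) i

    write : ∀ {Γ κ} → Cell Γ κ → Value κ → Memory Γ → Memory Γ
    write (x [ i ]) v = All.updateAt x λ vs → vs Vec.[ i ]≔ v

    Arrival : Mode → Set ℓ
    Arrival scan    = U
    Arrival offline = ⊤

    evalItem : ∀ {Γ μ} → Item Γ μ → Arrival μ → Memory Γ → Maybe U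
    evalItem arriving   x M = just x
    evalItem (stored c) x M = read c M

    similarity : Maybe U → Maybe U → Carrier
    similarity (just x) (just y) = f x y
    similarity _        _        = 0#

    eval : ∀ {Γ μ} → Expr Γ μ → Arrival μ → Memory Γ → Carrier
    eval (const r)   x M = r
    eval (get c)     x M = read c M
    eval (sim u v)   x M = similarity (evalItem u x M) (evalItem v x M)
    eval (e₁ ⊕ e₂)   x M = eval e₁ x M + eval e₂ x M
    eval (e₁ ⊗ e₂)   x M = eval e₁ x M * eval e₂ x M
    eval (recip e)   x M = eval e x M ⁻¹
    eval (total es)  x M = sum λ i → eval (es i) x M

    sequence : ∀ {Γ m} → (Fin m → Memory Γ → Rand (Memory Γ)) →
               Memory Γ → Rand (Memory Γ)
    sequence = Vector.foldr (λ k ks M → k M >>= ks) return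

    exec : ∀ {Γ μ} → Cmd Γ μ → Arrival μ → Memory Γ → Rand (Memory Γ)
    exec (c ≔ e)    x M = return (write c (eval e x M) M)
    exec (c ≔ᵢ u)   x M = return (write c (evalItem u x M) M)
    exec (c₁ ⨾ c₂)  x M = exec c₁ x M >>= exec c₂ x
    exec (if e₁ ≼ e₂ then c₁ else c₂) x M with eval e₁ x M ≤? eval e₂ x M
    ... | yes _ = exec c₁ x M
    ... | no  _ = exec c₂ x M
    exec (withProbability e perform c) x M = coin (eval e x M) (exec c x M) (return M)
    exec (for cs)   x M = sequence (λ i → exec (cs i) x) M

    execScan : ∀ {Γ n} → Cmd Γ scan → Vec U n → Memory Γ → Rand (Memory Γ)
    execScan c Vec.[]       M = return M
    execScan c (x Vec.∷ xs) M = exec c x M >>= execScan c xs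

    execStages : ∀ {Γ n} → List (∃ (Cmd Γ)) → Vec U n → Memory Γ → Rand (Memory Γ)
    execStages []                   σ M = return M
    execStages ((scan    , c) ∷ cs) σ M = execScan c σ M >>= execStages cs σ
    execStages ((offline , c) ∷ cs) σ M = exec c tt M >>= execStages cs σ

    run : ∀ {n} → Program → Vec U n → Rand Carrier
    run P σ = execStages stages σ (initialMemory layout) >>= λ M →
              return (eval output tt M)
      where open Program P

  open Semantics public using (run)

------------------------------------------------------------------------
-- The three-pass algorithm

module ThreePass (R : Reals ℓ) (n : ℕ) (t₁ t₂ : ℕ) (θ : Reals.Carrier R) where
  open Reals R using (fromℕ; 0#; 1#)
  open Streaming R

  Γ : Layout
  Γ = (item , t₁) ∷ (item , t₂) ∷ (num , t₂) ∷
      (num , 1) ∷ (num , 1) ∷ (num , 1) ∷ (num , 1) ∷ (num , 1) ∷ []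

  S₁ : Fin t₁ → Cell Γ item
  S₁ i = here refl [ i ]

  S₂ : Fin t₂ → Cell Γ item
  S₂ i = there (here refl) [ i ]

  D : Fin t₂ → Cell Γ num
  D i = there (there (here refl)) [ i ]

  -- j is the position of the arriving item in the first pass.
  j n₂ Y W-H W-L : Cell Γ num
  j   = there (there (there (here refl))) [ fzero ]
  n₂  = there (there (there (there (here refl)))) [ fzero ]
  Y   = there (there (there (there (there (here refl))))) [ fzero ]
  W-H = there (there (there (there (there (there (here refl)))))) [ fzero ]
  W-L = there (there (there (there (there (there (there (here refl))))))) [ fzero ]

  pass₁ pass₂ pass₃ : Cmd Γ scan

  pass₁ =
    j ≔ get j ⊕ const 1# ⨾
    for λ i → withProbability recip (get j) perform (S₁ i ≔ᵢ arriving)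

  pass₂ =
    Y ≔ total (λ i → sim (stored (S₁ i)) arriving) ⨾
    (if const θ ≼ get Y
     then W-H ≔ get W-H ⊕ recip (const (fromℕ n) ⊗ recip (const (fromℕ t₁)) ⊗ get Y)
     else (n₂ ≔ get n₂ ⊕ const 1# ⨾
           for λ i → withProbability recip (get n₂) perform (S₂ i ≔ᵢ arriving)))

  pass₃ =
    for λ i → D i ≔ get (D i) ⊕ sim (stored (S₂ i)) arriving

  finish : Cmd Γ offline
  finish =
    if get n₂ ≼ const 0#
    then W-L ≔ const 0#
    else (W-L ≔ get n₂ ⊗ recip (const (fromℕ t₂)) ⊗ total (λ i → recip (get (D i))))

  program : Program
  program = record
    { layout = Γ
    ; stages = (scan , pass₁) ∷ (scan , pass₂) ∷ (scan , pass₃) ∷ (offline , finish) ∷ []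
    ; output = get W-H ⊕ get W-L
    }

-- The parameters √n and logn are the square root and the natural
-- logarithm of n.

module Parameters (R : Reals ℓ) (√n logn ε : Reals.Carrier R) where
  open Reals R

  size₁ size₂ threshold : Carrier
  size₁     = fromℕ 48 * √n * logn * (ε * ε) ⁻¹
  size₂     = fromℕ 36 * √n * logn * (ε * ε) ⁻¹
  threshold = fromℕ 96 * logn * (ε * ε) ⁻¹

{-# OPTIONS --safe #-}

-- After the first pass the cells of S₁ are independent uniform samples of the
-- stream, so by Chernoff's bound, with probability 1 - 2/n, every item of
-- degree at least about √n has an estimate within a factor 1 ± ε/2, and every
-- other item has an estimate below θ.  In that event the heavy items
-- contribute to W_H up to a factor 1 ± ε, and every light item has degree at
-- most 2θn/t₁ = O(√n).  Hence the reciprocal degrees of the samples in S₂ have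
-- such a large mean that t₂ of them suffice: Chernoff's bound again gives W_L
-- up to a factor 1 ± ε with probability 1 - 2/n.
--
-- Chernoff's bound needs only expectations of functions ∏ᵢ φ(S[i]) of a
-- reservoir S.  These are computed by induction on the stream: an arrival
-- replaces φ by a mixture of φ with the constant φ(x).  The exponential
-- function is the supremum of its partial sums on nonnegative arguments, with
-- exp (a - b) = exp a / exp b, and additivity comes from Cauchy products.

module Submission where

open import Defs
open import Algebra.Solver.Ring.AlmostCommutativeRing
  using (fromCommutativeRing; _-Raw-AlmostCommutative⟶_; Induced-equivalence)
open import Data.Empty using (⊥-elim)
open import Data.Fin.Base using (Fin; toℕ)
import Data.Integer as ℤ
open import Data.Integer using (ℤ)
open import Data.Integer.Properties using ([1+m]⊖[1+n]≡m⊖n)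
open import Data.List.Base using (List; []; _∷_; length; filter; foldl)
open import Data.List.Relation.Unary.All as All using (All; []; _∷_)
open import Data.List.Relation.Unary.Any using (here; there)
open import Data.Maybe.Base using (Maybe; just; nothing)
open import Data.Nat.Base as ℕ using (ℕ; zero; suc; _!)
import Data.Nat.Properties as ℕ
open import Data.Nat.Solver using (module +-*-Solver)
open import Data.Product.Base using (Σ; ∃; _×_; _,_; proj₁; proj₂)
import Data.Sign.Base as Sign
open import Data.Sum.Base using (inj₁; inj₂)
open import Data.Unit.Polymorphic.Base using (tt)
open import Data.Vec.Base using (Vec; []; _∷_; lookup; tabulate; toList; replicate; _[_]≔_)
import Data.Vec.Functional as Vector
open import Data.Vec.Properties using (lookup∘tabulate; lookup-replicate; length-toList)
open import Function.Base using (_∘_)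
open import Relation.Binary.Bundles using (Poset)
import Relation.Binary.Construct.NonStrictToStrict as ToStrict
open import Relation.Binary.Definitions using (WeaklyDecidable)
import Relation.Binary.PropositionalEquality as ≡
open import Relation.Binary.PropositionalEquality.Core using (_≡_)
import Relation.Binary.Reasoning.PartialOrder as PosetReasoning
import Relation.Binary.Reasoning.Setoid as SetoidReasoning
open import Relation.Binary.Structures using (IsDecTotalOrder)
open import Relation.Nullary.Decidable.Core using (Dec; yes; no; ¬?; True; toWitness)
open import Relation.Nullary.Negation.Core using (¬_)

-- No event is ever conditioned on. A deviation is witnessed by its exponential moment, a product
-- over the cells of a reservoir that is at least 1 whenever the deviation occurs. `failure₁` and
-- `failure₂` add up such products, and a lower bound of the form 1 - failure on the chance of
-- success is shown for every content of the memory: it is trivial where the failure term is at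
-- least 1, because that chance is nonnegative. Taking expectations then does the work of Markov's
-- inequality and the union bound at once.
--
-- The first reservoir serves n items with two tails each, so its exponents are 2 log n, and 2n / n²
-- = 2/n. The second one estimates a single number, so log n is enough for another 2/n.
--
-- The logarithm is given only by the convergence of the exponential partial sums at log n to n, and
-- even its sign is open. So the sign has to be settled before n ≤ exp (log n) is available.

-- Arithmetic of ordered fields.

module OrderedField {ℓ} (R : Reals ℓ) where
  open Reals R public
  open import Algebra.Properties.Ring ring
    using (-‿distribˡ-*; -‿distribʳ-*; -0#≈0#; -‿involutive; -‿+-comm)
  open import Algebra.Properties.Semiring.Mult semiring
    using (×-homo-+; ×1-homo-*)
  open IsDecTotalOrder isDecTotalOrder public
    using (_≟_; antisym; ≤-respˡ-≈; ≤-respʳ-≈)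
    renaming (refl to ≤-refl; reflexive to ≤-reflexive; trans to ≤-trans; total to ≤-total)

  poset : Poset ℓ ℓ ℓ
  poset = record { isPartialOrder = IsDecTotalOrder.isPartialOrder isDecTotalOrder }

  module ≤-Reasoning = PosetReasoning poset

  -- The ring solver gets integer coefficients, so that it normalises numerals.
  -- `nat` agrees with `fromℕ` definitionally on numerals from 2 on, and with
  -- 0# and 1# on the first two.
  private
    nat : ℕ → Carrier
    nat 0             = 0#
    nat 1             = 1#
    nat (suc (suc n)) = fromℕ (suc (suc n))

    nat≈ : ∀ n → nat n ≈ fromℕ n
    nat≈ 0             = refl
    nat≈ 1             = sym (+-identityʳ 1#)
    nat≈ (suc (suc n)) = refl

    int : ℤ → Carrier
    int (ℤ.+ n)    = nat n
    int ℤ.-[1+ n ] = - nat (suc n)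

    x-x+y : ∀ a b c → (a + b) - (a + c) ≈ b - c
    x-x+y a b c = begin
      (a + b) + - (a + c)    ≈⟨ +-congˡ (-‿+-comm a c) ⟨
      (a + b) + (- a + - c)  ≈⟨ +-congʳ (+-comm a b) ⟩
      (b + a) + (- a + - c)  ≈⟨ +-assoc b a _ ⟩
      b + (a + (- a + - c))  ≈⟨ +-congˡ (+-assoc a (- a) (- c)) ⟨
      b + ((a - a) + - c)    ≈⟨ +-congˡ (+-congʳ (-‿inverseʳ a)) ⟩
      b + (0# + - c)         ≈⟨ +-congˡ (+-identityˡ _) ⟩
      b - c                  ∎
      where open SetoidReasoning setoid

    int-⊖ : ∀ m n → int (m ℤ.⊖ n) ≈ fromℕ m - fromℕ n
    int-⊖ m zero = trans (nat≈ m) (sym (trans (+-congˡ -0#≈0#) (+-identityʳ _)))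
    int-⊖ zero (suc n) = trans (-‿cong (nat≈ (suc n))) (sym (+-identityˡ _))
    int-⊖ (suc m) (suc n) rewrite [1+m]⊖[1+n]≡m⊖n m n =
      trans (int-⊖ m n) (sym (x-x+y 1# (fromℕ m) (fromℕ n)))

    int-+ : ∀ i j → int (i ℤ.+ j) ≈ int i + int j
    int-+ (ℤ.+ m) (ℤ.+ n) =
      trans (nat≈ (m ℕ.+ n)) (trans (×-homo-+ 1# m n) (sym (+-cong (nat≈ m) (nat≈ n))))
    int-+ (ℤ.+ m) ℤ.-[1+ n ] =
      trans (int-⊖ m (suc n)) (sym (+-cong (nat≈ m) (-‿cong (nat≈ (suc n)))))
    int-+ ℤ.-[1+ m ] (ℤ.+ n) =
      trans (int-⊖ n (suc m)) (trans (+-comm _ _) (sym (+-cong (-‿cong (nat≈ (suc m))) (nat≈ n))))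
    int-+ ℤ.-[1+ m ] ℤ.-[1+ n ] =
      trans (-‿cong (trans (reflexive (≡.cong (λ k → fromℕ (suc k)) (≡.sym (ℕ.+-suc m n))))
                           (×-homo-+ 1# (suc m) (suc n))))
            (trans (sym (-‿+-comm _ _))
                   (sym (+-cong (-‿cong (nat≈ (suc m))) (-‿cong (nat≈ (suc n))))))

    int-neg : ∀ i → int (ℤ.- i) ≈ - int i
    int-neg (ℤ.+ zero)    = sym -0#≈0#
    int-neg (ℤ.+ (suc n)) = refl
    int-neg ℤ.-[1+ n ]    = sym (-‿involutive _)

    int-pos-◃ : ∀ n → int (Sign.+ ℤ.◃ n) ≈ fromℕ n
    int-pos-◃ zero    = refl
    int-pos-◃ (suc n) = nat≈ (suc n)

    int-neg-◃ : ∀ n → int (Sign.- ℤ.◃ n) ≈ - fromℕ n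
    int-neg-◃ zero    = sym -0#≈0#
    int-neg-◃ (suc n) = -‿cong (nat≈ (suc n))

    int-* : ∀ i j → int (i ℤ.* j) ≈ int i * int j
    int-* (ℤ.+ m) (ℤ.+ n) =
      trans (int-pos-◃ (m ℕ.* n)) (trans (×1-homo-* m n) (sym (*-cong (nat≈ m) (nat≈ n))))
    int-* (ℤ.+ m) ℤ.-[1+ n ] =
      trans (int-neg-◃ (m ℕ.* suc n))
        (trans (-‿cong (trans (×1-homo-* m (suc n)) (sym (*-cong (nat≈ m) (nat≈ (suc n))))))
               (-‿distribʳ-* _ _))
    int-* ℤ.-[1+ m ] (ℤ.+ n) =
      trans (int-neg-◃ (suc m ℕ.* n))
        (trans (-‿cong (trans (×1-homo-* (suc m) n) (sym (*-cong (nat≈ (suc m)) (nat≈ n)))))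
               (-‿distribˡ-* _ _))
    int-* ℤ.-[1+ m ] ℤ.-[1+ n ] =
      trans (int-pos-◃ (suc m ℕ.* suc n))
        (trans (trans (×1-homo-* (suc m) (suc n)) (sym (*-cong (nat≈ (suc m)) (nat≈ (suc n)))))
               (trans (sym (-‿involutive _))
                      (trans (-‿cong (-‿distribʳ-* _ _)) (-‿distribˡ-* _ _))))

    int-homo : ℤ.+-*-rawRing -Raw-AlmostCommutative⟶ fromCommutativeRing commutativeRing
    int-homo = record
      { ⟦_⟧ = int; +-homo = int-+; *-homo = int-*; -‿homo = int-neg
      ; 0-homo = refl; 1-homo = refl }

    int≟ : WeaklyDecidable (Induced-equivalence int-homo)
    int≟ i j with i ℤ.≟ j
    ... | yes ≡.refl = just refl
    ... | no _       = nothing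

  open import Algebra.Solver.Ring
    ℤ.+-*-rawRing (fromCommutativeRing commutativeRing) int-homo int≟ public
    using (Polynomial; solve; _:=_; con; _:+_; _:*_; _:-_; :-_)

  # : ∀ {k} → ℕ → Polynomial k
  # n = con (ℤ.+ n)

  -- The standard way to prove a polynomial inequality below: the nonnegative gap `c` is exhibited,
  -- and the identity is left to the ring solver.
  ≤-by : ∀ {a b} c → 0# ≤ c → b ≈ a + c → a ≤ b
  ≤-by {a} c 0≤c b≈a+c = ≤-respʳ-≈ (trans (+-comm c a) (sym b≈a+c))
    (≤-respˡ-≈ (+-identityˡ a) (+-monoˡ-≤ a 0≤c))

  x≤y⇒0≤y-x : ∀ {x y} → x ≤ y → 0# ≤ y - x
  x≤y⇒0≤y-x {x} x≤y = ≤-respˡ-≈ (-‿inverseʳ x) (+-monoˡ-≤ (- x) x≤y)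

  0≤y-x⇒x≤y : ∀ {x y} → 0# ≤ y - x → x ≤ y
  0≤y-x⇒x≤y {x} {y} 0≤ = ≤-by (y - x) 0≤ (solve 2 (λ x y → y := x :+ (y :- x)) refl x y)

  <-by : ∀ {a b} c → 0# < c → b ≈ a + c → a < b
  <-by {a} {b} c (0≤c , 0≉c) b≈a+c = ≤-by c 0≤c b≈a+c , λ a≈b → 0≉c (begin
    0#         ≈⟨ -‿inverseʳ b ⟨
    b - b      ≈⟨ +-cong b≈a+c (-‿cong (sym a≈b)) ⟩
    a + c - a  ≈⟨ solve 2 (λ a c → a :+ c :- a := c) refl a c ⟩
    c          ∎)
    where open SetoidReasoning setoid

  x<y⇒0<y-x : ∀ {x y} → x < y → 0# < y - x
  x<y⇒0<y-x {x} {y} (x≤y , x≉y) = x≤y⇒0≤y-x x≤y , λ 0≈y-x → x≉y (begin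
    x            ≈⟨ +-identityʳ x ⟨
    x + 0#       ≈⟨ +-congˡ 0≈y-x ⟩
    x + (y - x)  ≈⟨ solve 2 (λ x y → x :+ (y :- x) := y) refl x y ⟩
    y            ∎)
    where open SetoidReasoning setoid

  <⇒≤ : ∀ {x y} → x < y → x ≤ y
  <⇒≤ = proj₁

  ≤-<-trans : ∀ {x y z} → x ≤ y → y < z → x < z
  ≤-<-trans = ToStrict.≤-<-trans _≈_ _≤_ ≤-trans antisym ≤-respˡ-≈

  <-≤-trans : ∀ {x y z} → x < y → y ≤ z → x < z
  <-≤-trans = ToStrict.<-≤-trans _≈_ _≤_ sym ≤-trans antisym ≤-respʳ-≈

  ≰⇒> : ∀ {x y} → ¬ (x ≤ y) → y < x
  ≰⇒> = ToStrict.≰⇒> _≈_ _≤_ sym ≤-reflexive ≤-total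

  <⇒≱ : ∀ {x y} → x < y → ¬ (y ≤ x)
  <⇒≱ = ToStrict.<⇒≱ _≈_ _≤_ antisym

  ≮⇒≥ : ∀ {x y} → ¬ (x < y) → y ≤ x
  ≮⇒≥ {x} {y} x≮y with y ≤? x
  ... | yes y≤x = y≤x
  ... | no  y≰x = ⊥-elim (x≮y (≰⇒> y≰x))

  +-mono-≤ : ∀ {a b c d} → a ≤ b → c ≤ d → a + c ≤ b + d
  +-mono-≤ {a} {b} {c} {d} a≤b c≤d = ≤-trans (+-monoˡ-≤ c a≤b)
    (≤-respˡ-≈ (+-comm c b) (≤-respʳ-≈ (+-comm d b) (+-monoˡ-≤ b c≤d)))

  +-monoʳ-≤ : ∀ {x y} z → x ≤ y → z + x ≤ z + y
  +-monoʳ-≤ z x≤y = +-mono-≤ ≤-refl x≤y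

  neg-mono-≤ : ∀ {x y} → x ≤ y → - y ≤ - x
  neg-mono-≤ {x} {y} x≤y =
    ≤-by (y - x) (x≤y⇒0≤y-x x≤y) (solve 2 (λ x y → :- x := :- y :+ (y :- x)) refl x y)

  +-nonNegative : ∀ {x y} → 0# ≤ x → 0# ≤ y → 0# ≤ x + y
  +-nonNegative 0≤x 0≤y = ≤-respˡ-≈ (+-identityˡ 0#) (+-mono-≤ 0≤x 0≤y)

  *-monoˡ-≤ : ∀ {x y z} → 0# ≤ z → x ≤ y → z * x ≤ z * y
  *-monoˡ-≤ {x} {y} {z} 0≤z x≤y = ≤-by (z * (y - x)) (*-nonNegative 0≤z (x≤y⇒0≤y-x x≤y))
    (solve 3 (λ x y z → z :* y := z :* x :+ z :* (y :- x)) refl x y z)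

  *-monoʳ-≤ : ∀ {x y z} → 0# ≤ z → x ≤ y → x * z ≤ y * z
  *-monoʳ-≤ {x} {y} {z} 0≤z x≤y =
    ≤-respˡ-≈ (*-comm z x) (≤-respʳ-≈ (*-comm z y) (*-monoˡ-≤ 0≤z x≤y))

  *-mono-≤ : ∀ {a b c d} → 0# ≤ a → a ≤ b → 0# ≤ c → c ≤ d → a * c ≤ b * d
  *-mono-≤ 0≤a a≤b 0≤c c≤d =
    ≤-trans (*-monoʳ-≤ 0≤c a≤b) (*-monoˡ-≤ (≤-trans 0≤a a≤b) c≤d)

  square-nonNegative : ∀ x → 0# ≤ x * x
  square-nonNegative x with ≤-total 0# x
  ... | inj₁ 0≤x = *-nonNegative 0≤x 0≤x
  ... | inj₂ x≤0 = ≤-respʳ-≈ (solve 1 (λ x → (# 0 :- x) :* (# 0 :- x) := x :* x) refl x)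
    (*-nonNegative (x≤y⇒0≤y-x x≤0) (x≤y⇒0≤y-x x≤0))

  0≤1 : 0# ≤ 1#
  0≤1 = ≤-respʳ-≈ (*-identityˡ 1#) (square-nonNegative 1#)

  0<1 : 0# < 1#
  0<1 = 0≤1 , 0≉1

  fromℕ-+ : ∀ m n → fromℕ (m ℕ.+ n) ≈ fromℕ m + fromℕ n
  fromℕ-+ = ×-homo-+ 1#

  fromℕ-* : ∀ m n → fromℕ (m ℕ.* n) ≈ fromℕ m * fromℕ n
  fromℕ-* = ×1-homo-*

  fromℕ-nonNegative : ∀ n → 0# ≤ fromℕ n
  fromℕ-nonNegative zero    = ≤-refl
  fromℕ-nonNegative (suc n) = +-nonNegative 0≤1 (fromℕ-nonNegative n)

  fromℕ-mono-≤ : ∀ {m n} → m ℕ.≤ n → fromℕ m ≤ fromℕ n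
  fromℕ-mono-≤ {n = n} ℕ.z≤n = fromℕ-nonNegative n
  fromℕ-mono-≤ (ℕ.s≤s m≤n)   = +-monoʳ-≤ 1# (fromℕ-mono-≤ m≤n)

  fromℕ-suc-positive : ∀ n → 0# < fromℕ (suc n)
  fromℕ-suc-positive n =
    <-≤-trans 0<1 (≤-by (fromℕ n) (fromℕ-nonNegative n) refl)

  >⇒≉0 : ∀ {x} → 0# < x → ¬ (x ≈ 0#)
  >⇒≉0 (_ , 0≉x) x≈0 = 0≉x (sym x≈0)

  *-inverse : ∀ {x} → 0# < x → x * x ⁻¹ ≈ 1#
  *-inverse 0<x = *-inverseʳ _ (>⇒≉0 0<x)

  *-cancelˡ-≤ : ∀ {x y z} → 0# < z → z * x ≤ z * y → x ≤ y
  *-cancelˡ-≤ {x} {y} {z} 0<z zx≤zy with x ≤? y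
  ... | yes x≤y = x≤y
  ... | no  x≰y = ⊥-elim (proj₂ y<x (sym x≈y))
    where
    y<x : y < x
    y<x = ≰⇒> x≰y
    cancel : ∀ w → z ⁻¹ * (z * w) ≈ w
    cancel w = trans (sym (*-assoc _ _ _)) (trans (*-congʳ (trans (*-comm _ _) (*-inverse 0<z))) (*-identityˡ w))
    x≈y : x ≈ y
    x≈y = trans (sym (cancel x))
      (trans (*-congˡ (antisym zx≤zy (*-monoˡ-≤ (<⇒≤ 0<z) (<⇒≤ y<x)))) (cancel y))

  *-cancelˡ-≈ : ∀ {x y z} → 0# < z → z * x ≈ z * y → x ≈ y
  *-cancelˡ-≈ 0<z zx≈zy =
    antisym (*-cancelˡ-≤ 0<z (≤-reflexive zx≈zy)) (*-cancelˡ-≤ 0<z (≤-reflexive (sym zx≈zy)))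

  *-positive : ∀ {x y} → 0# < x → 0# < y → 0# < x * y
  *-positive {x} {y} 0<x 0<y = *-nonNegative (<⇒≤ 0<x) (<⇒≤ 0<y) , λ 0≈xy →
    <⇒≱ 0<y (*-cancelˡ-≤ 0<x (≤-reflexive (trans (sym 0≈xy) (sym (zeroʳ x)))))

  ⁻¹-positive : ∀ {x} → 0# < x → 0# < x ⁻¹
  ⁻¹-positive {x} 0<x = ≰⇒> λ x⁻¹≤0 → <⇒≱ 0<1
    (≤-respˡ-≈ (*-inverse 0<x) (≤-respʳ-≈ (zeroʳ x) (*-monoˡ-≤ (<⇒≤ 0<x) x⁻¹≤0)))

  ⁻¹-unique : ∀ {x y} → 0# < x → x * y ≈ 1# → y ≈ x ⁻¹
  ⁻¹-unique 0<x xy≈1 = *-cancelˡ-≈ 0<x (trans xy≈1 (sym (*-inverse 0<x)))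

  ⁻¹-*-distrib : ∀ {x y} → 0# < x → 0# < y → (x * y) ⁻¹ ≈ x ⁻¹ * y ⁻¹
  ⁻¹-*-distrib {x} {y} 0<x 0<y = sym (⁻¹-unique (*-positive 0<x 0<y)
    (trans (solve 4 (λ x y a b → x :* y :* (a :* b) := (x :* a) :* (y :* b)) refl x y _ _)
      (trans (*-cong (*-inverse 0<x) (*-inverse 0<y)) (*-identityˡ 1#))))

  cross-multiply : ∀ {a b p q} → 0# < b → 0# < q → b * p ≈ a * q → p * q ⁻¹ ≈ a * b ⁻¹
  cross-multiply {a} {b} {p} {q} 0<b 0<q bp≈aq = *-cancelˡ-≈ (*-positive 0<b 0<q) (begin
    b * q * (p * q ⁻¹)    ≈⟨ solve 4 (λ b q p q′ → b :* q :* (p :* q′) := b :* p :* (q :* q′)) refl b q p (q ⁻¹) ⟩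
    b * p * (q * q ⁻¹)    ≈⟨ *-cong bp≈aq (trans (*-inverse 0<q) (sym (*-inverse 0<b))) ⟩
    a * q * (b * b ⁻¹)    ≈⟨ solve 4 (λ a q b b′ → a :* q :* (b :* b′) := b :* q :* (a :* b′)) refl a q b (b ⁻¹) ⟩
    b * q * (a * b ⁻¹)    ∎)
    where open SetoidReasoning setoid

-- Cauchy products of coefficient sequences.

module CauchyProduct {ℓ} (R : Reals ℓ) where
  open OrderedField R
  open import Algebra.Properties.CommutativeMonoid.Sum +-commutativeMonoid using (∑-distrib-+)
  open import Algebra.Properties.Semiring.Sum semiring using (*-distribˡ-sum)

  Seq : Set ℓ
  Seq = ℕ → Carrier

  partialSum : Seq → ℕ → Carrier
  partialSum a k = sum {k} λ i → a (toℕ i)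

  partialSum-nonNegative : ∀ {a} → (∀ i → 0# ≤ a i) → ∀ k → 0# ≤ partialSum a k
  partialSum-nonNegative 0≤a zero    = ≤-refl
  partialSum-nonNegative 0≤a (suc k) =
    +-nonNegative (0≤a 0) (partialSum-nonNegative (λ i → 0≤a (suc i)) k)

  partialSum-mono-≤ : ∀ {a} → (∀ i → 0# ≤ a i) → ∀ {k l} → k ℕ.≤ l → partialSum a k ≤ partialSum a l
  partialSum-mono-≤ 0≤a {l = l} ℕ.z≤n = partialSum-nonNegative 0≤a l
  partialSum-mono-≤ 0≤a (ℕ.s≤s k≤l)   = +-monoʳ-≤ _ (partialSum-mono-≤ (λ i → 0≤a (suc i)) k≤l)

  convolution : Seq → Seq → Seq
  convolution a b zero    = a 0 * b 0
  convolution a b (suc m) = a 0 * b (suc m) + convolution (a ∘ suc) b m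

  -- The sum of a i * b j over i + j < k, by rows.
  triangle : Seq → Seq → ℕ → Carrier
  triangle a b zero    = 0#
  triangle a b (suc k) = a 0 * partialSum b (suc k) + triangle (a ∘ suc) b k

  -- The same triangle summed by antidiagonals: removing the row of `a 0` removes the first summand
  -- of every convolution.
  triangle-convolution : ∀ a b k → triangle a b k ≈ partialSum (convolution a b) k
  triangle-convolution a b zero    = refl
  triangle-convolution a b (suc k) = begin
    a 0 * (b 0 + partialSum (b ∘ suc) k) + triangle (a ∘ suc) b k
      ≈⟨ +-cong (distribˡ _ _ _) (triangle-convolution (a ∘ suc) b k) ⟩
    a 0 * b 0 + a 0 * partialSum (b ∘ suc) k + partialSum (convolution (a ∘ suc) b) k
      ≈⟨ +-assoc _ _ _ ⟩
    a 0 * b 0 + (a 0 * partialSum (b ∘ suc) k + partialSum (convolution (a ∘ suc) b) k)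
      ≈⟨ +-congˡ (+-congʳ (*-distribˡ-sum {k} (a 0) (λ i → b (suc (toℕ i))))) ⟩
    a 0 * b 0 + (partialSum (λ j → a 0 * b (suc j)) k + partialSum (convolution (a ∘ suc) b) k)
      ≈⟨ +-congˡ (∑-distrib-+ {k} (λ i → a 0 * b (suc (toℕ i))) (λ i → convolution (a ∘ suc) b (toℕ i))) ⟨
    partialSum (convolution a b) (suc k) ∎
    where open SetoidReasoning setoid

  -- If i + j < k, then i < k and j < l, so the rectangle only adds nonnegative products.
  triangle≤square : ∀ {a b} → (∀ i → 0# ≤ a i) → (∀ i → 0# ≤ b i) → ∀ {k l} → k ℕ.≤ l →
                    triangle a b k ≤ partialSum a k * partialSum b l
  triangle≤square 0≤a 0≤b ℕ.z≤n = ≤-reflexive (sym (zeroˡ _))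
  triangle≤square 0≤a 0≤b (ℕ.s≤s k≤l) = ≤-respʳ-≈ (sym (distribʳ _ _ _))
    (+-mono-≤ (*-monoˡ-≤ (0≤a 0) (partialSum-mono-≤ 0≤b (ℕ.s≤s k≤l)))
              (triangle≤square (λ i → 0≤a (suc i)) 0≤b (ℕ.m≤n⇒m≤1+n k≤l)))

  -- If i < k and j < l, then i + j < k + l.
  square≤triangle : ∀ {a b} → (∀ i → 0# ≤ a i) → (∀ i → 0# ≤ b i) → ∀ k l →
                    partialSum a k * partialSum b l ≤ triangle a b (k ℕ.+ l)
  square≤triangle {a} {b} 0≤a 0≤b zero l = ≤-trans (≤-reflexive (zeroˡ _)) (nonNegative 0≤a l)
    where
    nonNegative : ∀ {a} → (∀ i → 0# ≤ a i) → ∀ k → 0# ≤ triangle a b k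
    nonNegative 0≤a zero    = ≤-refl
    nonNegative 0≤a (suc k) = +-nonNegative (*-nonNegative (0≤a 0) (partialSum-nonNegative 0≤b (suc k)))
                                            (nonNegative (λ i → 0≤a (suc i)) k)
  square≤triangle 0≤a 0≤b (suc k) l = ≤-respˡ-≈ (sym (distribʳ _ _ _))
    (+-mono-≤ (*-monoˡ-≤ (0≤a 0) (partialSum-mono-≤ 0≤b (ℕ.m≤n+m l (suc k))))
              (square≤triangle (λ i → 0≤a (suc i)) 0≤b k l))

  -- The difference consists of the products a i * b j with k ≤ i + j, which
  -- are monotone in a.
  square-triangle-mono : ∀ {a a′ b} → (∀ i → a i ≤ a′ i) → (∀ i → 0# ≤ b i) → ∀ {k l} → k ℕ.≤ l →
    partialSum a k * partialSum b l - triangle a b k ≤ partialSum a′ k * partialSum b l - triangle a′ b k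
  square-triangle-mono a≤a′ 0≤b ℕ.z≤n = +-monoˡ-≤ _ (≤-reflexive (trans (zeroˡ _) (sym (zeroˡ _))))
  square-triangle-mono {a} {a′} {b} a≤a′ 0≤b {suc k} {l} k<l =
    ≤-respˡ-≈ (sym (split a)) (≤-respʳ-≈ (sym (split a′))
      (+-mono-≤ (*-monoʳ-≤ (x≤y⇒0≤y-x (partialSum-mono-≤ 0≤b k<l)) (a≤a′ 0))
                (square-triangle-mono (λ i → a≤a′ (suc i)) 0≤b (ℕ.≤-trans (ℕ.n≤1+n k) k<l))))
    where
    split : ∀ a → partialSum a (suc k) * partialSum b l - triangle a b (suc k)
                ≈ a 0 * (partialSum b l - partialSum b (suc k))
                  + (partialSum (a ∘ suc) k * partialSum b l - triangle (a ∘ suc) b k)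
    split a = solve 5 (λ a₀ A B B′ T → (a₀ :+ A) :* B :- (a₀ :* B′ :+ T)
                                    := a₀ :* (B :- B′) :+ (A :* B :- T))
                refl _ _ _ _ _

  module _ {b : Seq} where
    convolution-+ˡ : ∀ {a a₁ a₂} → (∀ i → a i ≈ a₁ i + a₂ i) → ∀ m →
                     convolution a b m ≈ convolution a₁ b m + convolution a₂ b m
    convolution-+ˡ a≈ zero    = trans (*-congʳ (a≈ 0)) (distribʳ _ _ _)
    convolution-+ˡ a≈ (suc m) =
      trans (+-cong (*-congʳ (a≈ 0)) (convolution-+ˡ (λ i → a≈ (suc i)) m))
        (solve 5 (λ x y b p q → (x :+ y) :* b :+ (p :+ q) := (x :* b :+ p) :+ (y :* b :+ q)) refl _ _ _ _ _)

    convolution-*ˡ : ∀ {a a₁} x → (∀ i → a i ≈ x * a₁ i) → ∀ m → convolution a b m ≈ x * convolution a₁ b m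
    convolution-*ˡ x a≈ zero    = trans (*-congʳ (a≈ 0)) (*-assoc _ _ _)
    convolution-*ˡ x a≈ (suc m) =
      trans (+-cong (trans (*-congʳ (a≈ 0)) (*-assoc _ _ _)) (convolution-*ˡ x (λ i → a≈ (suc i)) m))
        (sym (distribˡ _ _ _))

  convolution-*ʳ : ∀ {a b b₁} y → (∀ i → b i ≈ y * b₁ i) → ∀ m → convolution a b m ≈ y * convolution a b₁ m
  convolution-*ʳ y b≈ zero = trans (*-congˡ (b≈ 0)) (solve 3 (λ a y b → a :* (y :* b) := y :* (a :* b)) refl _ _ _)
  convolution-*ʳ {a} {b} {b₁} y b≈ (suc m) =
    trans (+-cong (*-congˡ (b≈ (suc m))) (convolution-*ʳ y b≈ m))
      (solve 4 (λ a y b c → a :* (y :* b) :+ y :* c := y :* (a :* b :+ c)) refl _ _ _ _)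

  derivative : Seq → Seq
  derivative a i = fromℕ (suc i) * a (suc i)

  -- The Leibniz rule for formal power series. It takes the place of the binomial theorem:
  -- additivity of the exponential will come from its differential equation.
  convolution-derivative : ∀ a b m → derivative (convolution a b) m
                                   ≈ convolution (derivative a) b m + convolution a (derivative b) m
  convolution-derivative a b zero =
    solve 4 (λ a₀ a₁ b₀ b₁ → (# 1 :+ # 0) :* (a₀ :* b₁ :+ a₁ :* b₀)
                          := (# 1 :+ # 0) :* a₁ :* b₀ :+ a₀ :* ((# 1 :+ # 0) :* b₁))
      refl _ _ _ _
  convolution-derivative a b (suc m) = begin
    (1# + M) * (a 0 * b (2 ℕ.+ m) + (a 1 * b (suc m) + C))
      -- Of the `1# + M` copies of the tail one is set aside. The other `M` form the derivative of
      -- the convolution of `a ∘ suc` with `b`, to which the induction hypothesis applies.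
      ≈⟨ solve 6 (λ M a₀ b₂ a₁ b₁ C → (# 1 :+ M) :* (a₀ :* b₂ :+ (a₁ :* b₁ :+ C))
                    := a₀ :* ((# 1 :+ M) :* b₂) :+ (a₁ :* b₁ :+ C) :+ M :* (a₁ :* b₁ :+ C))
           refl _ _ _ _ _ _ ⟩
    a 0 * ((1# + M) * b (2 ℕ.+ m)) + (a 1 * b (suc m) + C) + M * (a 1 * b (suc m) + C)
      ≈⟨ +-congˡ (convolution-derivative (a ∘ suc) b m) ⟩
    a 0 * ((1# + M) * b (2 ℕ.+ m)) + (a 1 * b (suc m) + C)
      + (convolution (derivative (a ∘ suc)) b m + convolution (a ∘ suc) (derivative b) m)
      ≈⟨ solve 6 (λ x a₁ b₁ C D F → x :+ (a₁ :* b₁ :+ C) :+ (D :+ F)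
                    := ((# 1 :+ # 0) :* a₁ :* b₁ :+ (C :+ D)) :+ (x :+ F))
           refl _ _ _ _ _ _ ⟩
    (derivative a 0 * b (suc m) + (C + convolution (derivative (a ∘ suc)) b m))
      + (a 0 * derivative b (suc m) + convolution (a ∘ suc) (derivative b) m)
      -- Derivative and shift commute only up to one copy of the shifted sequence; the tail set
      -- aside supplies it.
      ≈⟨ +-congʳ (+-congˡ (convolution-+ˡ {b} {derivative a ∘ suc}
           (λ i → trans (distribʳ _ _ _) (+-congʳ (*-identityˡ _))) m)) ⟨
    convolution (derivative a) b (suc m) + convolution a (derivative b) (suc m) ∎
    where
    open SetoidReasoning setoid
    M = fromℕ (suc m)
    C = convolution (a ∘ suc ∘ suc) b m

-- The exponential function and bounds on logarithms.

module Exponential {ℓ} (R : Reals ℓ) where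
  open OrderedField R
  open Analysis R
  open CauchyProduct R
  open import Algebra.Properties.CommutativeMonoid.Sum +-commutativeMonoid using (sum-cong-≋)
  open import Algebra.Properties.Ring ring using (-0#≈0#)

  term : Carrier → Seq
  term x i = x ^ i * fromℕ (i !) ⁻¹

  fromℕ-!-positive : ∀ i → 0# < fromℕ (i !)
  fromℕ-!-positive i = <-≤-trans (fromℕ-suc-positive 0) (fromℕ-mono-≤ (ℕ.1≤n! i))

  -- The differential equation of z ↦ exp (x z), read off coefficient by coefficient.
  derivative-term : ∀ x i → derivative (term x) i ≈ x * term x i
  derivative-term x i = begin
    s * (x * x ^ i * fromℕ (suc i !) ⁻¹)  ≈⟨ *-congˡ (*-congˡ (trans (⁻¹-cong (fromℕ-* (suc i) (i !)))
                                               (⁻¹-*-distrib (fromℕ-suc-positive i) (fromℕ-!-positive i)))) ⟩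
    s * (x * x ^ i * (s ⁻¹ * f ⁻¹))       ≈⟨ solve 5 (λ s x p t g → s :* (x :* p :* (t :* g))
                                                       := s :* t :* (x :* (p :* g))) refl _ _ _ _ _ ⟩
    s * s ⁻¹ * (x * (x ^ i * f ⁻¹))       ≈⟨ *-congʳ (*-inverse (fromℕ-suc-positive i)) ⟩
    1# * (x * (x ^ i * f ⁻¹))             ≈⟨ *-identityˡ _ ⟩
    x * term x i                          ∎
    where
    open SetoidReasoning setoid
    s = fromℕ (suc i)
    f = fromℕ (i !)

  term-0 : ∀ x → term x 0 ≈ 1#
  term-0 x = trans (*-identityˡ _)
    (sym (⁻¹-unique (fromℕ-suc-positive 0) (solve 0 ((# 1 :+ # 0) :* # 1 := # 1) refl)))

  term-nonNegative : ∀ {x} → 0# ≤ x → ∀ i → 0# ≤ term x i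
  term-nonNegative {x} 0≤x i = *-nonNegative (power i) (<⇒≤ (⁻¹-positive (fromℕ-!-positive i)))
    where
    power : ∀ i → 0# ≤ x ^ i
    power zero    = 0≤1
    power (suc i) = *-nonNegative 0≤x (power i)

  term-neg-≤ : ∀ {x} → 0# ≤ x → ∀ i → term (- x) i ≤ term x i
  term-neg-≤ {x} 0≤x i = *-monoʳ-≤ (<⇒≤ (⁻¹-positive (fromℕ-!-positive i))) (proj₁ (power i))
    where
    -- Both signs are carried along, because multiplication by `- x` exchanges them.
    power : ∀ i → (- x) ^ i ≤ x ^ i × - ((- x) ^ i) ≤ x ^ i
    power zero = ≤-refl , ≤-by (1# + 1#) (+-nonNegative 0≤1 0≤1) (solve 0 (# 1 := (:- # 1) :+ (# 1 :+ # 1)) refl)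
    power (suc i) =
      ≤-respˡ-≈ (solve 2 (λ x y → x :* (:- y) := (:- x) :* y) refl _ _) (*-monoˡ-≤ 0≤x (proj₂ (power i))) ,
      ≤-respˡ-≈ (solve 2 (λ x y → x :* y := :- ((:- x) :* y)) refl _ _) (*-monoˡ-≤ 0≤x (proj₁ (power i)))

  -- By the Leibniz rule both sides satisfy (m + 1) c (m + 1) = (x + y) c m with c 0 = 1, which
  -- determines them.
  convolution-term : ∀ x y m → convolution (term x) (term y) m ≈ term (x + y) m
  convolution-term x y zero =
    trans (*-cong (term-0 x) (term-0 y)) (trans (*-identityˡ 1#) (sym (term-0 (x + y))))
  convolution-term x y (suc m) = *-cancelˡ-≈ (fromℕ-suc-positive m) (begin
    derivative (convolution (term x) (term y)) m
      ≈⟨ convolution-derivative (term x) (term y) m ⟩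
    convolution (derivative (term x)) (term y) m + convolution (term x) (derivative (term y)) m
      ≈⟨ +-cong (convolution-*ˡ x (derivative-term x) m) (convolution-*ʳ y (derivative-term y) m) ⟩
    x * convolution (term x) (term y) m + y * convolution (term x) (term y) m
      ≈⟨ distribʳ _ _ _ ⟨
    (x + y) * convolution (term x) (term y) m
      ≈⟨ *-congˡ (convolution-term x y m) ⟩
    (x + y) * term (x + y) m
      ≈⟨ derivative-term (x + y) m ⟨
    derivative (term (x + y)) m ∎)
    where open SetoidReasoning setoid

  triangle-term : ∀ x y k → triangle (term x) (term y) k ≈ expPartialSum (x + y) k
  triangle-term x y k = trans (triangle-convolution (term x) (term y) k)
    (sum-cong-≋ {k} λ i → convolution-term x y (toℕ i))

  expPartialSum-cong : ∀ {x y} → x ≈ y → ∀ k → expPartialSum x k ≈ expPartialSum y k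
  expPartialSum-cong {x} {y} x≈y k = sum-cong-≋ {k} λ i → *-congʳ (power (toℕ i))
    where
    power : ∀ i → x ^ i ≈ y ^ i
    power zero    = refl
    power (suc i) = *-cong x≈y (power i)

  expPartialSum-+-≤ : ∀ {x y} → 0# ≤ x → 0# ≤ y → ∀ k →
                      expPartialSum (x + y) k ≤ expPartialSum x k * expPartialSum y k
  expPartialSum-+-≤ {x} {y} 0≤x 0≤y k = ≤-respˡ-≈ (triangle-term x y k)
    (triangle≤square (term-nonNegative 0≤x) (term-nonNegative 0≤y) {k} ℕ.≤-refl)

  expPartialSum-+-≥ : ∀ {x y} → 0# ≤ x → 0# ≤ y → ∀ k l →
                      expPartialSum x k * expPartialSum y l ≤ expPartialSum (x + y) (k ℕ.+ l)
  expPartialSum-+-≥ {x} {y} 0≤x 0≤y k l = ≤-respʳ-≈ (triangle-term x y (k ℕ.+ l))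
    (square≤triangle (term-nonNegative 0≤x) (term-nonNegative 0≤y) k l)

  expPartialSum-nonNegative : ∀ {x} → 0# ≤ x → ∀ k → 0# ≤ expPartialSum x k
  expPartialSum-nonNegative 0≤x = partialSum-nonNegative (term-nonNegative 0≤x)

  geometric-≤ : ∀ {a} → (∀ i → 0# ≤ a i) → (∀ i → fromℕ 2 * a (suc i) ≤ a i) → ∀ k →
                partialSum a k ≤ fromℕ 2 * a 0
  geometric-≤ 0≤a halving zero    = *-nonNegative (fromℕ-nonNegative 2) (0≤a 0)
  geometric-≤ 0≤a halving (suc k) = ≤-trans
    (+-monoʳ-≤ _ (≤-trans (geometric-≤ (λ i → 0≤a (suc i)) (λ i → halving (suc i)) k) (halving 0)))
    (≤-reflexive (solve 1 (λ x → x :+ x := # 2 :* x) refl _))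

  term-1 : ∀ x → term x 1 ≈ x
  term-1 x = *-cancelˡ-≈ (fromℕ-suc-positive 0) (trans (derivative-term x 0) (trans (*-congˡ (term-0 x))
    (solve 1 (λ x → x :* # 1 := (# 1 :+ # 0) :* x) refl x)))

  -- For x ≤ 1 the terms at least halve from index 2 on, so together they are at most twice the
  -- first of them, x² / 2.
  expPartialSum-≤ : ∀ {x} → 0# ≤ x → x ≤ 1# → ∀ k → expPartialSum x k ≤ 1# + x + x * x
  expPartialSum-≤ {x} 0≤x x≤1 k = ≤-trans (partialSum-mono-≤ (term-nonNegative 0≤x) (ℕ.m≤n+m k 2))
    (≤-respˡ-≈ (sym (trans (+-cong (term-0 x) (+-congʳ (term-1 x))) (sym (+-assoc _ _ _))))
      (+-monoʳ-≤ (1# + x) (≤-trans (geometric-≤ (λ i → term-nonNegative 0≤x (2 ℕ.+ i)) halving k)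
        (≤-reflexive (trans (derivative-term x 1) (*-congˡ (term-1 x)))))))
    where
    halving : ∀ i → fromℕ 2 * term x (3 ℕ.+ i) ≤ term x (2 ℕ.+ i)
    halving i = begin
      fromℕ 2 * term x (3 ℕ.+ i)  ≤⟨ *-monoʳ-≤ (term-nonNegative 0≤x (3 ℕ.+ i)) (fromℕ-mono-≤ (ℕ.m≤m+n 2 (suc i))) ⟩
      derivative (term x) (2 ℕ.+ i) ≈⟨ derivative-term x (2 ℕ.+ i) ⟩
      x * term x (2 ℕ.+ i)        ≤⟨ *-monoʳ-≤ (term-nonNegative 0≤x (2 ℕ.+ i)) x≤1 ⟩
      1# * term x (2 ℕ.+ i)       ≈⟨ *-identityˡ _ ⟩
      term x (2 ℕ.+ i)            ∎
      where open ≤-Reasoning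

  expPartialSum-≤3 : ∀ {x} → 0# ≤ x → x ≤ 1# → ∀ k → expPartialSum x k ≤ fromℕ 3
  expPartialSum-≤3 {x} 0≤x x≤1 k = ≤-trans (expPartialSum-≤ 0≤x x≤1 k)
    (≤-respʳ-≈ (solve 0 (# 1 :+ # 1 :+ # 1 :* # 1 := # 3) refl)
      (+-mono-≤ (+-monoʳ-≤ 1# x≤1) (*-mono-≤ 0≤x x≤1 0≤x x≤1)))

  -- Supplies the upper bound that `supremum` demands. The recursion on a natural number above x
  -- takes 1 off x and pays a factor 3 each time.
  expPartialSum-bounded : ∀ {x} → 0# ≤ x → ∃ λ B → ∀ k → expPartialSum x k ≤ B
  expPartialSum-bounded {x} 0≤x with archimedean x
  ... | n , x≤n = bound n 0≤x x≤n
    where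
    bound : ∀ n {x} → 0# ≤ x → x ≤ fromℕ n → ∃ λ B → ∀ k → expPartialSum x k ≤ B
    bound n {x} 0≤x x≤n with x ≤? 1#
    bound n       0≤x x≤n | yes x≤1 = fromℕ 3 , expPartialSum-≤3 0≤x x≤1
    bound zero    0≤x x≤0 | no x≰1  = ⊥-elim (x≰1 (≤-trans x≤0 0≤1))
    bound (suc n) {x} 0≤x x≤n | no x≰1
      with 0≤x-1 ← x≤y⇒0≤y-x (<⇒≤ (≰⇒> x≰1))
      with B , E≤B ← bound n 0≤x-1 (≤-respʳ-≈ (solve 1 (λ n → # 1 :+ n :- # 1 := n) refl _) (+-monoˡ-≤ (- 1#) x≤n))
      = B * fromℕ 3 , λ k → ≤-trans
          (≤-respˡ-≈ (expPartialSum-cong (solve 1 (λ x → x :- # 1 :+ # 1 := x) refl x) k)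
            (expPartialSum-+-≤ 0≤x-1 0≤1 k))
          (*-mono-≤ (expPartialSum-nonNegative 0≤x-1 k) (E≤B k)
            (expPartialSum-nonNegative 0≤1 k) (expPartialSum-≤3 0≤1 ≤-refl k))

  private
    expSup : ∀ {x} (0≤x : 0# ≤ x) →
             ∃ λ s → UpperBound (λ y → ∃ λ k → y ≈ expPartialSum x k) s ×
                     (∀ u → UpperBound (λ y → ∃ λ k → y ≈ expPartialSum x k) u → s ≤ u)
    expSup 0≤x with B , E≤B ← expPartialSum-bounded 0≤x =
      supremum _ (_ , 0 , refl) (B , λ { y (k , y≈) → ≤-respˡ-≈ (sym y≈) (E≤B k) })

  opaque
    exp⁺ : ∀ {x} → 0# ≤ x → Carrier
    exp⁺ 0≤x = proj₁ (expSup 0≤x)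

    exp⁺-upper : ∀ {x} (0≤x : 0# ≤ x) k → expPartialSum x k ≤ exp⁺ 0≤x
    exp⁺-upper 0≤x k = proj₁ (proj₂ (expSup 0≤x)) _ (k , refl)

    exp⁺-least : ∀ {x} (0≤x : 0# ≤ x) {u} → (∀ k → expPartialSum x k ≤ u) → exp⁺ 0≤x ≤ u
    exp⁺-least 0≤x E≤u = proj₂ (proj₂ (expSup 0≤x)) _ λ { y (k , y≈) → ≤-respˡ-≈ (sym y≈) (E≤u k) }

  -- Allows the supremum to be taken in one factor of a product. The case `c ≈ 0#`, where division
  -- by `c` fails, does occur: the empty partial sum is `0#`.
  exp⁺-least-* : ∀ {x} (0≤x : 0# ≤ x) {c u} → 0# ≤ c → (∀ k → c * expPartialSum x k ≤ u) → c * exp⁺ 0≤x ≤ u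
  exp⁺-least-* 0≤x {c} {u} 0≤c cE≤u with c ≟ 0#
  ... | yes c≈0 = ≤-respˡ-≈ (trans (zeroʳ c) (sym (trans (*-congʳ c≈0) (zeroˡ _)))) (cE≤u 0)
  ... | no  c≉0 = ≤-respʳ-≈ (rescale u)
        (*-monoˡ-≤ 0≤c (exp⁺-least 0≤x λ k → *-cancelˡ-≤ 0<c (≤-respʳ-≈ (sym (rescale u)) (cE≤u k))))
    where
    0<c : 0# < c
    0<c = 0≤c , λ 0≈c → c≉0 (sym 0≈c)
    rescale : ∀ u → c * (c ⁻¹ * u) ≈ u
    rescale u = trans (sym (*-assoc _ _ _)) (trans (*-congʳ (*-inverse 0<c)) (*-identityˡ u))

  1+x≤exp⁺ : ∀ {x} (0≤x : 0# ≤ x) → 1# + x ≤ exp⁺ 0≤x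
  1+x≤exp⁺ {x} 0≤x = ≤-respˡ-≈ (+-cong (term-0 x) (trans (+-identityʳ _) (term-1 x))) (exp⁺-upper 0≤x 2)

  exp⁺-positive : ∀ {x} (0≤x : 0# ≤ x) → 0# < exp⁺ 0≤x
  exp⁺-positive {x} 0≤x = <-≤-trans 0<1 (≤-trans (≤-by x 0≤x refl) (1+x≤exp⁺ 0≤x))

  -- Products of partial sums with k and l terms lie below the partial sum at x + y with k + l
  -- terms; the suprema over k and l are then taken one after the other.
  exp⁺-+ : ∀ {x y z} (0≤x : 0# ≤ x) (0≤y : 0# ≤ y) (0≤z : 0# ≤ z) → z ≈ x + y →
           exp⁺ 0≤z ≈ exp⁺ 0≤x * exp⁺ 0≤y
  exp⁺-+ {x} {y} {z} 0≤x 0≤y 0≤z z≈x+y = antisym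
    (exp⁺-least 0≤z λ k → ≤-respˡ-≈ (expPartialSum-cong (sym z≈x+y) k)
      (≤-trans (expPartialSum-+-≤ 0≤x 0≤y k)
        (*-mono-≤ (expPartialSum-nonNegative 0≤x k) (exp⁺-upper 0≤x k)
                  (expPartialSum-nonNegative 0≤y k) (exp⁺-upper 0≤y k))))
    (exp⁺-least-* 0≤y (<⇒≤ (exp⁺-positive 0≤x)) λ l → ≤-respˡ-≈ (*-comm _ _)
      (exp⁺-least-* 0≤x (expPartialSum-nonNegative 0≤y l) λ k → ≤-respˡ-≈ (*-comm _ _)
        (≤-trans (expPartialSum-+-≥ 0≤x 0≤y k l)
          (≤-respˡ-≈ (expPartialSum-cong z≈x+y (k ℕ.+ l)) (exp⁺-upper 0≤z (k ℕ.+ l))))))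

  pos : Carrier → Carrier
  pos x with 0# ≤? x
  ... | yes _ = x
  ... | no  _ = 0#

  0≤pos : ∀ x → 0# ≤ pos x
  0≤pos x with 0# ≤? x
  ... | yes 0≤x = 0≤x
  ... | no  _   = ≤-refl

  pos-neg : ∀ x → pos x - pos (- x) ≈ x
  pos-neg x with 0# ≤? x | 0# ≤? - x
  ... | yes 0≤x | yes 0≤-x = trans (solve 1 (λ x → x :- (:- x) := x :+ x) refl x)
                               (trans (+-congˡ x≈0) (+-identityʳ x))
    where
    x≈0 : x ≈ 0#
    x≈0 = antisym (0≤y-x⇒x≤y (≤-respʳ-≈ (sym (+-identityˡ _)) 0≤-x)) 0≤x
  ... | yes _   | no _     = solve 1 (λ x → x :- # 0 := x) refl x
  ... | no _    | yes _    = solve 1 (λ x → # 0 :- (:- x) := x) refl x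
  ... | no 0≰x  | no 0≰-x  = ⊥-elim (0≰-x (≤-respʳ-≈ (+-identityˡ _) (x≤y⇒0≤y-x (<⇒≤ (≰⇒> 0≰x)))))

  opaque
    exp : Carrier → Carrier
    exp x = exp⁺ (0≤pos x) * exp⁺ (0≤pos (- x)) ⁻¹

    -- Any two nonnegative numbers with difference z compute `exp z`, not just the positive and
    -- negative parts in the definition. Congruence and additivity rest on this freedom.
    exp-difference : ∀ {x y z} (0≤x : 0# ≤ x) (0≤y : 0# ≤ y) → z ≈ x - y → exp z ≈ exp⁺ 0≤x * exp⁺ 0≤y ⁻¹
    exp-difference {x} {y} {z} 0≤x 0≤y z≈x-y =
      cross-multiply (exp⁺-positive 0≤y) (exp⁺-positive (0≤pos (- z)))
        (trans (sym (exp⁺-+ 0≤y (0≤pos z) y+p refl)) (exp⁺-+ 0≤x (0≤pos (- z)) y+p eq))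
      where
      y+p : 0# ≤ y + pos z
      y+p = +-nonNegative 0≤y (0≤pos z)
      eq : y + pos z ≈ x + pos (- z)
      eq = trans (solve 3 (λ y p q → y :+ p := y :+ (p :- q) :+ q) refl y (pos z) (pos (- z)))
        (+-congʳ (trans (+-congˡ (trans (pos-neg z) z≈x-y)) (solve 2 (λ x y → y :+ (x :- y) := x) refl x y)))

    exp-positive : ∀ x → 0# < exp x
    exp-positive x = *-positive (exp⁺-positive (0≤pos x)) (⁻¹-positive (exp⁺-positive (0≤pos (- x))))

    exp-+ : ∀ x y → exp (x + y) ≈ exp x * exp y
    exp-+ x y = begin
      exp (x + y)
        ≈⟨ exp-difference (+-nonNegative (0≤pos x) (0≤pos y)) (+-nonNegative (0≤pos (- x)) (0≤pos (- y)))
             (trans (+-cong (sym (pos-neg x)) (sym (pos-neg y)))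
               (solve 4 (λ a b c d → a :- b :+ (c :- d) := a :+ c :- (b :+ d)) refl _ _ _ _)) ⟩
      exp⁺ (+-nonNegative (0≤pos x) (0≤pos y)) * exp⁺ (+-nonNegative (0≤pos (- x)) (0≤pos (- y))) ⁻¹
        ≈⟨ *-cong (exp⁺-+ (0≤pos x) (0≤pos y) (+-nonNegative (0≤pos x) (0≤pos y)) refl)
             (trans (⁻¹-cong (exp⁺-+ (0≤pos (- x)) (0≤pos (- y)) (+-nonNegative (0≤pos (- x)) (0≤pos (- y))) refl))
               (⁻¹-*-distrib (exp⁺-positive (0≤pos (- x))) (exp⁺-positive (0≤pos (- y))))) ⟩
      exp⁺ (0≤pos x) * exp⁺ (0≤pos y) * (exp⁺ (0≤pos (- x)) ⁻¹ * exp⁺ (0≤pos (- y)) ⁻¹)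
        ≈⟨ solve 4 (λ a c b d → a :* c :* (b :* d) := (a :* b) :* (c :* d)) refl _ _ _ _ ⟩
      exp x * exp y ∎
      where open SetoidReasoning setoid

  exp-exp⁺ : ∀ {x} (0≤x : 0# ≤ x) → exp x ≈ exp⁺ 0≤x
  exp-exp⁺ {x} 0≤x = trans (exp-difference 0≤x ≤-refl (solve 1 (λ x → x := x :- # 0) refl x))
    (trans (*-congˡ (trans (⁻¹-cong exp⁺0≈1) (sym (⁻¹-unique 0<1 (*-identityˡ 1#))))) (*-identityʳ _))
    where
    exp⁺0≈1 : exp⁺ ≤-refl ≈ 1#
    exp⁺0≈1 = antisym
      (≤-respʳ-≈ (solve 0 (# 1 :+ # 0 :+ # 0 :* # 0 := # 1) refl) (exp⁺-least ≤-refl (expPartialSum-≤ ≤-refl 0≤1)))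
      (≤-respˡ-≈ (+-identityʳ 1#) (1+x≤exp⁺ ≤-refl))

  -- Not immediate from the definition, since `pos` branches on a decision about its argument. Here
  -- both values are computed from the parts of `y`.
  exp-cong : ∀ {x y} → x ≈ y → exp x ≈ exp y
  exp-cong {x} {y} x≈y = trans
    (exp-difference (0≤pos y) (0≤pos (- y)) (trans x≈y (sym (pos-neg y))))
    (sym (exp-difference (0≤pos y) (0≤pos (- y)) (sym (pos-neg y))))

  exp-0 : exp 0# ≈ 1#
  exp-0 = *-cancelˡ-≈ (exp-positive 0#)
    (trans (sym (exp-+ 0# 0#)) (trans (exp-cong (+-identityˡ 0#)) (sym (*-identityʳ _))))

  exp-neg : ∀ x → exp x * exp (- x) ≈ 1#
  exp-neg x = trans (sym (exp-+ x (- x))) (trans (exp-cong (-‿inverseʳ x)) exp-0)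

  exp-≤-unit : ∀ {x} → 0# ≤ x → x ≤ 1# → exp x ≤ 1# + x + x * x
  exp-≤-unit 0≤x x≤1 = ≤-respˡ-≈ (sym (exp-exp⁺ 0≤x)) (exp⁺-least 0≤x (expPartialSum-≤ 0≤x x≤1))

  -- Below -1 the left side is negative. Between -1 and 0 the claim is multiplied by exp (-x) ≤ 1 -
  -- x + x², and (1 - x + x²)(1 + x) = 1 + x³ ≤ 1.
  1+x≤exp : ∀ x → 1# + x ≤ exp x
  1+x≤exp x with 0# ≤? x | - 1# ≤? x
  ... | yes 0≤x | _ = ≤-respʳ-≈ (sym (exp-exp⁺ 0≤x)) (1+x≤exp⁺ 0≤x)
  ... | no  _   | no -1≰x = ≤-trans (≤-respʳ-≈ (-‿inverseʳ 1#) (+-monoʳ-≤ 1# (<⇒≤ (≰⇒> -1≰x))))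
                              (<⇒≤ (exp-positive x))
  ... | no  0≰x | yes -1≤x = *-cancelˡ-≤ (exp-positive (- x)) (begin
      exp (- x) * (1# + x)                 ≤⟨ *-monoʳ-≤ 0≤1+x (exp-≤-unit 0≤-x -x≤1) ⟩
      (1# + - x + - x * - x) * (1# + x)    ≤⟨ ≤-by _ (*-nonNegative 0≤-x (*-nonNegative 0≤-x 0≤-x))
                                                (solve 1 (λ x → # 1 := (# 1 :+ (:- x) :+ (:- x) :* (:- x)) :* (# 1 :+ x)
                                                   :+ (:- x) :* ((:- x) :* (:- x))) refl x) ⟩
      1#                                   ≈⟨ trans (*-comm _ _) (exp-neg x) ⟨
      exp (- x) * exp x                    ∎)
    where
    open ≤-Reasoning
    0≤-x : 0# ≤ - x
    0≤-x = ≤-respʳ-≈ (+-identityˡ _) (x≤y⇒0≤y-x (<⇒≤ (≰⇒> 0≰x)))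
    0≤1+x : 0# ≤ 1# + x
    0≤1+x = ≤-respˡ-≈ (-‿inverseʳ 1#) (+-monoʳ-≤ 1# -1≤x)
    -x≤1 : - x ≤ 1#
    -x≤1 = ≤-respʳ-≈ (solve 0 (:- (:- # 1) := # 1) refl) (neg-mono-≤ -1≤x)

  -- For negative x, multiplication by exp (-x) ≥ 1 - x reduces the claim to (1 - x)(1 + x + x²) = 1
  -- - x³ ≥ 1.
  exp-≤-quadratic : ∀ {x} → - 1# ≤ x → x ≤ 1# → exp x ≤ 1# + x + x * x
  exp-≤-quadratic {x} -1≤x x≤1 with 0# ≤? x
  ... | yes 0≤x = exp-≤-unit 0≤x x≤1
  ... | no  0≰x = *-cancelˡ-≤ (exp-positive (- x)) (begin
      exp (- x) * exp x                   ≈⟨ trans (*-comm _ _) (exp-neg x) ⟩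
      1#                                  ≤⟨ ≤-by _ (*-nonNegative 0≤-x (*-nonNegative 0≤-x 0≤-x))
                                                (solve 1 (λ x → (# 1 :+ (:- x)) :* (# 1 :+ x :+ x :* x)
                                                   := # 1 :+ (:- x) :* ((:- x) :* (:- x))) refl x) ⟩
      (1# + - x) * (1# + x + x * x)       ≤⟨ *-monoʳ-≤ 0≤q (1+x≤exp (- x)) ⟩
      exp (- x) * (1# + x + x * x)        ∎)
    where
    open ≤-Reasoning
    0≤-x : 0# ≤ - x
    0≤-x = ≤-respʳ-≈ (+-identityˡ _) (x≤y⇒0≤y-x (<⇒≤ (≰⇒> 0≰x)))
    0≤q : 0# ≤ 1# + x + x * x
    0≤q = +-nonNegative (≤-respˡ-≈ (-‿inverseʳ 1#) (+-monoʳ-≤ 1# -1≤x)) (square-nonNegative x)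

  exp-mono-≤ : ∀ {x y} → x ≤ y → exp x ≤ exp y
  exp-mono-≤ {x} {y} x≤y = begin
    exp x                ≈⟨ *-identityʳ _ ⟨
    exp x * 1#           ≤⟨ *-monoˡ-≤ (<⇒≤ (exp-positive x))
                              (≤-trans (≤-by (y - x) (x≤y⇒0≤y-x x≤y) refl) (1+x≤exp (y - x))) ⟩
    exp x * exp (y - x)  ≈⟨ exp-+ x (y - x) ⟨
    exp (x + (y - x))    ≈⟨ exp-cong (solve 2 (λ x y → x :+ (y :- x) := y) refl x y) ⟩
    exp y                ∎
    where open ≤-Reasoning

  -- The right-hand side tends to 1, as it should since exp (- x) * exp x ≈ 1.
  expPartialSum-neg-*-≤ : ∀ {x} (0≤x : 0# ≤ x) k →
    expPartialSum (- x) k * expPartialSum x k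
      ≤ expPartialSum 0# k + (exp⁺ (+-nonNegative 0≤x 0≤x) - expPartialSum (x + x) k)
  expPartialSum-neg-*-≤ {x} 0≤x k = begin
    P * Q
      ≈⟨ solve 2 (λ p t → p := t :+ (p :- t)) refl (P * Q) (triangle (term (- x)) (term x) k) ⟩
    triangle (term (- x)) (term x) k + (P * Q - triangle (term (- x)) (term x) k)
      ≤⟨ +-mono-≤ (≤-reflexive (trans (triangle-term (- x) x k) (expPartialSum-cong (-‿inverseˡ x) k)))
           (square-triangle-mono (term-neg-≤ 0≤x) (term-nonNegative 0≤x) {k} ℕ.≤-refl) ⟩
    expPartialSum 0# k + (Q * Q - triangle (term x) (term x) k)
      ≤⟨ +-monoʳ-≤ _ (+-mono-≤ (≤-trans (expPartialSum-+-≥ 0≤x 0≤x k k) (exp⁺-upper _ (k ℕ.+ k)))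
           (≤-reflexive (-‿cong (triangle-term x x k)))) ⟩
    expPartialSum 0# k + (exp⁺ (+-nonNegative 0≤x 0≤x) - expPartialSum (x + x) k) ∎
    where
    open ≤-Reasoning
    P = expPartialSum (- x) k
    Q = expPartialSum x k

  -- For l < 0, the partial sums at l would eventually be at least 3, those at - l
  -- are at least 1, and yet the products are eventually at most 2.
  IsLog⇒nonNegative : ∀ {n l} → 4 ℕ.≤ n → IsLog (fromℕ n) l → 0# ≤ l
  IsLog⇒nonNegative {n} {l} 4≤n E⟶n with 0# ≤? l | E⟶n 1# 0<1
  ... | yes 0≤l | _       = 0≤l
  ... | no  0≰l | N , eventually = ⊥-elim (<⇒≱ {s - 1#} {s} s-1<s (exp⁺-least 0≤2x below))
    where
    open ≤-Reasoning
    x = - l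
    0≤x : 0# ≤ x
    0≤x = ≤-respʳ-≈ (+-identityˡ _) (x≤y⇒0≤y-x (<⇒≤ (≰⇒> 0≰l)))
    0≤2x : 0# ≤ x + x
    0≤2x = +-nonNegative 0≤x 0≤x
    s = exp⁺ 0≤2x
    s-1<s : s - 1# < s
    s-1<s = <-by 1# 0<1 (solve 1 (λ s → s := s :- # 1 :+ # 1) refl s)
    3≤E : ∀ k → N ℕ.≤ k → fromℕ 3 ≤ expPartialSum (- x) k
    3≤E k N≤k = begin
      fromℕ 3                    ≈⟨ solve 0 (# 3 := # 4 :- # 1) refl ⟩
      fromℕ 4 - 1#               ≤⟨ +-mono-≤ (fromℕ-mono-≤ 4≤n) (neg-mono-≤ (proj₂ (eventually k N≤k))) ⟩
      fromℕ n - (fromℕ n - expPartialSum l k) ≈⟨ solve 2 (λ n e → n :- (n :- e) := e) refl _ _ ⟩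
      expPartialSum l k          ≈⟨ expPartialSum-cong (solve 1 (λ l → l := :- (:- l)) refl l) k ⟩
      expPartialSum (- x) k      ∎
    1≤E : ∀ k → 1 ℕ.≤ k → 1# ≤ expPartialSum x k
    1≤E (suc k) _ = ≤-by _ (partialSum-nonNegative (λ i → term-nonNegative 0≤x (suc i)) k) (+-congʳ (term-0 x))
    late : ∀ k → N ℕ.≤ k → 1 ℕ.≤ k → expPartialSum (x + x) k ≤ s - 1#
    late k N≤k 1≤k = begin
      e                          ≈⟨ solve 2 (λ e p → e := p :+ (e :- p)) refl e p ⟩
      p + (e - p)                ≤⟨ +-mono-≤ (expPartialSum-neg-*-≤ 0≤x k)
                                      (+-monoʳ-≤ e (neg-mono-≤ (*-mono-≤ (fromℕ-nonNegative 3) (3≤E k N≤k) 0≤1 (1≤E k 1≤k)))) ⟩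
      expPartialSum 0# k + (s - e) + (e - fromℕ 3 * 1#)
                                 ≤⟨ +-monoˡ-≤ _ (+-monoˡ-≤ _ (expPartialSum-≤ ≤-refl 0≤1 k)) ⟩
      1# + 0# + 0# * 0# + (s - e) + (e - fromℕ 3 * 1#)
                                 ≤⟨ ≤-by 1# 0≤1 (solve 2 (λ s e → s :- # 1
                                      := # 1 :+ # 0 :+ # 0 :* # 0 :+ (s :- e) :+ (e :- # 3 :* # 1) :+ # 1) refl s e) ⟩
      s - 1#                     ∎
      where
      e = expPartialSum (x + x) k
      p = expPartialSum (- x) k * expPartialSum x k
    below : ∀ k → expPartialSum (x + x) k ≤ s - 1#
    below k = ≤-trans (partialSum-mono-≤ (term-nonNegative 0≤2x) (ℕ.m≤m+n k (N ℕ.+ 1)))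
      (late (k ℕ.+ (N ℕ.+ 1)) (ℕ.≤-trans (ℕ.m≤m+n N 1) (ℕ.m≤n+m (N ℕ.+ 1) k))
                              (ℕ.≤-trans (ℕ.m≤n+m 1 N) (ℕ.m≤n+m (N ℕ.+ 1) k)))

  -- If exp l were below n by 2η, the partial sums, which are at most exp l, could never come within
  -- η of n.
  IsLog⇒≤exp : ∀ {n l} → 4 ℕ.≤ n → IsLog (fromℕ n) l → fromℕ n ≤ exp l
  IsLog⇒≤exp {n} {l} 4≤n E⟶n = ≮⇒≥ λ e<n →
    let η              = fromℕ 2 ⁻¹ * (fromℕ n - exp l)
        0<η            = *-positive (⁻¹-positive (fromℕ-suc-positive 1)) (x<y⇒0<y-x e<n)
        N , eventually = E⟶n η 0<η
    in <⇒≱ 0<η (begin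
      η                              ≈⟨ solve 1 (λ η → η := # 2 :* η :- η) refl η ⟩
      fromℕ 2 * η - η                ≤⟨ +-monoʳ-≤ _ (neg-mono-≤ (proj₂ (eventually N ℕ.≤-refl))) ⟩
      fromℕ 2 * η - (fromℕ n - expPartialSum l N)
        ≤⟨ +-monoʳ-≤ _ (neg-mono-≤ (+-monoʳ-≤ _ (neg-mono-≤
             (≤-respʳ-≈ (sym (exp-exp⁺ 0≤l)) (exp⁺-upper 0≤l N))))) ⟩
      fromℕ 2 * η - (fromℕ n - exp l) ≈⟨ +-congʳ (trans (sym (*-assoc _ _ _))
                                          (trans (*-congʳ (*-inverse (fromℕ-suc-positive 1))) (*-identityˡ _))) ⟩
      (fromℕ n - exp l) - (fromℕ n - exp l) ≈⟨ -‿inverseʳ _ ⟩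
      0#                             ∎)
    where
    open ≤-Reasoning
    0≤l : 0# ≤ l
    0≤l = IsLog⇒nonNegative 4≤n E⟶n

  -- On the unit interval `exp` is at most 3. The bound is what later allows rounding errors to be
  -- absorbed into multiples of √n log n / ε².
  IsLog⇒1≤ : ∀ {n l} → 4 ℕ.≤ n → IsLog (fromℕ n) l → 1# ≤ l
  IsLog⇒1≤ {n} {l} 4≤n E⟶n = ≮⇒≥ λ l<1 → <⇒≱ 3<4 (begin
    fromℕ 4    ≤⟨ fromℕ-mono-≤ 4≤n ⟩
    fromℕ n    ≤⟨ IsLog⇒≤exp 4≤n E⟶n ⟩
    exp l      ≈⟨ exp-exp⁺ 0≤l ⟩
    exp⁺ 0≤l   ≤⟨ exp⁺-least 0≤l (expPartialSum-≤3 0≤l (<⇒≤ l<1)) ⟩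
    fromℕ 3    ∎)
    where
    open ≤-Reasoning
    0≤l : 0# ≤ l
    0≤l = IsLog⇒nonNegative 4≤n E⟶n
    3<4 : fromℕ 3 < fromℕ 4
    3<4 = <-by 1# 0<1 (+-comm 1# (fromℕ 3))

-- Expectations over trees of coins.

module Expectation {ℓ} (R : Reals ℓ) where
  open OrderedField R
  open Probability R

  private
    variable
      A B : Set ℓ

  E : (A → Carrier) → Rand A → Carrier
  E F (return x)   = F x
  E F (coin p x y) = p * E F x + (1# - p) * E F y

  indicator : {P : Set ℓ} → Dec P → Carrier
  indicator (yes _) = 1#
  indicator (no _)  = 0#

  Prob≡E : {P : A → Set ℓ} (P? : ∀ x → Dec (P x)) (m : Rand A) →
           Prob P? m ≡ E (λ x → indicator (P? x)) m
  Prob≡E P? (return x) with P? x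
  ... | yes _ = ≡.refl
  ... | no  _ = ≡.refl
  Prob≡E P? (coin p x y) = ≡.cong₂ (λ u v → p * u + (1# - p) * v) (Prob≡E P? x) (Prob≡E P? y)

  E->>= : (F : B → Carrier) (m : Rand A) (k : A → Rand B) → E F (m >>= k) ≡ E (λ x → E F (k x)) m
  E->>= F (return x)   k = ≡.refl
  E->>= F (coin p x y) k = ≡.cong₂ (λ u v → p * u + (1# - p) * v) (E->>= F x k) (E->>= F y k)

  E-cong : {F G : A → Carrier} → (∀ x → F x ≈ G x) → ∀ m → E F m ≈ E G m
  E-cong F≈G (return x)   = F≈G x
  E-cong F≈G (coin p x y) = +-cong (*-congˡ (E-cong F≈G x)) (*-congˡ (E-cong F≈G y))

  E-const : ∀ c (m : Rand A) → E (λ _ → c) m ≈ c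
  E-const c (return x)   = refl
  E-const c (coin p x y) = trans (+-cong (*-congˡ (E-const c x)) (*-congˡ (E-const c y)))
    (solve 2 (λ p c → p :* c :+ (# 1 :- p) :* c := c) refl p c)

  E-+ : ∀ (F G : A → Carrier) m → E (λ x → F x + G x) m ≈ E F m + E G m
  E-+ F G (return x)   = refl
  E-+ F G (coin p x y) = trans (+-cong (*-congˡ (E-+ F G x)) (*-congˡ (E-+ F G y)))
    (solve 5 (λ p a b c d → p :* (a :+ b) :+ (# 1 :- p) :* (c :+ d)
                         := (p :* a :+ (# 1 :- p) :* c) :+ (p :* b :+ (# 1 :- p) :* d)) refl p _ _ _ _)

  E-neg : ∀ (F : A → Carrier) m → E (λ x → - F x) m ≈ - E F m
  E-neg F (return x)   = refl
  E-neg F (coin p x y) = trans (+-cong (*-congˡ (E-neg F x)) (*-congˡ (E-neg F y)))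
    (solve 3 (λ p a c → p :* (:- a) :+ (# 1 :- p) :* (:- c) := :- (p :* a :+ (# 1 :- p) :* c)) refl p _ _)

  E-sum : ∀ {n} (F : Fin n → A → Carrier) m → E (λ x → sum λ j → F j x) m ≈ sum λ j → E (F j) m
  E-sum {n = zero}  F m = E-const 0# m
  E-sum {n = suc n} F m = trans (E-+ (F Fin.zero) (λ x → sum λ j → F (Fin.suc j) x) m)
    (+-congˡ (E-sum (λ j → F (Fin.suc j)) m))

  -- A coin may carry any field element as its bias, and expectation is monotone only if all biases
  -- lie in the unit interval. This is certified together with a property `Q` of all outcomes.
  data Valid (Q : A → Set ℓ) : Rand A → Set ℓ where
    return : ∀ {x} → Q x → Valid Q (return x)
    coin   : ∀ {p x y} → 0# ≤ p → p ≤ 1# → Valid Q x → Valid Q y → Valid Q (coin p x y)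

  Valid->>= : {P : A → Set ℓ} {Q : B → Set ℓ} {m : Rand A} {k : A → Rand B} →
              Valid P m → (∀ {x} → P x → Valid Q (k x)) → Valid Q (m >>= k)
  Valid->>= (return p)           valid-k = valid-k p
  Valid->>= (coin 0≤p p≤1 vx vy) valid-k = coin 0≤p p≤1 (Valid->>= vx valid-k) (Valid->>= vy valid-k)

  E-mono : {Q : A → Set ℓ} {F G : A → Carrier} {m : Rand A} →
           Valid Q m → (∀ {x} → Q x → F x ≤ G x) → E F m ≤ E G m
  E-mono (return q)           F≤G = F≤G q
  E-mono (coin 0≤p p≤1 vx vy) F≤G =
    +-mono-≤ (*-monoˡ-≤ 0≤p (E-mono vx F≤G)) (*-monoˡ-≤ (x≤y⇒0≤y-x p≤1) (E-mono vy F≤G))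

-- Reservoir sampling.

module ReservoirSampling {ℓ} (R : Reals ℓ) where
  open OrderedField R
  open Probability R
  open Expectation R

  private
    variable
      A U X : Set ℓ
      m : ℕ

  product : (A → Carrier) → Vec A m → Carrier
  product φ []      = 1#
  product φ (a ∷ s) = φ a * product φ s

  -- Unfolds to the same fold as `sequence` in the semantics, but over an arbitrary state. An array
  -- is embedded by a function `put`, into which inductions move the cells already processed.
  loop : (Fin m → X → Rand X) → X → Rand X
  loop = Vector.foldr (λ k ks x → k x >>= ks) return

  loop-update : (put : Vec A m → X) (k : Fin m → X → Rand X) (g : Fin m → A → A) →
    (∀ i s → k i (put s) ≡ return (put (s [ i ]≔ g i (lookup s i)))) →
    ∀ s → loop k (put s) ≡ return (put (tabulate λ i → g i (lookup s i)))
  loop-update put k g step []      = ≡.refl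
  loop-update put k g step (a ∷ s) rewrite step Fin.zero (a ∷ s) =
    loop-update (λ s → put (g Fin.zero a ∷ s)) (λ i → k (Fin.suc i)) (λ i → g (Fin.suc i))
      (λ i s → step (Fin.suc i) (g Fin.zero a ∷ s)) s

  mix : Carrier → A → (A → Carrier) → A → Carrier
  mix p v φ a = p * φ v + (1# - p) * φ a

  module _ {p : Carrier} {v : A} where

    Overwrites : (Vec A m → X) → (Fin m → X → Rand X) → Set ℓ
    Overwrites put k = ∀ i s → k i (put s) ≡ coin p (return (put (s [ i ]≔ v))) (return (put s))

    -- The cells use independent coins, so the expectation factorises. The factor `c` accounts for
    -- cells already moved into `put`.
    E-loop : (put : Vec A m → X) (k : Fin m → X → Rand X) → Overwrites put k →
      ∀ {F φ} c → (∀ s → F (put s) ≈ c * product φ s) →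
      ∀ s → E F (loop k (put s)) ≈ c * product (mix p v φ) s
    E-loop put k step c F≈ []      = F≈ []
    E-loop put k step {F} {φ} c F≈ (a ∷ s) rewrite step Fin.zero (a ∷ s) = trans
      (+-cong (*-congˡ (rest v)) (*-congˡ (rest a)))
      (solve 5 (λ p c x y P → p :* (c :* x :* P) :+ (# 1 :- p) :* (c :* y :* P)
                           := c :* ((p :* x :+ (# 1 :- p) :* y) :* P)) refl p c (φ v) (φ a) _)
      where
      rest : ∀ b → E F (loop (λ i → k (Fin.suc i)) (put (b ∷ s))) ≈ c * φ b * product (mix p v φ) s
      rest b = E-loop (λ s → put (b ∷ s)) (λ i → k (Fin.suc i)) (λ i s → step (Fin.suc i) (b ∷ s))
        (c * φ b) (λ s → trans (F≈ (b ∷ s)) (sym (*-assoc _ _ _))) s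

    Valid-loop : (put : Vec A m → X) (k : Fin m → X → Rand X) → Overwrites put k →
      0# ≤ p → p ≤ 1# → ∀ {Q} → (∀ s → Q (put s)) → ∀ s → Valid Q (loop k (put s))
    Valid-loop put k step 0≤p p≤1 q []      = return (q [])
    Valid-loop put k step 0≤p p≤1 {Q} q (a ∷ s) rewrite step Fin.zero (a ∷ s) = coin 0≤p p≤1 (rest v) (rest a)
      where
      rest : ∀ b → Valid Q (loop (λ i → k (Fin.suc i)) (put (b ∷ s)))
      rest b = Valid-loop (λ s → put (b ∷ s)) (λ i → k (Fin.suc i)) (λ i s → step (Fin.suc i) (b ∷ s))
        0≤p p≤1 (λ s → q (b ∷ s)) s

  -- The expectation of φ at a cell of the reservoir after the items of xs
  -- have arrived, as a function of its content after the first c items.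
  sampled : Carrier → List U → (Maybe U → Carrier) → Maybe U → Carrier
  sampled c []       φ = φ
  sampled c (x ∷ xs) φ = mix ((c + 1#) ⁻¹) (just x) (sampled (c + 1#) xs φ)

  sumOver : (U → Carrier) → List U → Carrier
  sumOver g []       = 0#
  sumOver g (x ∷ xs) = g x + sumOver g xs

  0≤x⇒0<x+1 : ∀ {x} → 0# ≤ x → 0# < x + 1#
  0≤x⇒0<x+1 {x} 0≤x = <-≤-trans 0<1 (≤-by x 0≤x (+-comm x 1#))

  -- After l further arrivals the old content has weight c / (c + l) and every new item 1 / (c + l).
  -- For c = 0 the cell is uniform on `xs`, whatever it held before.
  sampled-mean : ∀ {c} → 0# ≤ c → ∀ xs φ (a : Maybe U) →
    (c + fromℕ (length xs)) * sampled c xs φ a ≈ c * φ a + sumOver (φ ∘ just) xs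
  sampled-mean {c = c} 0≤c [] φ a = solve 2 (λ c x → (c :+ # 0) :* x := c :* x :+ # 0) refl c (φ a)
  sampled-mean {c = c} 0≤c (x ∷ xs) φ a = begin
    (c + (1# + l)) * (p * u + (1# - p) * v)
      ≈⟨ solve 5 (λ c l p u v → (c :+ (# 1 :+ l)) :* (p :* u :+ (# 1 :- p) :* v)
                             := p :* ((c :+ # 1 :+ l) :* u) :+ (# 1 :- p) :* ((c :+ # 1 :+ l) :* v)) refl c l p u v ⟩
    p * ((c + 1# + l) * u) + (1# - p) * ((c + 1# + l) * v)
      ≈⟨ +-cong (*-congˡ (sampled-mean 0≤c+1 xs φ (just x))) (*-congˡ (sampled-mean 0≤c+1 xs φ a)) ⟩
    p * ((c + 1#) * φ (just x) + t) + (1# - p) * ((c + 1#) * φ a + t)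
      ≈⟨ solve 5 (λ c p y z t → p :* ((c :+ # 1) :* y :+ t) :+ (# 1 :- p) :* ((c :+ # 1) :* z :+ t)
                             := (c :+ # 1) :* p :* (y :- z) :+ (c :* z :+ z :+ t)) refl c p _ _ t ⟩
    (c + 1#) * p * (φ (just x) - φ a) + (c * φ a + φ a + t)
      ≈⟨ +-congʳ (*-congʳ (*-inverse (0≤x⇒0<x+1 0≤c))) ⟩
    1# * (φ (just x) - φ a) + (c * φ a + φ a + t)
      ≈⟨ solve 4 (λ c y z t → # 1 :* (y :- z) :+ (c :* z :+ z :+ t) := c :* z :+ (y :+ t)) refl c _ _ t ⟩
    c * φ a + (φ (just x) + t) ∎
    where
    open SetoidReasoning setoid
    l = fromℕ (length xs)
    p = (c + 1#) ⁻¹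
    u = sampled (c + 1#) xs φ (just x)
    v = sampled (c + 1#) xs φ a
    t = sumOver (φ ∘ just) xs
    0≤c+1 : 0# ≤ c + 1#
    0≤c+1 = <⇒≤ (0≤x⇒0<x+1 0≤c)

  recip-probability : ∀ {c} → 0# ≤ c → 0# ≤ (c + 1#) ⁻¹ × (c + 1#) ⁻¹ ≤ 1#
  recip-probability {c} 0≤c = <⇒≤ (⁻¹-positive 0<c+1) , *-cancelˡ-≤ 0<c+1
    (≤-respˡ-≈ (sym (*-inverse 0<c+1)) (≤-by c 0≤c (solve 1 (λ c → (c :+ # 1) :* # 1 := # 1 :+ c) refl c)))
    where
    0<c+1 : 0# < c + 1#
    0<c+1 = 0≤x⇒0<x+1 0≤c

-- Effect of each pass on the memory.

module Execution {ℓ} (R : Reals ℓ) (n t₁ t₂ : ℕ) (θ : Reals.Carrier R)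
                 {U : Set ℓ} (f : U → U → Reals.Carrier R) where
  open OrderedField R
  open Probability R
  open Expectation R
  open ReservoirSampling R
  open Streaming R
  open Streaming.Semantics R f
  open ThreePass R n t₁ t₂ θ using (Γ; pass₁; pass₂; pass₃; finish; program)

  state : Vec (Maybe U) t₁ → Vec (Maybe U) t₂ → Vec Carrier t₂ → (j c y h l : Carrier) → Memory Γ
  state s₁ s₂ d j c y h l =
    s₁ ∷ s₂ ∷ d ∷ (j ∷ []) ∷ (c ∷ []) ∷ (y ∷ []) ∷ (h ∷ []) ∷ (l ∷ []) ∷ []

  module Pass₁ (s₂ : Vec (Maybe U) t₂) (d : Vec Carrier t₂) (c y h l : Carrier) where
    after : Vec (Maybe U) t₁ → Carrier → Memory Γ
    after s₁ j = state s₁ s₂ d j c y h l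

    -- The stream is peeled from the front: the induction hypothesis turns the rest of the scan into
    -- a product again, with `sampled` as the new test function for the loop of the first arrival.
    E-pass₁ : ∀ {F φ} → (∀ s₁ j → F (after s₁ j) ≈ product φ s₁) → ∀ {m} (xs : Vec U m) s₁ j →
              E F (execScan pass₁ xs (after s₁ j)) ≈ product (sampled j (toList xs) φ) s₁
    E-pass₁ F≈ []       s₁ j = F≈ s₁ j
    E-pass₁ {F} F≈ (x ∷ xs) s₁ j = trans (reflexive (E->>= F (exec pass₁ x (after s₁ j)) (execScan pass₁ xs)))
      (trans (E-loop (λ s₁ → after s₁ (j + 1#)) _ (λ i s₁ → ≡.refl) 1#
               (λ s₁ → trans (E-pass₁ F≈ xs s₁ (j + 1#)) (sym (*-identityˡ _))) s₁)
             (*-identityˡ _))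

    Valid-pass₁ : ∀ {Q} → (∀ s₁ j → Q (after s₁ j)) → ∀ {m} (xs : Vec U m) s₁ {j} → 0# ≤ j →
                  Valid Q (execScan pass₁ xs (after s₁ j))
    Valid-pass₁ q []       s₁ {j} 0≤j = return (q s₁ j)
    Valid-pass₁ {Q} q (x ∷ xs) s₁ {j} 0≤j =
      -- The property tracked through the loop is the validity of the remaining scan itself, so the
      -- continuation has nothing left to prove.
      Valid->>= {P = λ M → Valid Q (execScan pass₁ xs M)}
        (Valid-loop (λ s₁ → after s₁ (j + 1#)) _ (λ i s₁ → ≡.refl)
          (proj₁ (recip-probability 0≤j)) (proj₂ (recip-probability 0≤j))
          (λ s₁ → Valid-pass₁ q xs s₁ (<⇒≤ (0≤x⇒0<x+1 0≤j))) s₁)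
        (λ v → v)

  module Pass₂ (s₁ : Vec (Maybe U) t₁) (d : Vec Carrier t₂) (j l : Carrier) where
    estimate : U → Carrier
    estimate x = sum λ i → similarity (lookup s₁ i) (just x)

    Heavy : U → Set ℓ
    Heavy x = θ ≤ estimate x

    heavy? : ∀ x → Dec (Heavy x)
    heavy? x = θ ≤? estimate x

    reciprocal : U → Carrier
    reciprocal x = (fromℕ n * fromℕ t₁ ⁻¹ * estimate x) ⁻¹

    heavy light : ∀ {m} → Vec U m → List U
    heavy xs = filter heavy? (toList xs)
    light xs = filter (¬? ∘ heavy?) (toList xs)

    after : Vec (Maybe U) t₂ → (c y h : Carrier) → Memory Γ
    after s₂ c y h = state s₁ s₂ d j c y h l

    addOne : Carrier → U → Carrier
    addOne c _ = c + 1#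

    addReciprocal : Carrier → U → Carrier
    addReciprocal h x = h + reciprocal x

    sample : U → Carrier → Fin t₂ → Memory Γ → Rand (Memory Γ)
    sample x c i = exec (withProbability recip (get (there (there (there (there (here ≡.refl)))) [ Fin.zero ]))
                          perform (there (here ≡.refl) [ i ] ≔ᵢ arriving)) x

    overwrites : ∀ x {c y h} → Overwrites {p = (c + 1#) ⁻¹} {v = just x}
                   (λ s₂ → after s₂ (c + 1#) y h) (sample x c)
    overwrites x i s₂ = ≡.refl

    -- With `s₁` fixed, the split into heavy and light is deterministic. Heavy arrivals leave the
    -- second reservoir and its counter alone, so the pass samples from the sublist of light items.
    E-pass₂ : ∀ {F φ} → (∀ s₂ c y h → F (after s₂ c y h) ≈ product φ s₂) →
              ∀ {m} (xs : Vec U m) s₂ c y h →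
              E F (execScan pass₂ xs (after s₂ c y h)) ≈ product (sampled c (light xs) φ) s₂
    E-pass₂ F≈ [] s₂ c y h = F≈ s₂ c y h
    E-pass₂ {F} F≈ (x ∷ xs) s₂ c y h with heavy? x
    ... | yes _ = E-pass₂ F≈ xs s₂ c _ _
    ... | no  _ =
      trans (reflexive (E->>= F (loop (sample x c) (after s₂ (c + 1#) (estimate x) h)) (execScan pass₂ xs)))
        (trans (E-loop (λ s₂ → after s₂ (c + 1#) (estimate x) h) (sample x c) (overwrites x) 1#
                 (λ s₂ → trans (E-pass₂ F≈ xs s₂ (c + 1#) _ h) (sym (*-identityˡ _))) s₂)
               (*-identityˡ _))

    -- The counter and `W-H` end at the same values whatever the coins show. They are left folds
    -- because the program accumulates in stream order.
    Valid-pass₂ : ∀ {Q m} (xs : Vec U m) s₂ {c} y h →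
      (∀ s₂ y → Q (after s₂ (foldl addOne c (light xs)) y (foldl addReciprocal h (heavy xs)))) →
      0# ≤ c → Valid Q (execScan pass₂ xs (after s₂ c y h))
    Valid-pass₂ [] s₂ y h q 0≤c = return (q s₂ y)
    Valid-pass₂ {Q} (x ∷ xs) s₂ {c} y h q 0≤c with heavy? x
    ... | yes _ = Valid-pass₂ xs s₂ _ _ q 0≤c
    ... | no  _ =
      Valid->>= {P = λ M → Valid Q (execScan pass₂ xs M)}
        (Valid-loop (λ s₂ → after s₂ (c + 1#) (estimate x) h) (sample x c) (overwrites x)
          (proj₁ (recip-probability 0≤c)) (proj₂ (recip-probability 0≤c))
          (λ s₂ → Valid-pass₂ xs s₂ _ _ q (<⇒≤ (0≤x⇒0<x+1 0≤c))) s₂)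
        (λ v → v)

  module Pass₃ (s₁ : Vec (Maybe U) t₁) (s₂ : Vec (Maybe U) t₂) (j c y h : Carrier) where
    after : Vec Carrier t₂ → Memory Γ
    after d = state s₁ s₂ d j c y h 0#

    execScan-pass₃ : ∀ {m} (xs : Vec U m) d →
      ∃ λ d′ → execScan pass₃ xs (after d) ≡ return (after d′) ×
               ∀ i → lookup d′ i ≈ lookup d i + sum λ k → similarity (lookup s₂ i) (just (lookup xs k))
    execScan-pass₃ [] d = d , ≡.refl , λ i → sym (+-identityʳ _)
    execScan-pass₃ (x ∷ xs) d
      with d′ , eq , d′≈ ← execScan-pass₃ xs (tabulate λ i → lookup d i + similarity (lookup s₂ i) (just x))
      = d′
      , ≡.trans (≡.cong (_>>= execScan pass₃ xs)
          (loop-update after _ (λ i a → a + similarity (lookup s₂ i) (just x)) (λ i d → ≡.refl) d)) eq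
      , λ i → trans (d′≈ i) (trans (+-congʳ (reflexive (lookup∘tabulate _ i))) (+-assoc _ _ _))

    mean : Vec Carrier t₂ → Carrier
    mean d = c * fromℕ t₂ ⁻¹ * sum λ i → lookup d i ⁻¹

    exec-finish : ∀ d → ∃ λ l → exec finish tt (after d) ≡ return (state s₁ s₂ d j c y h l) ×
                               (c ≤ 0# → l ≈ 0#) × (¬ (c ≤ 0#) → l ≈ mean d)
    exec-finish d with c ≤? 0#
    ... | yes c≤0 = _ , ≡.refl , (λ _ → refl) , λ c≰0 → ⊥-elim (c≰0 c≤0)
    ... | no  c≰0 = _ , ≡.refl , (λ c≤0 → ⊥-elim (c≰0 c≤0)) , λ _ → refl

-- Sums over indices and over lists.

module Sums {ℓ} (R : Reals ℓ) where
  open OrderedField R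
  open ReservoirSampling R using (sumOver)

  private
    variable
      U : Set ℓ

  sum-mono-≤ : ∀ {n} {a b : Fin n → Carrier} → (∀ i → a i ≤ b i) → sum a ≤ sum b
  sum-mono-≤ {zero}  a≤b = ≤-refl
  sum-mono-≤ {suc n} a≤b = +-mono-≤ (a≤b Fin.zero) (sum-mono-≤ λ i → a≤b (Fin.suc i))

  sum-nonNegative : ∀ {n} {a : Fin n → Carrier} → (∀ i → 0# ≤ a i) → 0# ≤ sum a
  sum-nonNegative {zero}  0≤a = ≤-refl
  sum-nonNegative {suc n} 0≤a = +-nonNegative (0≤a Fin.zero) (sum-nonNegative λ i → 0≤a (Fin.suc i))

  term≤sum : ∀ {n} {a : Fin n → Carrier} → (∀ i → 0# ≤ a i) → ∀ i → a i ≤ sum a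
  term≤sum 0≤a Fin.zero    = ≤-by _ (sum-nonNegative λ i → 0≤a (Fin.suc i)) refl
  term≤sum 0≤a (Fin.suc i) = ≤-trans (term≤sum (λ i → 0≤a (Fin.suc i)) i) (≤-by _ (0≤a Fin.zero) (+-comm _ _))

  sum-≤-const : ∀ {n c} {a : Fin n → Carrier} → (∀ i → a i ≤ c) → sum a ≤ fromℕ n * c
  sum-≤-const {zero}  {c} a≤c = ≤-reflexive (sym (zeroˡ c))
  sum-≤-const {suc n} {c} a≤c = ≤-respʳ-≈
    (solve 2 (λ n c → c :+ n :* c := (# 1 :+ n) :* c) refl (fromℕ n) c)
    (+-mono-≤ (a≤c Fin.zero) (sum-≤-const λ i → a≤c (Fin.suc i)))

  sumOver-mono-≤ : ∀ {g h : U → Carrier} {xs} → All (λ x → g x ≤ h x) xs → sumOver g xs ≤ sumOver h xs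
  sumOver-mono-≤ []           = ≤-refl
  sumOver-mono-≤ (g≤h ∷ gs≤hs) = +-mono-≤ g≤h (sumOver-mono-≤ gs≤hs)

  sumOver-nonNegative : ∀ {g : U → Carrier} {xs} → All (λ x → 0# ≤ g x) xs → 0# ≤ sumOver g xs
  sumOver-nonNegative []         = ≤-refl
  sumOver-nonNegative (0≤g ∷ 0≤gs) = +-nonNegative 0≤g (sumOver-nonNegative 0≤gs)

  *-distribˡ-sumOver : ∀ c (g : U → Carrier) xs → c * sumOver g xs ≈ sumOver (λ x → c * g x) xs
  *-distribˡ-sumOver c g []       = zeroʳ c
  *-distribˡ-sumOver c g (x ∷ xs) = trans (distribˡ _ _ _) (+-congˡ (*-distribˡ-sumOver c g xs))

  sumOver-affine : ∀ (g : U → Carrier) k e xs →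
    sumOver (λ x → (1# + k * g x) * e) xs ≈ (fromℕ (length xs) + k * sumOver g xs) * e
  sumOver-affine g k e [] = solve 2 (λ k e → # 0 := (# 0 :+ k :* # 0) :* e) refl k e
  sumOver-affine g k e (x ∷ xs) = trans (+-congˡ (sumOver-affine g k e xs))
    (solve 5 (λ k y e n s → (# 1 :+ k :* y) :* e :+ (n :+ k :* s) :* e := (# 1 :+ n :+ k :* (y :+ s)) :* e)
      refl k (g x) e _ _)

  sumOver-≥-const : ∀ {c} {g : U → Carrier} {xs} → All (λ x → c ≤ g x) xs → fromℕ (length xs) * c ≤ sumOver g xs
  sumOver-≥-const {c = c} [] = ≤-reflexive (zeroˡ c)
  sumOver-≥-const {c = c} {xs = _ ∷ xs} (c≤g ∷ c≤gs) = ≤-respˡ-≈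
    (solve 2 (λ n c → c :+ n :* c := (# 1 :+ n) :* c) refl (fromℕ (length xs)) c)
    (+-mono-≤ c≤g (sumOver-≥-const c≤gs))

  sumOver-toList : ∀ (g : U → Carrier) {m} (xs : Vec U m) → sumOver g (toList xs) ≡ sum λ k → g (lookup xs k)
  sumOver-toList g []       = ≡.refl
  sumOver-toList g (x ∷ xs) = ≡.cong (g x +_) (sumOver-toList g xs)

  module _ {P : U → Set ℓ} (P? : ∀ x → Dec (P x)) where

    sumOver-partition : ∀ (g : U → Carrier) xs →
      sumOver g (filter P? xs) + sumOver g (filter (¬? ∘ P?) xs) ≈ sumOver g xs
    sumOver-partition g [] = +-identityˡ 0#
    sumOver-partition g (x ∷ xs) with P? x
    ... | yes _ = trans (+-assoc _ _ _) (+-congˡ (sumOver-partition g xs))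
    ... | no  _ = trans (solve 3 (λ a y b → a :+ (y :+ b) := y :+ (a :+ b)) refl _ (g x) _)
                    (+-congˡ (sumOver-partition g xs))

    -- Stated by position because facts such as a degree being at least 1 hold for items of the
    -- stream, not for all of `U`.
    All-filter : ∀ {Q : U → Set ℓ} {m} (xs : Vec U m) → (∀ k → P (lookup xs k) → Q (lookup xs k)) →
                 All Q (filter P? (toList xs))
    All-filter []       P⇒Q = []
    All-filter (x ∷ xs) P⇒Q with P? x
    ... | yes p = P⇒Q Fin.zero p ∷ All-filter xs (λ k → P⇒Q (Fin.suc k))
    ... | no  _ = All-filter xs (λ k → P⇒Q (Fin.suc k))

  foldl-count : ∀ (c : Carrier) (xs : List U) → foldl (λ c _ → c + 1#) c xs ≈ c + fromℕ (length xs)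
  foldl-count c []       = sym (+-identityʳ c)
  foldl-count c (x ∷ xs) = trans (foldl-count (c + 1#) xs) (+-assoc _ _ _)

  foldl-sumOver : ∀ (g : U → Carrier) h xs → foldl (λ h x → h + g x) h xs ≈ h + sumOver g xs
  foldl-sumOver g h []       = sym (+-identityʳ h)
  foldl-sumOver g h (x ∷ xs) = trans (foldl-sumOver g (h + g x) xs) (+-assoc _ _ _)

-- Chernoff bounds for reservoirs.

module Chernoff {ℓ} (R : Reals ℓ) where
  open OrderedField R
  open Exponential R
  open ReservoirSampling R
  open Sums R

  private
    variable
      A U : Set ℓ
      m : ℕ

  valueSum : (A → Carrier) → Vec A m → Carrier
  valueSum g s = sum λ i → g (lookup s i)

  -- The factor of the exponential moment that belongs to one sample.  A positive
  -- t bounds the upper tail, a negative one the lower tail.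
  tilt : (A → Carrier) → (t τ : Carrier) → A → Carrier
  tilt g t τ a = exp (t * (g a - τ))

  product-tilt : ∀ (g : A → Carrier) t τ (s : Vec A m) →
    product (tilt g t τ) s ≈ exp (t * (valueSum g s - fromℕ m * τ))
  product-tilt g t τ [] = trans (sym exp-0)
    (exp-cong (solve 2 (λ t τ → # 0 := t :* (# 0 :- # 0 :* τ)) refl t τ))
  product-tilt {m = suc m} g t τ (a ∷ s) = trans (*-congˡ (product-tilt g t τ s))
    (trans (sym (exp-+ _ _)) (exp-cong
      (solve 5 (λ t y τ v m → t :* (y :- τ) :+ t :* (v :- m :* τ) := t :* (y :+ v :- (# 1 :+ m) :* τ))
        refl t (g a) τ (valueSum g s) (fromℕ m))))

  product-nonNegative : ∀ {φ : A → Carrier} → (∀ a → 0# ≤ φ a) → ∀ (s : Vec A m) → 0# ≤ product φ s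
  product-nonNegative 0≤φ []      = 0≤1
  product-nonNegative 0≤φ (a ∷ s) = *-nonNegative (0≤φ a) (product-nonNegative 0≤φ s)

  product-tilt-nonNegative : ∀ (g : A → Carrier) t τ (s : Vec A m) → 0# ≤ product (tilt g t τ) s
  product-tilt-nonNegative g t τ = product-nonNegative λ a → <⇒≤ (exp-positive _)

  product-≤-exp : ∀ {φ : A → Carrier} {r} → (∀ a → 0# ≤ φ a × φ a ≤ exp r) →
                  ∀ (s : Vec A m) → product φ s ≤ exp (fromℕ m * r)
  product-≤-exp {r = r} φ≤ [] = ≤-reflexive (trans (sym exp-0) (exp-cong (sym (zeroˡ r))))
  product-≤-exp {m = suc m} {r = r} φ≤ (a ∷ s) = ≤-respʳ-≈
    (trans (sym (exp-+ _ _)) (exp-cong (solve 2 (λ m r → r :+ m :* r := (# 1 :+ m) :* r) refl (fromℕ m) r)))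
    (*-mono-≤ (proj₁ (φ≤ a)) (proj₂ (φ≤ a)) (product-nonNegative (λ a → proj₁ (φ≤ a)) s) (product-≤-exp φ≤ s))

  -- The pointwise core of Markov's inequality: at a nonnegative exponent `exp` is at least 1, so a
  -- product below 1 certifies that the deviation did not occur.
  product-tilt<1⇒ : ∀ (g : A → Carrier) t τ (s : Vec A m) → product (tilt g t τ) s < 1# →
                    t * (valueSum g s - fromℕ m * τ) < 0#
  product-tilt<1⇒ g t τ s Π<1 = ≰⇒> λ 0≤z → <⇒≱ Π<1 (begin
    1#                         ≤⟨ ≤-by _ 0≤z refl ⟩
    1# + _                     ≤⟨ 1+x≤exp _ ⟩
    exp (t * (valueSum g s - _)) ≈⟨ product-tilt g t τ s ⟨
    product (tilt g t τ) s     ∎)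
    where open ≤-Reasoning

  upper-tail : ∀ (g : A → Carrier) {t} τ (s : Vec A m) → 0# ≤ t → product (tilt g t τ) s < 1# →
               valueSum g s < fromℕ m * τ
  upper-tail g τ s 0≤t Π<1 = ≰⇒> λ τ≤v →
    <⇒≱ (product-tilt<1⇒ g _ τ s Π<1) (*-nonNegative 0≤t (x≤y⇒0≤y-x τ≤v))

  lower-tail : ∀ (g : A → Carrier) {t} τ (s : Vec A m) → 0# ≤ t → product (tilt g (- t) τ) s < 1# →
               fromℕ m * τ < valueSum g s
  lower-tail g {t} τ s 0≤t Π<1 = ≰⇒> λ v≤τ →
    <⇒≱ (product-tilt<1⇒ g _ τ s Π<1) (≤-respʳ-≈
      (solve 3 (λ t a b → t :* (a :- b) := (:- t) :* (b :- a)) refl t _ _)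
      (*-nonNegative 0≤t (x≤y⇒0≤y-x v≤τ)))

  module _ (g : Maybe U → Carrier) {t : Carrier} (-1≤t : - 1# ≤ t) (t≤1 : t ≤ 1#) (τ : Carrier)
           {xs : List U} (bounded : All (λ x → 0# ≤ g (just x) × g (just x) ≤ 1#) xs)
           (0<l : 0# < fromℕ (length xs)) {μ : Carrier} (mean : fromℕ (length xs) * μ ≈ sumOver (g ∘ just) xs)
    where
    private
      l = fromℕ (length xs)
      k = t + t * t
      e = exp (- (t * τ))

      tilt-≤ : ∀ {y} → 0# ≤ y × y ≤ 1# → exp (t * (y - τ)) ≤ (1# + k * y) * e
      tilt-≤ {y} (0≤y , y≤1) = begin
        exp (t * (y - τ))
          ≈⟨ exp-cong (solve 3 (λ t y τ → t :* (y :- τ) := t :* y :+ (:- (t :* τ))) refl t y τ) ⟩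
        exp (t * y + - (t * τ))          ≈⟨ exp-+ _ _ ⟩
        exp (t * y) * e                  ≤⟨ *-monoʳ-≤ (<⇒≤ (exp-positive _)) (exp-≤-quadratic
          (≤-by _ (+-nonNegative (*-nonNegative 0≤y (x≤y⇒0≤y-x -1≤t)) (x≤y⇒0≤y-x y≤1))
            (solve 2 (λ t y → t :* y := (:- # 1) :+ (y :* (t :- (:- # 1)) :+ (# 1 :- y))) refl t y))
          (≤-by _ (+-nonNegative (*-nonNegative 0≤y (x≤y⇒0≤y-x t≤1)) (x≤y⇒0≤y-x y≤1))
            (solve 2 (λ t y → # 1 := t :* y :+ (y :* (# 1 :- t) :+ (# 1 :- y))) refl t y))) ⟩
        -- Since y² ≤ y on the unit interval, the bound becomes affine in y, and only the mean of
        -- the samples will matter.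
        (1# + t * y + t * y * (t * y)) * e ≤⟨ *-monoʳ-≤ (<⇒≤ (exp-positive _))
          (≤-by _ (*-nonNegative (square-nonNegative t) (*-nonNegative 0≤y (x≤y⇒0≤y-x y≤1)))
            (solve 2 (λ t y → # 1 :+ (t :+ t :* t) :* y
              := # 1 :+ t :* y :+ t :* y :* (t :* y) :+ t :* t :* (y :* (# 1 :- y))) refl t y)) ⟩
        (1# + k * y) * e                 ∎
        where open ≤-Reasoning

      l*sampled : ∀ a → l * sampled 0# xs (tilt g t τ) a ≈ sumOver (tilt g t τ ∘ just) xs
      l*sampled a = trans (*-congʳ (sym (+-identityˡ l))) (trans (sampled-mean ≤-refl xs (tilt g t τ) a)
        (trans (+-congʳ (zeroˡ _)) (+-identityˡ _)))

      sampled-nonNegative : ∀ a → 0# ≤ sampled 0# xs (tilt g t τ) a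
      sampled-nonNegative a = *-cancelˡ-≤ 0<l (≤-respˡ-≈ (sym (zeroʳ l)) (≤-respʳ-≈ (sym (l*sampled a))
        (sumOver-nonNegative (All.universal (λ x → <⇒≤ (exp-positive _)) xs))))

      sampled-≤ : ∀ a → sampled 0# xs (tilt g t τ) a ≤ exp (t * μ + t * t * μ - t * τ)
      sampled-≤ a = *-cancelˡ-≤ 0<l (begin
        l * sampled 0# xs (tilt g t τ) a       ≈⟨ l*sampled a ⟩
        sumOver (tilt g t τ ∘ just) xs         ≤⟨ sumOver-mono-≤ (All.map tilt-≤ bounded) ⟩
        sumOver (λ x → (1# + k * g (just x)) * e) xs ≈⟨ sumOver-affine (g ∘ just) k e xs ⟩
        (l + k * sumOver (g ∘ just) xs) * e    ≈⟨ *-congʳ (+-congˡ (*-congˡ (sym mean))) ⟩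
        (l + k * (l * μ)) * e
          ≈⟨ solve 4 (λ l k μ e → (l :+ k :* (l :* μ)) :* e := l :* ((# 1 :+ k :* μ) :* e)) refl l k μ e ⟩
        l * ((1# + k * μ) * e)                 ≤⟨ *-monoˡ-≤ (<⇒≤ 0<l) (*-monoʳ-≤ (<⇒≤ (exp-positive _)) (1+x≤exp (k * μ))) ⟩
        l * (exp (k * μ) * e)                  ≈⟨ *-congˡ (trans (sym (exp-+ _ _)) (exp-cong
          (solve 3 (λ t μ τ → (t :+ t :* t) :* μ :+ (:- (t :* τ)) := t :* μ :+ t :* t :* μ :- t :* τ) refl t μ τ))) ⟩
        l * exp (t * μ + t * t * μ - t * τ)    ∎)
        where open ≤-Reasoning

    chernoff : ∀ (s : Vec (Maybe U) m) → product (sampled 0# xs (tilt g t τ)) s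
               ≤ exp (fromℕ m * (t * μ + t * t * μ - t * τ))
    chernoff = product-≤-exp λ a → sampled-nonNegative a , sampled-≤ a

  module _ (g : Maybe U → Carrier) {t : Carrier} (0≤t : 0# ≤ t) (t≤1 : t ≤ 1#)
           {xs : List U} (bounded : All (λ x → 0# ≤ g (just x) × g (just x) ≤ 1#) xs)
           (0<l : 0# < fromℕ (length xs)) {μ : Carrier} (mean : fromℕ (length xs) * μ ≈ sumOver (g ∘ just) xs)
           {K : Carrier} {m : ℕ} (K≤ : K ≤ t * t * (fromℕ m * μ)) (s : Vec (Maybe U) m)
    where

    -- At relative deviation 2t the exponent t μ + t² μ - t τ collapses to -t² μ per cell, and the
    -- given t is its minimiser for that threshold.
    upper-deviation : product (sampled 0# xs (tilt g t ((1# + fromℕ 2 * t) * μ))) s ≤ exp (- K)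
    upper-deviation = ≤-trans
      (chernoff g (≤-trans (≤-by 1# 0≤1 (sym (-‿inverseˡ 1#))) 0≤t) t≤1 _ bounded 0<l mean s)
      (exp-mono-≤ (≤-trans (≤-reflexive (solve 3 (λ t μ m →
          m :* (t :* μ :+ t :* t :* μ :- t :* ((# 1 :+ # 2 :* t) :* μ)) := :- (t :* t :* (m :* μ))) refl t μ (fromℕ m)))
        (neg-mono-≤ K≤)))

    lower-deviation : product (sampled 0# xs (tilt g (- t) ((1# - fromℕ 2 * t) * μ))) s ≤ exp (- K)
    lower-deviation = ≤-trans
      (chernoff g (neg-mono-≤ t≤1) (≤-trans (neg-mono-≤ 0≤t)
          (≤-by 1# 0≤1 (solve 0 (# 1 := (:- # 0) :+ # 1) refl))) _ bounded 0<l mean s)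
      (exp-mono-≤ (≤-trans (≤-reflexive (solve 3 (λ t μ m →
          m :* ((:- t) :* μ :+ (:- t) :* (:- t) :* μ :- (:- t) :* ((# 1 :- # 2 :* t) :* μ)) := :- (t :* t :* (m :* μ)))
          refl t μ (fromℕ m)))
        (neg-mono-≤ K≤)))

-- Propagation of relative errors.

module Estimates {ℓ} (R : Reals ℓ) where
  open OrderedField R
  open Probability R using (Within)

  ratio-≤ : ∀ {a b c} → 0# < a → 0# < b → c * a ≤ b → c * b ⁻¹ ≤ a ⁻¹
  ratio-≤ {a} {b} {c} 0<a 0<b ca≤b = *-cancelˡ-≤ (*-positive 0<a 0<b) (begin
    a * b * (c * b ⁻¹)    ≈⟨ solve 4 (λ a b c b′ → a :* b :* (c :* b′) := c :* a :* (b :* b′)) refl a b c (b ⁻¹) ⟩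
    c * a * (b * b ⁻¹)    ≈⟨ trans (*-congˡ (*-inverse 0<b)) (*-identityʳ _) ⟩
    c * a                 ≤⟨ ca≤b ⟩
    b                     ≈⟨ trans (*-congˡ (*-inverse 0<a)) (*-identityʳ _) ⟨
    b * (a * a ⁻¹)        ≈⟨ solve 3 (λ a b a′ → b :* (a :* a′) := a :* b :* a′) refl a b (a ⁻¹) ⟩
    a * b * a ⁻¹          ∎)
    where open ≤-Reasoning

  ≤-ratio : ∀ {a b c} → 0# < a → 0# < b → b ≤ c * a → a ⁻¹ ≤ c * b ⁻¹
  ≤-ratio {a} {b} {c} 0<a 0<b b≤ca = *-cancelˡ-≤ (*-positive 0<a 0<b) (begin
    a * b * a ⁻¹          ≈⟨ solve 3 (λ a b a′ → b :* (a :* a′) := a :* b :* a′) refl a b (a ⁻¹) ⟨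
    b * (a * a ⁻¹)        ≈⟨ trans (*-congˡ (*-inverse 0<a)) (*-identityʳ _) ⟩
    b                     ≤⟨ b≤ca ⟩
    c * a                 ≈⟨ trans (*-congˡ (*-inverse 0<b)) (*-identityʳ _) ⟨
    c * a * (b * b ⁻¹)    ≈⟨ solve 4 (λ a b c b′ → a :* b :* (c :* b′) := c :* a :* (b :* b′)) refl a b c (b ⁻¹) ⟨
    a * b * (c * b ⁻¹)    ∎)
    where open ≤-Reasoning

  rescale : ∀ {n t} x → 0# < t → n * t ⁻¹ * (t * x) ≈ n * x
  rescale {n} {t} x 0<t = trans (solve 4 (λ n t t′ x → n :* t′ :* (t :* x) := (t :* t′) :* (n :* x)) refl n t (t ⁻¹) x)
    (trans (*-congʳ (*-inverse 0<t)) (*-identityˡ _))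

  fraction : ∀ k x → fromℕ (suc k) * (x * fromℕ (suc k) ⁻¹) ≈ x
  fraction k x = trans (solve 3 (λ k x k′ → k :* (x :* k′) := x :* (k :* k′)) refl _ x _)
    (trans (*-congˡ (*-inverse (fromℕ-suc-positive k))) (*-identityʳ x))

  -- Reciprocals at most double a relative error δ ≤ 1/2, because (1 - 2δ)(1 + δ) ≤ 1 ≤ (1 + 2δ)(1 -
  -- δ).
  Within-⁻¹ : ∀ {ε δ d z} → 0# < d → 0# < z → 0# ≤ ε → ε ≤ 1# → fromℕ 2 * δ ≈ ε →
              (1# - δ) * d ≤ z → z ≤ (1# + δ) * d → Within ε (d ⁻¹) (z ⁻¹)
  Within-⁻¹ {ε} {δ} {d} {z} 0<d 0<z 0≤ε ε≤1 2δ≈ε lower upper =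
    ratio-≤ 0<z 0<d (begin
      (1# - ε) * z                  ≤⟨ *-monoˡ-≤ (x≤y⇒0≤y-x ε≤1) upper ⟩
      (1# - ε) * ((1# + δ) * d)     ≈⟨ *-congʳ (+-congˡ (-‿cong (sym 2δ≈ε))) ⟩
      (1# - fromℕ 2 * δ) * ((1# + δ) * d)
        ≤⟨ ≤-by _ (*-nonNegative (<⇒≤ 0<d) (*-nonNegative 0≤δ (+-nonNegative 0≤1 0≤2δ)))
             (solve 2 (λ δ d → d := (# 1 :- # 2 :* δ) :* ((# 1 :+ δ) :* d)
                                    :+ d :* (δ :* (# 1 :+ # 2 :* δ))) refl δ d) ⟩
      d                             ∎) ,
    ≤-ratio 0<z 0<d (begin
      d                             ≤⟨ ≤-by _ (*-nonNegative (<⇒≤ 0<d) (*-nonNegative 0≤δ 0≤1-2δ))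
             (solve 2 (λ δ d → (# 1 :+ # 2 :* δ) :* ((# 1 :- δ) :* d)
                             := d :+ d :* (δ :* (# 1 :- # 2 :* δ))) refl δ d) ⟩
      (1# + fromℕ 2 * δ) * ((1# - δ) * d) ≈⟨ *-congʳ (+-congˡ 2δ≈ε) ⟩
      (1# + ε) * ((1# - δ) * d)     ≤⟨ *-monoˡ-≤ (+-nonNegative 0≤1 0≤ε) lower ⟩
      (1# + ε) * z                  ∎)
    where
    open ≤-Reasoning
    0≤2δ : 0# ≤ fromℕ 2 * δ
    0≤2δ = ≤-respʳ-≈ (sym 2δ≈ε) 0≤ε
    0≤δ : 0# ≤ δ
    0≤δ = *-cancelˡ-≤ (fromℕ-suc-positive 1) (≤-respˡ-≈ (sym (zeroʳ _)) 0≤2δ)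
    0≤1-2δ : 0# ≤ 1# - fromℕ 2 * δ
    0≤1-2δ = x≤y⇒0≤y-x (≤-respˡ-≈ (sym 2δ≈ε) ε≤1)

  Within-+ : ∀ {ε x x̃ y ỹ} → Within ε x x̃ → Within ε y ỹ → Within ε (x + y) (x̃ + ỹ)
  Within-+ (x≤ , ≤x) (y≤ , ≤y) =
    ≤-respˡ-≈ (sym (distribˡ _ _ _)) (+-mono-≤ x≤ y≤) , ≤-respʳ-≈ (sym (distribˡ _ _ _)) (+-mono-≤ ≤x ≤y)

  Within-0 : ∀ {ε} → Within ε 0# 0#
  Within-0 = ≤-reflexive (zeroʳ _) , ≤-reflexive (sym (zeroʳ _))

  Within-cong : ∀ {ε x y x̃ ỹ} → x ≈ y → x̃ ≈ ỹ → Within ε x x̃ → Within ε y ỹ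
  Within-cong x≈y x̃≈ỹ (x≤ , ≤x) =
    ≤-respˡ-≈ (*-congˡ x≈y) (≤-respʳ-≈ x̃≈ỹ x≤) , ≤-respʳ-≈ (*-congˡ x≈y) (≤-respˡ-≈ x̃≈ỹ ≤x)

  Within-scale : ∀ {ε c t y μ} → 0# ≤ c → 0# < t → t * ((1# - ε) * μ) ≤ y → y ≤ t * ((1# + ε) * μ) →
                 Within ε (c * μ) (c * t ⁻¹ * y)
  Within-scale {ε} {c} {t} {y} {μ} 0≤c 0<t lower upper =
    ≤-respˡ-≈ (scaled (1# - ε)) (*-monoˡ-≤ 0≤c/t lower) ,
    ≤-respʳ-≈ (scaled (1# + ε)) (*-monoˡ-≤ 0≤c/t upper)
    where
    0≤c/t : 0# ≤ c * t ⁻¹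
    0≤c/t = *-nonNegative 0≤c (<⇒≤ (⁻¹-positive 0<t))
    scaled : ∀ k → c * t ⁻¹ * (t * (k * μ)) ≈ k * (c * μ)
    scaled k = trans (rescale (k * μ) 0<t) (solve 3 (λ c k μ → c :* (k :* μ) := k :* (c :* μ)) refl c k μ)

  Within-sumOver : ∀ {U : Set ℓ} {ε} {g h : U → Carrier} {xs} → All (λ x → Within ε (g x) (h x)) xs →
                   Within ε (ReservoirSampling.sumOver R g xs) (ReservoirSampling.sumOver R h xs)
  Within-sumOver []       = Within-0
  Within-sumOver (w ∷ ws) = Within-+ w (Within-sumOver ws)

-- The success probability as a nested expectation.

module Outcome {ℓ} (R : Reals ℓ) (n t₁ t₂ : ℕ) (ε θ : Reals.Carrier R)
               {U : Set ℓ} (f : U → U → Reals.Carrier R) (σ : Vec U n) where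
  open OrderedField R
  open Probability R
  open Expectation R
  open Chernoff R using (valueSum)
  open import Algebra.Properties.CommutativeMonoid.Sum +-commutativeMonoid using (sum-cong-≋)
  open Similarity R using (diversityIndex)
  open Streaming R using (run; scan; offline)
  open Streaming.Semantics R f using (Memory; similarity; exec; execScan; execStages)
  open ThreePass R n t₁ t₂ θ using (Γ; pass₁; pass₂; pass₃; finish; program)
  open Execution R n t₁ t₂ θ f

  T₂ : Carrier
  T₂ = fromℕ t₂

  module FirstPass = Pass₁ (replicate t₂ nothing) (replicate t₂ 0#) 0# 0# 0# 0#

  initialState : Memory Γ
  initialState = FirstPass.after (replicate t₁ nothing) 0#

  -- At `nothing` this is the unspecified 0# ⁻¹.  It does not matter, since the
  -- initial content of a reservoir has weight 0 in `sampled 0#`.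
  reciprocalDegree : Maybe U → Carrier
  reciprocalDegree a = (sum λ k → similarity a (just (lookup σ k))) ⁻¹

  tailStages : List (∃ (Streaming.Cmd R Γ))
  tailStages = (scan , pass₃) ∷ (offline , finish) ∷ []

  DI : Carrier
  DI = diversityIndex f σ

  success : Carrier → Carrier
  success r = indicator (within? ε DI r)

  0≤success : ∀ r → 0# ≤ success r
  0≤success r with within? ε DI r
  ... | yes _ = 0≤1
  ... | no  _ = ≤-refl

  success-Within : ∀ {r} → Within ε DI r → 1# ≤ success r
  success-Within {r} w with within? ε DI r
  ... | yes _ = ≤-refl
  ... | no ¬w = ⊥-elim (¬w w)

  output : Memory Γ → Carrier
  output = Streaming.Semantics.eval R f (Streaming.Program.output program) tt

  E-success-tail : Memory Γ → Carrier
  E-success-tail M = E (success ∘ output) (execStages tailStages σ M)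

  -- The third pass and `finish` toss no coins, so success is settled by the memory after the second
  -- pass.
  tail-outcome : ∀ s₁ s₂ j c y h → ∃ λ w →
    E-success-tail (state s₁ s₂ (replicate t₂ 0#) j c y h 0#) ≡ success (h + w) ×
    (c ≤ 0# → w ≈ 0#) × (¬ (c ≤ 0#) → w ≈ c * T₂ ⁻¹ * valueSum reciprocalDegree s₂)
  tail-outcome s₁ s₂ j c y h
    with d , eq₃ , d≈ ← Pass₃.execScan-pass₃ s₁ s₂ j c y h σ (replicate t₂ 0#)
    with w , eq₄ , w≈0 , w≈mean ← Pass₃.exec-finish s₁ s₂ j c y h d
    = w
    , ≡.trans (≡.cong (λ m → E (success ∘ output) (m >>= execStages ((offline , finish) ∷ []) σ)) eq₃)
              (≡.cong (λ m → E (success ∘ output) (m >>= execStages [] σ)) eq₄)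
    , w≈0
    , λ c≰0 → trans (w≈mean c≰0) (*-congˡ (sum-cong-≋ {t₂} λ i → ⁻¹-cong
        (trans (d≈ i) (trans (+-congʳ (reflexive (lookup-replicate i 0#))) (+-identityˡ _)))))

  0≤E-success-tail : ∀ s₁ s₂ j c y h → 0# ≤ E-success-tail (state s₁ s₂ (replicate t₂ 0#) j c y h 0#)
  0≤E-success-tail s₁ s₂ j c y h with w , eq , _ ← tail-outcome s₁ s₂ j c y h =
    ≤-respʳ-≈ (reflexive (≡.sym eq)) (0≤success (h + w))

  0≤E-success : ∀ s₁ j s₂ y → let open Pass₂ s₁ (replicate t₂ 0#) j 0# using (after) in
                0# ≤ E E-success-tail (execScan pass₂ σ (after s₂ 0# y 0#))
  0≤E-success s₁ j s₂ y = ≤-respˡ-≈ (E-const 0# (execScan pass₂ σ (after s₂ 0# y 0#))) (E-mono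
    (Valid-pass₂ {Q = λ M → ∃ λ s₂ → ∃ λ c → ∃ λ y → ∃ λ h → M ≡ after s₂ c y h} σ s₂ y 0#
       (λ s₂ y → s₂ , _ , y , _ , ≡.refl) ≤-refl)
    (λ { (s₂ , c , y , h , ≡.refl) → 0≤E-success-tail s₁ s₂ j c y h }))
    where open Pass₂ s₁ (replicate t₂ 0#) j 0#

  -- The split after the first pass allows the second to be analysed with `s₁` held fixed.
  Prob≈ : Prob (within? ε DI) (run f program σ)
          ≈ E (λ M → E E-success-tail (execScan pass₂ σ M)) (execScan pass₁ σ initialState)
  Prob≈ = trans (reflexive (≡.trans (Prob≡E (within? ε DI) (run f program σ))
      (≡.trans (E->>= success (m >>= execStages stages₂ σ) (λ M → return (output M)))
               (E->>= (success ∘ output) m (execStages stages₂ σ)))))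
    (E-cong (λ M → reflexive (E->>= (success ∘ output) (execScan pass₂ σ M) (execStages tailStages σ))) m)
    where
    m = execScan pass₁ σ initialState
    stages₂ : List (∃ (Streaming.Cmd R Γ))
    stages₂ = (scan , pass₂) ∷ tailStages

  Valid-initial : Valid (λ M → ∃ λ s₁ → ∃ λ j → M ≡ FirstPass.after s₁ j) (execScan pass₁ σ initialState)
  Valid-initial = FirstPass.Valid-pass₁ (λ s₁ j → s₁ , j , ≡.refl) σ (replicate t₁ nothing) ≤-refl

  -- Settles the lengths n < 4, for which the permitted failure probability is at least 1.
  Prob-nonNegative : 0# ≤ Prob (within? ε DI) (run f program σ)
  Prob-nonNegative = ≤-respʳ-≈ (sym Prob≈) (≤-respˡ-≈ (E-const 0# (execScan pass₁ σ initialState))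
    (E-mono Valid-initial (λ { (s₁ , j , ≡.refl) → 0≤E-success s₁ j (replicate t₂ nothing) 0# })))

-- Accuracy of the two estimates.

module Correctness {ℓ} (R : Reals ℓ) (n t₁ t₂ : ℕ) (ε θ l : Reals.Carrier R) where
  open OrderedField R
  open Exponential R
  open Probability R
  open Expectation R
  open ReservoirSampling R
  open Sums R
  open Chernoff R
  open Estimates R
  open import Algebra.Properties.CommutativeMonoid.Sum +-commutativeMonoid using (sum-cong-≋)

  N T₁ : Carrier
  N  = fromℕ n
  T₁ = fromℕ t₁

  -- The constants are those of the two Chernoff exponents. 64 = 2 * 16 * 2: exponent 2l, tilt ε/4,
  -- and mean at least θ/2 for dense items. 8 = 4 * 2: tilt ε/2, and sampled mean at most 2θ for
  -- light items.
  module _ (0<N : 0# < N) (0<T₁ : 0# < T₁) (0<T₂ : 0# < fromℕ t₂) (0<ε : 0# < ε) (ε≤1 : ε ≤ 1#)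
           (0<θ : 0# < θ) (0≤l : 0# ≤ l) (N≤expl : N ≤ exp l) (64l≤ε²θ : fromℕ 64 * l ≤ ε * ε * θ)
           (8θNl≤ε²T₁T₂ : fromℕ 8 * (θ * N * l) ≤ ε * ε * (T₁ * fromℕ t₂))
           {U : Set ℓ} (f : U → U → Carrier) (similar : Similarity.IsSimilarity R f) (σ : Vec U n)
    where
    open Similarity.IsSimilarity similar
    open Streaming R using (run)
    open Streaming.Semantics R f using (Memory; similarity; execScan)
    open ThreePass R n t₁ t₂ θ using (Γ; pass₁; pass₂; program)
    open Execution R n t₁ t₂ θ f
    open Outcome R n t₁ t₂ ε θ f σ

    degree : U → Carrier
    degree x = sum λ k → f x (lookup σ k)

    1≤degree : ∀ k → 1# ≤ degree (lookup σ k)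
    1≤degree k = ≤-respˡ-≈ (f-reflexive _) (term≤sum (λ i → nonNegative _ (lookup σ i)) k)

    0<degree : ∀ k → 0# < degree (lookup σ k)
    0<degree k = <-≤-trans 0<1 (1≤degree k)

    similarityTo : U → Maybe U → Carrier
    similarityTo x a = similarity a (just x)

    μ : U → Carrier
    μ x = degree x * N ⁻¹

    Nμ≈degree : ∀ x → N * μ x ≈ degree x
    Nμ≈degree x = trans (solve 3 (λ n d n′ → n :* (d :* n′) := d :* (n :* n′)) refl N (degree x) (N ⁻¹))
      (trans (*-congˡ (*-inverse 0<N)) (*-identityʳ _))

    items : List U
    items = toList σ

    length-items : fromℕ (length items) ≈ N
    length-items = reflexive (≡.cong fromℕ (length-toList σ))

    mean-similarity : ∀ x → fromℕ (length items) * μ x ≈ sumOver (similarityTo x ∘ just) items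
    mean-similarity x = trans (*-congʳ length-items) (trans (Nμ≈degree x)
      (trans (sum-cong-≋ {n} (λ k → f-symmetric x (lookup σ k)))
             (reflexive (≡.sym (sumOver-toList (similarityTo x ∘ just) σ)))))

    -- Items of degree at least about √n.  Only their estimates need to be
    -- accurate; the others must merely stay below the threshold.
    Dense : U → Set ℓ
    Dense x = θ ≤ fromℕ 2 * (T₁ * μ x)

    dense? : ∀ x → Dec (Dense x)
    dense? x = θ ≤? fromℕ 2 * (T₁ * μ x)

    ε/4 ε/2 ½ : Carrier
    ε/4 = ε * fromℕ 4 ⁻¹
    ε/2 = ε * fromℕ 2 ⁻¹
    ½   = 1# * fromℕ 2 ⁻¹

    0≤½ : 0# ≤ ½
    0≤½ = *-nonNegative 0≤1 (<⇒≤ (⁻¹-positive (fromℕ-suc-positive 1)))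

    fraction≤ : ∀ k {x} → 0# ≤ x → x ≤ 1# → x * fromℕ (suc k) ⁻¹ ≤ 1#
    fraction≤ k {x} 0≤x x≤1 = *-cancelˡ-≤ (fromℕ-suc-positive k) (≤-respˡ-≈ (sym (fraction k x))
      (≤-trans x≤1 (≤-by (fromℕ k) (fromℕ-nonNegative k) (*-identityʳ _))))

    0≤ε/ : ∀ k → 0# ≤ ε * fromℕ (suc k) ⁻¹
    0≤ε/ k = *-nonNegative (<⇒≤ 0<ε) (<⇒≤ (⁻¹-positive (fromℕ-suc-positive k)))

    -- A sparse item has only an upper tail at θ to fear, which stands in both places to keep
    -- `failure₁` uniform. The decision is an argument so that lemmas can split on it.
    upperTilt lowerTilt : ∀ x → Dec (Dense x) → Maybe U → Carrier
    upperTilt x (yes _) = tilt (similarityTo x) ε/4 ((1# + fromℕ 2 * ε/4) * μ x)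
    upperTilt x (no _)  = tilt (similarityTo x) ½ (θ * T₁ ⁻¹)
    lowerTilt x (yes _) = tilt (similarityTo x) (- ε/4) ((1# - fromℕ 2 * ε/4) * μ x)
    lowerTilt x (no _)  = tilt (similarityTo x) ½ (θ * T₁ ⁻¹)

    -- The summands are nonnegative, so a sum below 1 keeps each of them below 1 and thereby
    -- excludes every bad deviation at once.
    failure₁ : Vec (Maybe U) t₁ → Carrier
    failure₁ s = sum λ k → product (upperTilt (lookup σ k) (dense? (lookup σ k))) s
                         + product (lowerTilt (lookup σ k) (dense? (lookup σ k))) s

    bounded : ∀ x → All (λ y → 0# ≤ similarityTo x (just y) × similarityTo x (just y) ≤ 1#) items
    bounded x = All.universal (λ y → nonNegative y x , atMostOne y x) items

    0<length : 0# < fromℕ (length items)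
    0<length = <-≤-trans 0<N (≤-reflexive (sym length-items))

    2l≤ : ∀ x → Dense x → l + l ≤ ε/4 * ε/4 * (T₁ * μ x)
    2l≤ x dense = *-cancelˡ-≤ (fromℕ-suc-positive 31) (begin
      fromℕ 32 * (l + l)                   ≈⟨ solve 1 (λ l → # 32 :* (l :+ l) := # 64 :* l) refl l ⟩
      fromℕ 64 * l                         ≤⟨ 64l≤ε²θ ⟩
      ε * ε * θ                            ≤⟨ *-monoˡ-≤ (square-nonNegative ε) dense ⟩
      ε * ε * (fromℕ 2 * (T₁ * μ x))       ≈⟨ *-congʳ (*-cong (fraction 3 ε) (fraction 3 ε)) ⟨
      fromℕ 4 * ε/4 * (fromℕ 4 * ε/4) * (fromℕ 2 * (T₁ * μ x))
        ≈⟨ solve 2 (λ e m → # 4 :* e :* (# 4 :* e) :* (# 2 :* m) := # 32 :* (e :* e :* m)) refl ε/4 (T₁ * μ x) ⟩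
      fromℕ 32 * (ε/4 * ε/4 * (T₁ * μ x))  ∎)
      where open ≤-Reasoning

    ε²≤1 : ε * ε ≤ 1#
    ε²≤1 = ≤-respʳ-≈ (*-identityˡ 1#) (*-mono-≤ (<⇒≤ 0<ε) ε≤1 (<⇒≤ 0<ε) ε≤1)

    -- The threshold is more than twice the mean, so the fixed tilt 1/2 works: 3/4 * θ/2 - θ/2 =
    -- -θ/8, and θ ≥ 64l ≥ 16l.
    sparse-exponent : ∀ x → ¬ Dense x → T₁ * (½ * μ x + ½ * ½ * μ x - ½ * (θ * T₁ ⁻¹)) ≤ - (l + l)
    sparse-exponent x sparse = *-cancelˡ-≤ (fromℕ-suc-positive 7) (begin
      fromℕ 8 * (T₁ * (½ * μ x + ½ * ½ * μ x - ½ * (θ * T₁ ⁻¹)))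
        ≈⟨ solve 5 (λ t h m θ t′ → # 8 :* (t :* (h :* m :+ h :* h :* m :- h :* (θ :* t′)))
                 := # 2 :* h :* (# 4 :+ # 2 :* h :* # 2) :* (t :* m) :- # 2 :* h :* # 4 :* (θ :* (t :* t′)))
             refl T₁ ½ (μ x) θ (T₁ ⁻¹) ⟩
      fromℕ 2 * ½ * (fromℕ 4 + fromℕ 2 * ½ * fromℕ 2) * (T₁ * μ x) - fromℕ 2 * ½ * fromℕ 4 * (θ * (T₁ * T₁ ⁻¹))
        ≈⟨ +-cong (*-congʳ (*-cong 2½ (+-congˡ (*-congʳ 2½)))) (-‿cong (*-cong (*-congʳ 2½) (*-congˡ (*-inverse 0<T₁)))) ⟩
      1# * (fromℕ 4 + 1# * fromℕ 2) * (T₁ * μ x) - 1# * fromℕ 4 * (θ * 1#)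
        ≈⟨ solve 2 (λ m θ → # 1 :* (# 4 :+ # 1 :* # 2) :* m :- # 1 :* # 4 :* (θ :* # 1)
                          := # 3 :* (# 2 :* m) :- # 4 :* θ) refl (T₁ * μ x) θ ⟩
      fromℕ 3 * (fromℕ 2 * (T₁ * μ x)) - fromℕ 4 * θ
        ≤⟨ +-monoˡ-≤ _ (*-monoˡ-≤ (fromℕ-nonNegative 3) (<⇒≤ (≰⇒> sparse))) ⟩
      fromℕ 3 * θ - fromℕ 4 * θ             ≈⟨ solve 1 (λ θ → # 3 :* θ :- # 4 :* θ := :- (# 1 :* θ)) refl θ ⟩
      - (1# * θ)                            ≤⟨ neg-mono-≤ (≤-trans 64l≤ε²θ (*-monoʳ-≤ (<⇒≤ 0<θ) ε²≤1)) ⟩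
      - (fromℕ 64 * l)                      ≤⟨ neg-mono-≤ (≤-by (fromℕ 48 * l) (*-nonNegative (fromℕ-nonNegative 48) 0≤l)
                                                 (solve 1 (λ l → # 64 :* l := # 16 :* l :+ # 48 :* l) refl l)) ⟩
      - (fromℕ 16 * l)                      ≈⟨ solve 1 (λ l → :- (# 16 :* l) := # 8 :* (:- (l :+ l))) refl l ⟩
      fromℕ 8 * - (l + l)                   ∎)
      where
      open ≤-Reasoning
      2½ : fromℕ 2 * ½ ≈ 1#
      2½ = fraction 1 1#

    sparse-tail : ∀ x → ¬ Dense x → ∀ (s : Vec (Maybe U) t₁) →
                  product (sampled 0# items (tilt (similarityTo x) ½ (θ * T₁ ⁻¹))) s ≤ exp (- (l + l))
    sparse-tail x sparse s = ≤-trans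
      (chernoff (similarityTo x) (≤-trans (≤-by 1# 0≤1 (sym (-‿inverseˡ 1#))) 0≤½) (fraction≤ 1 0≤1 ≤-refl)
        (θ * T₁ ⁻¹) (bounded x) 0<length (mean-similarity x) s)
      (exp-mono-≤ (sparse-exponent x sparse))

    upperTilt-tail : ∀ x d (s : Vec (Maybe U) t₁) → product (sampled 0# items (upperTilt x d)) s ≤ exp (- (l + l))
    upperTilt-tail x (yes dense) s = upper-deviation (similarityTo x) (0≤ε/ 3) (fraction≤ 3 (<⇒≤ 0<ε) ε≤1)
      (bounded x) 0<length (mean-similarity x) (2l≤ x dense) s
    upperTilt-tail x (no sparse) s = sparse-tail x sparse s

    lowerTilt-tail : ∀ x d (s : Vec (Maybe U) t₁) → product (sampled 0# items (lowerTilt x d)) s ≤ exp (- (l + l))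
    lowerTilt-tail x (yes dense) s = lower-deviation (similarityTo x) (0≤ε/ 3) (fraction≤ 3 (<⇒≤ 0<ε) ε≤1)
      (bounded x) 0<length (mean-similarity x) (2l≤ x dense) s
    lowerTilt-tail x (no sparse) s = sparse-tail x sparse s

    exp-l≤ : exp (- l) ≤ N ⁻¹
    exp-l≤ = *-cancelˡ-≤ 0<N (≤-respʳ-≈ (sym (*-inverse 0<N)) (≤-respʳ-≈ (exp-neg l)
      (*-monoʳ-≤ (<⇒≤ (exp-positive _)) N≤expl)))

    upperTilt-nonNegative : ∀ x d (s : Vec (Maybe U) t₁) → 0# ≤ product (upperTilt x d) s
    upperTilt-nonNegative x (yes _) s = product-tilt-nonNegative _ _ _ s
    upperTilt-nonNegative x (no _)  s = product-tilt-nonNegative _ _ _ s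

    lowerTilt-nonNegative : ∀ x d (s : Vec (Maybe U) t₁) → 0# ≤ product (lowerTilt x d) s
    lowerTilt-nonNegative x (yes _) s = product-tilt-nonNegative _ _ _ s
    lowerTilt-nonNegative x (no _)  s = product-tilt-nonNegative _ _ _ s

    0≤failure₁ : ∀ s → 0# ≤ failure₁ s
    0≤failure₁ s = sum-nonNegative λ k →
      +-nonNegative (upperTilt-nonNegative _ (dense? (lookup σ k)) s) (lowerTilt-nonNegative _ (dense? (lookup σ k)) s)

    -- There are 2N tails, each with expectation at most exp (-2l) ≤ 1/N².
    E-failure₁ : E (failure₁ ∘ All.head) (execScan pass₁ σ initialState) ≤ fromℕ 2 * N ⁻¹
    E-failure₁ = begin
      E (failure₁ ∘ All.head) m
        ≈⟨ E-sum (λ k M → upper (lookup σ k) (All.head M) + lower (lookup σ k) (All.head M)) m ⟩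
      (sum λ k → E (λ M → upper (lookup σ k) (All.head M) + lower (lookup σ k) (All.head M)) m)
        ≤⟨ sum-≤-const (λ k → ≤-trans
             (≤-reflexive (E-+ (upper (lookup σ k) ∘ All.head) (lower (lookup σ k) ∘ All.head) m))
             (+-mono-≤
               (≤-respˡ-≈ (sym (FirstPass.E-pass₁ (λ _ _ → refl) σ s₀ 0#)) (upperTilt-tail _ (dense? (lookup σ k)) s₀))
               (≤-respˡ-≈ (sym (FirstPass.E-pass₁ (λ _ _ → refl) σ s₀ 0#)) (lowerTilt-tail _ (dense? (lookup σ k)) s₀)))) ⟩
      N * (exp (- (l + l)) + exp (- (l + l)))
        ≤⟨ *-monoˡ-≤ (<⇒≤ 0<N) (+-mono-≤ exp-2l≤ exp-2l≤) ⟩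
      N * (N ⁻¹ * N ⁻¹ + N ⁻¹ * N ⁻¹)
        ≈⟨ solve 2 (λ n n′ → n :* (n′ :* n′ :+ n′ :* n′) := n :* n′ :* (# 2 :* n′)) refl N (N ⁻¹) ⟩
      N * N ⁻¹ * (fromℕ 2 * N ⁻¹)
        ≈⟨ trans (*-congʳ (*-inverse 0<N)) (*-identityˡ _) ⟩
      fromℕ 2 * N ⁻¹ ∎
      where
      open ≤-Reasoning
      m  = execScan pass₁ σ initialState
      s₀ = replicate t₁ nothing
      upper lower : U → Vec (Maybe U) t₁ → Carrier
      upper x s = product (upperTilt x (dense? x)) s
      lower x s = product (lowerTilt x (dense? x)) s
      exp-2l≤ : exp (- (l + l)) ≤ N ⁻¹ * N ⁻¹
      exp-2l≤ = ≤-respˡ-≈ (trans (sym (exp-+ (- l) (- l))) (exp-cong (solve 1 (λ l → (:- l) :+ (:- l) := :- (l :+ l)) refl l)))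
        (*-mono-≤ (<⇒≤ (exp-positive _)) exp-l≤ (<⇒≤ (exp-positive _)) exp-l≤)

    v : U → Carrier
    v x = degree x ⁻¹

    1-x≤0 : ∀ {x} → 1# ≤ x → 1# + - x ≤ 0#
    1-x≤0 1≤x = ≤-respʳ-≈ (-‿inverseʳ _) (+-monoˡ-≤ _ 1≤x)

    E-1-x : ∀ {A : Set ℓ} (F : A → Carrier) m → E (λ x → 1# + - F x) m ≈ 1# + - E F m
    E-1-x F m = trans (E-+ (λ _ → 1#) (λ x → - F x) m) (+-cong (E-const 1# m) (E-neg F m))

    0≤2/N : 0# ≤ fromℕ 2 * N ⁻¹
    0≤2/N = *-nonNegative (fromℕ-nonNegative 2) (<⇒≤ (⁻¹-positive 0<N))

    module SecondPass (s₁ : Vec (Maybe U) t₁) (j : Carrier) where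
      open Pass₂ s₁ (replicate t₂ 0#) j 0# public

      -- A tilt of ε/4 controls the relative deviation ε/2, and the reciprocal doubles it to ε. A
      -- sparse item stays below θ and so cannot be heavy.
      heavy-Within : ∀ x d → 0# < degree x → product (upperTilt x d) s₁ < 1# → product (lowerTilt x d) s₁ < 1# →
                     Heavy x → Within ε (v x) (reciprocal x)
      heavy-Within x (yes _) 0<d Π⁺<1 Π⁻<1 θ≤Y = Within-⁻¹ 0<d
        (*-positive (*-positive 0<N (⁻¹-positive 0<T₁)) (<-≤-trans 0<θ θ≤Y)) (<⇒≤ 0<ε) ε≤1
        (trans (solve 1 (λ e → # 2 :* (# 2 :* e) := # 4 :* e) refl ε/4) (fraction 3 ε)) (proj₁ within) (proj₂ within)
        where
        within : Within (fromℕ 2 * ε/4) (degree x) (N * T₁ ⁻¹ * estimate x)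
        within = Within-cong (Nμ≈degree x) refl (Within-scale (<⇒≤ 0<N) 0<T₁
          (<⇒≤ (lower-tail (similarityTo x) _ s₁ (0≤ε/ 3) Π⁻<1))
          (<⇒≤ (upper-tail (similarityTo x) _ s₁ (0≤ε/ 3) Π⁺<1)))
      heavy-Within x (no _) 0<d Π⁺<1 _ θ≤Y = ⊥-elim (<⇒≱ (upper-tail (similarityTo x) _ s₁ 0≤½ Π⁺<1)
        (≤-respˡ-≈ (sym (fraction′ θ)) θ≤Y))
        where
        fraction′ : ∀ y → T₁ * (y * T₁ ⁻¹) ≈ y
        fraction′ y = trans (solve 3 (λ t y t′ → t :* (y :* t′) := y :* (t :* t′)) refl T₁ y (T₁ ⁻¹))
          (trans (*-congˡ (*-inverse 0<T₁)) (*-identityʳ y))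

      -- For a dense item (1 - ε/2) T₁ μ is below the estimate, hence below θ, and 1 - ε/2 ≥ 1/2.
      -- For a sparse one even T₁ μ ≤ θ/2 holds.
      light-μ : ∀ x d → 0# ≤ μ x → product (lowerTilt x d) s₁ < 1# → ¬ Heavy x → T₁ * μ x ≤ fromℕ 2 * θ
      light-μ x (yes _) 0≤μ Π⁻<1 θ≰Y = begin
        T₁ * μ x                                       ≤⟨ ≤-by _ (*-nonNegative (*-nonNegative (<⇒≤ 0<T₁) 0≤μ) (x≤y⇒0≤y-x ε≤1))
          (solve 3 (λ t m e → t :* m :* (# 2 :- e) := t :* m :+ t :* m :* (# 1 :- e)) refl T₁ (μ x) ε) ⟩
        T₁ * μ x * (fromℕ 2 - ε)                       ≈⟨ *-congˡ (+-congˡ (-‿cong (fraction 3 ε))) ⟨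
        T₁ * μ x * (fromℕ 2 - fromℕ 4 * ε/4)           ≈⟨ solve 3 (λ t m e → t :* m :* (# 2 :- # 4 :* e)
                                                            := # 2 :* (t :* ((# 1 :- # 2 :* e) :* m))) refl T₁ (μ x) ε/4 ⟩
        fromℕ 2 * (T₁ * ((1# - fromℕ 2 * ε/4) * μ x))  ≤⟨ *-monoˡ-≤ (fromℕ-nonNegative 2)
          (≤-trans (<⇒≤ (lower-tail (similarityTo x) _ s₁ (0≤ε/ 3) Π⁻<1)) (<⇒≤ (≰⇒> θ≰Y))) ⟩
        fromℕ 2 * θ                                    ∎
        where open ≤-Reasoning
      light-μ x (no sparse) 0≤μ _ _ = begin
        T₁ * μ x              ≤⟨ ≤-by (T₁ * μ x) (*-nonNegative (<⇒≤ 0<T₁) 0≤μ)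
                                   (solve 1 (λ y → # 2 :* y := y :+ y) refl (T₁ * μ x)) ⟩
        fromℕ 2 * (T₁ * μ x)  ≤⟨ <⇒≤ (≰⇒> sparse) ⟩
        θ                     ≤⟨ ≤-by θ (<⇒≤ 0<θ) (solve 1 (λ y → # 2 :* y := y :+ y) refl θ) ⟩
        fromℕ 2 * θ           ∎
        where open ≤-Reasoning

      light-v : ∀ x → 0# < degree x → T₁ * μ x ≤ fromℕ 2 * θ → T₁ ≤ fromℕ 2 * (θ * N) * v x
      light-v x 0<d Tμ≤2θ = *-cancelˡ-≤ 0<d (begin
        degree x * T₁                        ≈⟨ *-congʳ (Nμ≈degree x) ⟨
        N * μ x * T₁                         ≈⟨ solve 3 (λ n m t → n :* m :* t := n :* (t :* m)) refl N (μ x) T₁ ⟩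
        N * (T₁ * μ x)                       ≤⟨ *-monoˡ-≤ (<⇒≤ 0<N) Tμ≤2θ ⟩
        N * (fromℕ 2 * θ)                    ≈⟨ *-identityˡ _ ⟨
        1# * (N * (fromℕ 2 * θ))             ≈⟨ *-congʳ (*-inverse 0<d) ⟨
        degree x * v x * (N * (fromℕ 2 * θ))
          ≈⟨ solve 4 (λ d v n θ → d :* v :* (n :* (# 2 :* θ)) := d :* (# 2 :* (θ :* n) :* v)) refl (degree x) (v x) N θ ⟩
        degree x * (fromℕ 2 * (θ * N) * v x) ∎)
        where open ≤-Reasoning

      module _ (no-failure : failure₁ s₁ < 1#) where

        no-failure-at : ∀ k → product (upperTilt (lookup σ k) (dense? (lookup σ k))) s₁ < 1# ×
                              product (lowerTilt (lookup σ k) (dense? (lookup σ k))) s₁ < 1#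
        no-failure-at k = ≤-<-trans (≤-trans (≤-by _ 0≤Π⁻ refl) both≤) no-failure ,
                          ≤-<-trans (≤-trans (≤-by _ 0≤Π⁺ (+-comm _ _)) both≤) no-failure
          where
          0≤Π⁺ = upperTilt-nonNegative (lookup σ k) (dense? (lookup σ k)) s₁
          0≤Π⁻ = lowerTilt-nonNegative (lookup σ k) (dense? (lookup σ k)) s₁
          both≤ = term≤sum (λ k → +-nonNegative (upperTilt-nonNegative _ (dense? (lookup σ k)) s₁)
                                                (lowerTilt-nonNegative _ (dense? (lookup σ k)) s₁)) k

        all-heavy-Within : All (λ x → Within ε (v x) (reciprocal x)) (heavy σ)
        all-heavy-Within = All-filter heavy? σ λ k → heavy-Within _ (dense? (lookup σ k)) (0<degree k)
          (proj₁ (no-failure-at k)) (proj₂ (no-failure-at k))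

        all-light-v : All (λ x → T₁ ≤ fromℕ 2 * (θ * N) * v x) (light σ)
        all-light-v = All-filter (¬? ∘ heavy?) σ λ k θ≰Y → light-v _ (0<degree k)
          (light-μ _ (dense? (lookup σ k)) (*-nonNegative (<⇒≤ (0<degree k)) (<⇒≤ (⁻¹-positive 0<N)))
            (proj₂ (no-failure-at k)) θ≰Y)

        -- The self-loop makes every degree at least 1, which puts the sampled values in the range
        -- that the Chernoff bound requires.
        all-light-bounded : All (λ x → 0# ≤ reciprocalDegree (just x) × reciprocalDegree (just x) ≤ 1#) (light σ)
        all-light-bounded = All-filter (¬? ∘ heavy?) σ λ k _ →
          <⇒≤ (⁻¹-positive (0<degree k)) ,
          *-cancelˡ-≤ (0<degree k) (≤-respˡ-≈ (sym (*-inverse (0<degree k))) (≤-respʳ-≈ (sym (*-identityʳ _)) (1≤degree k)))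

        wH : Carrier
        wH = foldl addReciprocal 0# (heavy σ)

        count : Carrier
        count = foldl addOne 0# (light σ)

        count≈ : count ≈ fromℕ (length (light σ))
        count≈ = trans (foldl-count 0# (light σ)) (+-identityˡ _)

        Within-wH : Within ε (sumOver v (heavy σ)) wH
        Within-wH = Within-cong refl (sym (trans (foldl-sumOver reciprocal 0# (heavy σ)) (+-identityˡ _)))
          (Within-sumOver all-heavy-Within)

        DI≈ : DI ≈ sumOver v (heavy σ) + sumOver v (light σ)
        DI≈ = trans (reflexive (≡.sym (sumOver-toList v σ))) (sym (sumOver-partition heavy? v items))

        module _ (0<L : 0# < fromℕ (length (light σ))) where
          L W μ₂ : Carrier
          L  = fromℕ (length (light σ))
          W  = sumOver v (light σ)
          μ₂ = W * L ⁻¹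

          Lμ₂≈W : L * μ₂ ≈ W
          Lμ₂≈W = trans (solve 3 (λ l w l′ → l :* (w :* l′) := w :* (l :* l′)) refl L W (L ⁻¹))
            (trans (*-congˡ (*-inverse 0<L)) (*-identityʳ W))

          T₁≤ : T₁ ≤ fromℕ 2 * (θ * N) * μ₂
          T₁≤ = *-cancelˡ-≤ 0<L (begin
            L * T₁                                          ≤⟨ sumOver-≥-const all-light-v ⟩
            sumOver (λ x → fromℕ 2 * (θ * N) * v x) (light σ) ≈⟨ *-distribˡ-sumOver _ v (light σ) ⟨
            fromℕ 2 * (θ * N) * W                           ≈⟨ *-congˡ Lμ₂≈W ⟨
            fromℕ 2 * (θ * N) * (L * μ₂)                    ≈⟨ solve 3 (λ a l m → a :* (l :* m) := l :* (a :* m)) refl _ L μ₂ ⟩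
            L * (fromℕ 2 * (θ * N) * μ₂)                    ∎)
            where open ≤-Reasoning

          -- The exponent of the second estimate. No reciprocal is taken afterwards, so the tilt can
          -- be ε/2 instead of ε/4.
          l≤ : l ≤ ε/2 * ε/2 * (T₂ * μ₂)
          l≤ = *-cancelˡ-≤ (*-positive (fromℕ-suc-positive 7) (*-positive 0<θ 0<N)) (begin
            fromℕ 8 * (θ * N) * l                            ≈⟨ *-assoc _ _ _ ⟩
            fromℕ 8 * (θ * N * l)                            ≤⟨ 8θNl≤ε²T₁T₂ ⟩
            ε * ε * (T₁ * T₂)                                ≤⟨ *-monoˡ-≤ (square-nonNegative ε) (*-monoʳ-≤ (<⇒≤ 0<T₂) T₁≤) ⟩
            ε * ε * (fromℕ 2 * (θ * N) * μ₂ * T₂)            ≈⟨ *-congʳ (*-cong (fraction 1 ε) (fraction 1 ε)) ⟨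
            fromℕ 2 * ε/2 * (fromℕ 2 * ε/2) * (fromℕ 2 * (θ * N) * μ₂ * T₂)
              ≈⟨ solve 4 (λ e a m t → # 2 :* e :* (# 2 :* e) :* (# 2 :* a :* m :* t) := # 8 :* a :* (e :* e :* (t :* m)))
                   refl ε/2 (θ * N) μ₂ T₂ ⟩
            fromℕ 8 * (θ * N) * (ε/2 * ε/2 * (T₂ * μ₂))      ∎)
            where open ≤-Reasoning

          upper₂ lower₂ : Maybe U → Carrier
          upper₂ = tilt reciprocalDegree ε/2 ((1# + fromℕ 2 * ε/2) * μ₂)
          lower₂ = tilt reciprocalDegree (- ε/2) ((1# - fromℕ 2 * ε/2) * μ₂)

          Within-wL : ∀ {w} (s₂ : Vec (Maybe U) t₂) → product upper₂ s₂ < 1# → product lower₂ s₂ < 1# →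
                      w ≈ count * T₂ ⁻¹ * valueSum reciprocalDegree s₂ → Within ε W w
          Within-wL s₂ Π⁺<1 Π⁻<1 w≈ = Within-cong (trans (*-congʳ count≈) Lμ₂≈W) (sym w≈) (Within-scale
            (≤-respʳ-≈ (sym count≈) (<⇒≤ 0<L)) 0<T₂
            (≤-respˡ-≈ (*-congˡ (*-congʳ (+-congˡ (-‿cong (fraction 1 ε)))))
              (<⇒≤ (lower-tail reciprocalDegree _ s₂ (0≤ε/ 1) Π⁻<1)))
            (≤-respʳ-≈ (*-congˡ (*-congʳ (+-congˡ (fraction 1 ε))))
              (<⇒≤ (upper-tail reciprocalDegree _ s₂ (0≤ε/ 1) Π⁺<1))))

          failure₂ : Vec (Maybe U) t₂ → Carrier
          failure₂ s₂ = product upper₂ s₂ + product lower₂ s₂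

          -- If one of the products reaches 1, the left side is at most 0. Otherwise neither
          -- deviation occurs and the run succeeds for certain.
          success-≥ : ∀ s₂ y → 1# + - failure₂ s₂ ≤ E-success-tail (after s₂ count y wH)
          success-≥ s₂ y with 1# ≤? product upper₂ s₂ | 1# ≤? product lower₂ s₂
          ... | yes 1≤Π⁺ | _ = ≤-trans (1-x≤0 (≤-trans 1≤Π⁺ (≤-by _ (product-tilt-nonNegative _ _ _ s₂) refl)))
                                 (0≤E-success-tail s₁ s₂ j count y wH)
          ... | no _ | yes 1≤Π⁻ = ≤-trans (1-x≤0 (≤-trans 1≤Π⁻ (≤-by _ (product-tilt-nonNegative _ _ _ s₂) (+-comm _ _))))
                                    (0≤E-success-tail s₁ s₂ j count y wH)
          ... | no 1≰Π⁺ | no 1≰Π⁻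
            with w , eq , _ , w≈ ← tail-outcome s₁ s₂ j count y wH
            = ≤-trans
                (≤-by (failure₂ s₂) (+-nonNegative (product-tilt-nonNegative _ _ _ s₂) (product-tilt-nonNegative _ _ _ s₂))
                  (solve 1 (λ x → # 1 := # 1 :+ (:- x) :+ x) refl (failure₂ s₂)))
                (≤-respʳ-≈ (reflexive (≡.sym eq)) (success-Within (Within-cong (sym DI≈) refl (Within-+ Within-wH
                  (Within-wL s₂ (≰⇒> 1≰Π⁺) (≰⇒> 1≰Π⁻) (w≈ (<⇒≱ (<-≤-trans 0<L (≤-reflexive (sym count≈))))))))))

          E-success-some : ∀ s₂ y →
            1# + - (fromℕ 2 * N ⁻¹) ≤ E E-success-tail (execScan pass₂ σ (after s₂ 0# y 0#))
          E-success-some s₂ y = begin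
            1# + - (fromℕ 2 * N ⁻¹)
              ≤⟨ +-monoʳ-≤ 1# (neg-mono-≤ (≤-respʳ-≈ (solve 1 (λ x → x :+ x := # 2 :* x) refl (N ⁻¹)) (+-mono-≤
                   (≤-respˡ-≈ (sym (E-pass₂ (λ _ _ _ _ → refl) σ s₂ 0# y 0#))
                     (≤-trans (upper-deviation reciprocalDegree (0≤ε/ 1) (fraction≤ 1 (<⇒≤ 0<ε) ε≤1)
                       all-light-bounded 0<L Lμ₂≈W l≤ s₂) exp-l≤))
                   (≤-respˡ-≈ (sym (E-pass₂ (λ _ _ _ _ → refl) σ s₂ 0# y 0#))
                     (≤-trans (lower-deviation reciprocalDegree (0≤ε/ 1) (fraction≤ 1 (<⇒≤ 0<ε) ε≤1)
                       all-light-bounded 0<L Lμ₂≈W l≤ s₂) exp-l≤))))) ⟩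
            1# + - (E (product upper₂ ∘ second) m + E (product lower₂ ∘ second) m)
              ≈⟨ +-congˡ (-‿cong (E-+ (product upper₂ ∘ second) (product lower₂ ∘ second) m)) ⟨
            1# + - E (failure₂ ∘ second) m
              ≈⟨ E-1-x (failure₂ ∘ second) m ⟨
            E (λ M → 1# + - failure₂ (second M)) m
              ≤⟨ E-mono (Valid-pass₂ {Q = λ M → ∃ λ s₂ → ∃ λ y → M ≡ after s₂ count y wH} σ s₂ y 0#
                   (λ s₂ y → s₂ , y , ≡.refl) ≤-refl) (λ { (s₂ , y , ≡.refl) → success-≥ s₂ y }) ⟩
            E E-success-tail m ∎
            where
            open ≤-Reasoning
            m = execScan pass₂ σ (after s₂ 0# y 0#)
            second : Memory Γ → Vec (Maybe U) t₂
            second M = All.head (All.tail M)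

        -- There is no mean to estimate here. The counter is 0, so `finish` takes the branch that
        -- yields `0#`, the exact light contribution.
        E-success-none : light σ ≡ [] → ∀ s₂ y → 1# ≤ E E-success-tail (execScan pass₂ σ (after s₂ 0# y 0#))
        E-success-none light≡[] s₂ y = ≤-respˡ-≈ (E-const 1# m)
          (E-mono (Valid-pass₂ {Q = λ M → ∃ λ s₂ → ∃ λ y → M ≡ after s₂ count y wH} σ s₂ y 0#
                     (λ s₂ y → s₂ , y , ≡.refl) ≤-refl)
                  (λ { (s₂ , y , ≡.refl) → success-none s₂ y }))
          where
          m = execScan pass₂ σ (after s₂ 0# y 0#)
          success-none : ∀ s₂ y → 1# ≤ E-success-tail (after s₂ count y wH)
          success-none s₂ y with w , eq , w≈ , _ ← tail-outcome s₁ s₂ j count y wH =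
            ≤-respʳ-≈ (reflexive (≡.sym eq)) (success-Within (Within-cong (sym DI≈) refl (Within-+ Within-wH
              (Within-cong (reflexive (≡.sym (≡.cong (sumOver v) light≡[])))
                (sym (w≈ (≤-reflexive (reflexive (≡.cong (foldl addOne 0#) light≡[]))))) Within-0))))

      -- Holds for every `s₁`, good or bad, so that it can be integrated over the first pass without
      -- conditioning.
      E-success-≥ : ∀ s₂ y → 1# + - (failure₁ s₁ + fromℕ 2 * N ⁻¹)
                    ≤ E E-success-tail (execScan pass₂ σ (after s₂ 0# y 0#))
      E-success-≥ s₂ y with 1# ≤? failure₁ s₁ | light σ in light≡
      ... | yes 1≤failure | _ = ≤-trans (1-x≤0 (≤-trans 1≤failure (≤-by _ 0≤2/N refl)))
        (0≤E-success s₁ j s₂ y)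
      ... | no 1≰failure | [] = ≤-trans (≤-by _ (+-nonNegative (0≤failure₁ s₁) 0≤2/N)
                                  (solve 1 (λ x → # 1 := # 1 :+ (:- x) :+ x) refl _))
                                  (E-success-none (≰⇒> 1≰failure) light≡ s₂ y)
      ... | no 1≰failure | x ∷ xs = ≤-trans
        (+-monoʳ-≤ 1# (neg-mono-≤ (≤-by (failure₁ s₁) (0≤failure₁ s₁) (+-comm _ _))))
        (E-success-some (≰⇒> 1≰failure)
          (≡.subst (λ L → 0# < fromℕ (length L)) (≡.sym light≡) (fromℕ-suc-positive (length xs))) s₂ y)

    approximation : IsApproximation ε (fromℕ 4 * N ⁻¹) DI (run f program σ)
    approximation = ≤-respʳ-≈ (sym Prob≈) (begin
      1# - fromℕ 4 * N ⁻¹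
        ≈⟨ solve 1 (λ x → # 1 :- # 4 :* x := # 1 :+ (:- (# 2 :* x :+ # 2 :* x))) refl (N ⁻¹) ⟩
      1# + - (fromℕ 2 * N ⁻¹ + fromℕ 2 * N ⁻¹)
        ≤⟨ +-monoʳ-≤ 1# (neg-mono-≤ (+-monoˡ-≤ _ E-failure₁)) ⟩
      1# + - (E (failure₁ ∘ All.head) m + fromℕ 2 * N ⁻¹)
        ≈⟨ +-congˡ (-‿cong (trans (E-+ (failure₁ ∘ All.head) (λ _ → fromℕ 2 * N ⁻¹) m) (+-congˡ (E-const _ m)))) ⟨
      1# + - E (λ M → failure₁ (All.head M) + fromℕ 2 * N ⁻¹) m
        ≈⟨ E-1-x (λ M → failure₁ (All.head M) + fromℕ 2 * N ⁻¹) m ⟨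
      E (λ M → 1# + - (failure₁ (All.head M) + fromℕ 2 * N ⁻¹)) m
        ≤⟨ E-mono Valid-initial
             (λ { (s₁ , j , ≡.refl) → SecondPass.E-success-≥ s₁ j (replicate t₂ nothing) 0# }) ⟩
      E (λ M → E E-success-tail (execScan pass₂ σ M)) m ∎)
      where
      open ≤-Reasoning
      m = execScan pass₁ σ initialState

-- Numerical bounds on the parameters.

module ParameterBounds {ℓ} (R : Reals ℓ) (n : ℕ) (ε √n logn : Reals.Carrier R) (t₁ t₂ : ℕ) where
  open OrderedField R
  open Analysis R
  open Exponential R
  open Parameters R √n logn ε

  module Bounds (4≤n : 4 ℕ.≤ n) (0<ε : 0# < ε) (ε<1 : ε < 1#) (sqrt : IsSqrt (fromℕ n) √n)
           (log : IsLog (fromℕ n) logn) (rounding₁ : IsRounding size₁ t₁) (rounding₂ : IsRounding size₂ t₂) where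

    N T₁ T₂ q x : Carrier
    N  = fromℕ n
    T₁ = fromℕ t₁
    T₂ = fromℕ t₂
    q  = (ε * ε) ⁻¹
    x  = √n * logn * q

    0<N : 0# < N
    0<N = <-≤-trans (fromℕ-suc-positive 3) (fromℕ-mono-≤ 4≤n)

    1≤logn : 1# ≤ logn
    1≤logn = IsLog⇒1≤ 4≤n log

    0<ε² : 0# < ε * ε
    0<ε² = *-positive 0<ε 0<ε

    ε²q≈1 : ε * ε * q ≈ 1#
    ε²q≈1 = *-inverse 0<ε²

    0<q : 0# < q
    0<q = ⁻¹-positive 0<ε²

    1≤q : 1# ≤ q
    1≤q = begin
      1#         ≈⟨ ε²q≈1 ⟨
      ε * ε * q  ≤⟨ *-monoʳ-≤ (<⇒≤ 0<q) (*-mono-≤ (<⇒≤ 0<ε) (<⇒≤ ε<1) (<⇒≤ 0<ε) (<⇒≤ ε<1)) ⟩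
      1# * 1# * q ≈⟨ solve 1 (λ q → # 1 :* # 1 :* q := q) refl q ⟩
      q          ∎
      where open ≤-Reasoning

    1≤√n : 1# ≤ √n
    1≤√n = ≮⇒≥ λ √n<1 → <⇒≱ (<-by (fromℕ 3) (fromℕ-suc-positive 2) (solve 0 (# 4 := # 1 :* # 1 :+ # 3) refl)) (begin
      fromℕ 4  ≤⟨ fromℕ-mono-≤ 4≤n ⟩
      N        ≈⟨ proj₂ sqrt ⟨
      √n * √n  ≤⟨ *-mono-≤ (proj₁ sqrt) (<⇒≤ √n<1) (proj₁ sqrt) (<⇒≤ √n<1) ⟩
      1# * 1#  ∎)
      where open ≤-Reasoning

    1≤x : 1# ≤ x
    1≤x = ≤-respˡ-≈ (solve 0 (# 1 :* # 1 :* # 1 := # 1) refl)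
      (*-mono-≤ (*-nonNegative 0≤1 0≤1) (*-mono-≤ 0≤1 1≤√n 0≤1 1≤logn) 0≤1 1≤q)

    size₁≈ : size₁ ≈ fromℕ 48 * x
    size₁≈ = solve 3 (λ s l q → # 48 :* s :* l :* q := # 48 :* (s :* l :* q)) refl √n logn q

    size₂≈ : size₂ ≈ fromℕ 36 * x
    size₂≈ = solve 3 (λ s l q → # 36 :* s :* l :* q := # 36 :* (s :* l :* q)) refl √n logn q

    -- Rounding loses less than 1, and 1 is at most a third of (3 + k) x because x ≥ 1.
    rounding-≥ : ∀ {y} t k → y ≈ fromℕ (3 ℕ.+ k) * x → IsRounding y t →
                 fromℕ 2 * (fromℕ (3 ℕ.+ k) * x) ≤ fromℕ 3 * fromℕ t
    rounding-≥ {y} t k y≈ (y-t<1 , _) = begin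
      fromℕ 2 * (fromℕ (3 ℕ.+ k) * x)
        ≤⟨ ≤-by _ (*-nonNegative (fromℕ-nonNegative 3) (x≤y⇒0≤y-x (<⇒≤ y-t<1))) refl ⟩
      fromℕ 2 * (fromℕ (3 ℕ.+ k) * x) + fromℕ 3 * (1# - (y - fromℕ t))
        ≈⟨ +-congˡ (*-congˡ (+-congˡ (-‿cong (+-congʳ y≈)))) ⟩
      fromℕ 2 * (fromℕ (3 ℕ.+ k) * x) + fromℕ 3 * (1# - (fromℕ (3 ℕ.+ k) * x - fromℕ t))
        ≤⟨ ≤-by _ (+-nonNegative (*-nonNegative (fromℕ-nonNegative k) (≤-trans 0≤1 1≤x))
                                 (*-nonNegative (fromℕ-nonNegative 3) (x≤y⇒0≤y-x 1≤x)))
             (solve 3 (λ k x t → # 3 :* t := # 2 :* ((# 1 :+ (# 1 :+ (# 1 :+ k))) :* x)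
                  :+ # 3 :* (# 1 :- ((# 1 :+ (# 1 :+ (# 1 :+ k))) :* x :- t)) :+ (k :* x :+ # 3 :* (x :- # 1)))
                refl (fromℕ k) x (fromℕ t)) ⟩
      fromℕ 3 * fromℕ t ∎
      where open ≤-Reasoning

    2s₁≤3T₁ : fromℕ 2 * (fromℕ 48 * x) ≤ fromℕ 3 * T₁
    2s₁≤3T₁ = rounding-≥ t₁ 45 size₁≈ rounding₁

    2s₂≤3T₂ : fromℕ 2 * (fromℕ 36 * x) ≤ fromℕ 3 * T₂
    2s₂≤3T₂ = rounding-≥ t₂ 33 size₂≈ rounding₂

    0<3t⇒0<t : ∀ {t} → 0# < fromℕ 3 * t → 0# < t
    0<3t⇒0<t 0<3t = ≰⇒> λ t≤0 → <⇒≱ 0<3t (≤-respʳ-≈ (zeroʳ _) (*-monoˡ-≤ (fromℕ-nonNegative 3) t≤0))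

    0<x : 0# < x
    0<x = <-≤-trans 0<1 1≤x

    0<T₁ : 0# < T₁
    0<T₁ = 0<3t⇒0<t (<-≤-trans (*-positive (fromℕ-suc-positive 1) (*-positive (fromℕ-suc-positive 47) 0<x)) 2s₁≤3T₁)

    0<T₂ : 0# < T₂
    0<T₂ = 0<3t⇒0<t (<-≤-trans (*-positive (fromℕ-suc-positive 1) (*-positive (fromℕ-suc-positive 35) 0<x)) 2s₂≤3T₂)

    0<threshold : 0# < threshold
    0<threshold = *-positive (*-positive (fromℕ-suc-positive 95) (<-≤-trans 0<1 1≤logn)) 0<q

    64logn≤ : fromℕ 64 * logn ≤ ε * ε * threshold
    64logn≤ = begin
      fromℕ 64 * logn              ≤⟨ ≤-by _ (*-nonNegative (fromℕ-nonNegative 32) (≤-trans 0≤1 1≤logn))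
                                        (solve 1 (λ l → # 96 :* l :* # 1 := # 64 :* l :+ # 32 :* l) refl logn) ⟩
      fromℕ 96 * logn * 1#         ≈⟨ *-congˡ ε²q≈1 ⟨
      fromℕ 96 * logn * (ε * ε * q)
        ≈⟨ solve 3 (λ l e q → # 96 :* l :* (e :* q) := e :* (# 96 :* l :* q)) refl logn (ε * ε) q ⟩
      ε * ε * threshold            ∎
      where open ≤-Reasoning

    8θNlogn≤ : fromℕ 8 * (threshold * N * logn) ≤ ε * ε * (T₁ * T₂)
    8θNlogn≤ = *-cancelˡ-≤ (fromℕ-suc-positive 8) (begin
      fromℕ 9 * (fromℕ 8 * (threshold * N * logn))
        ≈⟨ *-congˡ (*-congˡ (*-congʳ (*-congˡ (proj₂ sqrt)))) ⟨
      fromℕ 9 * (fromℕ 8 * (threshold * (√n * √n) * logn))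
        ≈⟨ solve 3 (λ s l q → # 9 :* (# 8 :* (# 96 :* l :* q :* (s :* s) :* l))
                            := # 6912 :* (s :* s :* l :* l :* q) :* # 1) refl √n logn q ⟩
      fromℕ 6912 * (√n * √n * logn * logn * q) * 1#
        ≈⟨ *-congˡ ε²q≈1 ⟨
      fromℕ 6912 * (√n * √n * logn * logn * q) * (ε * ε * q)
        ≈⟨ solve 4 (λ s l q e → # 6912 :* (s :* s :* l :* l :* q) :* (e :* q)
             := e :* (# 2 :* (# 48 :* (s :* l :* q)) :* (# 2 :* (# 36 :* (s :* l :* q))))) refl √n logn q (ε * ε) ⟩
      ε * ε * (fromℕ 2 * (fromℕ 48 * x) * (fromℕ 2 * (fromℕ 36 * x)))
        -- The loss of a third in each size is just affordable: 48 * 36 * 4/9 = 768 = 8 * 96.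
        ≤⟨ *-monoˡ-≤ (<⇒≤ 0<ε²) (*-mono-≤ (double 48) 2s₁≤3T₁ (double 36) 2s₂≤3T₂) ⟩
      ε * ε * (fromℕ 3 * T₁ * (fromℕ 3 * T₂))
        ≈⟨ solve 3 (λ e a b → e :* (# 3 :* a :* (# 3 :* b)) := # 9 :* (e :* (a :* b))) refl (ε * ε) T₁ T₂ ⟩
      fromℕ 9 * (ε * ε * (T₁ * T₂)) ∎)
      where
      open ≤-Reasoning
      double : ∀ k → 0# ≤ fromℕ 2 * (fromℕ k * x)
      double k = *-nonNegative (fromℕ-nonNegative 2) (*-nonNegative (fromℕ-nonNegative k) (<⇒≤ 0<x))

    -- 123 is 48 + 36 + 36 for the three arrays plus 3 for their rounding. Since x ≥ 1, the
    -- roundings and the `k` extra words are absorbed into multiples of x.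
    words-≤ : ∀ k → fromℕ (t₁ ℕ.+ (t₂ ℕ.+ (t₂ ℕ.+ k))) ≤ fromℕ (123 ℕ.+ k) * (q * √n * logn)
    words-≤ k = begin
      fromℕ (t₁ ℕ.+ (t₂ ℕ.+ (t₂ ℕ.+ k)))
        ≈⟨ trans (fromℕ-+ t₁ _) (+-congˡ (trans (fromℕ-+ t₂ _) (+-congˡ (fromℕ-+ t₂ k)))) ⟩
      T₁ + (T₂ + (T₂ + fromℕ k))
        ≤⟨ +-mono-≤ (rounding-≤ t₁ 48 size₁≈ rounding₁) (+-mono-≤ (rounding-≤ t₂ 36 size₂≈ rounding₂)
             (+-monoˡ-≤ _ (rounding-≤ t₂ 36 size₂≈ rounding₂))) ⟩
      fromℕ 48 * x + 1# + (fromℕ 36 * x + 1# + (fromℕ 36 * x + 1# + fromℕ k))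
        ≤⟨ ≤-by _ (*-nonNegative (+-nonNegative (fromℕ-nonNegative 3) (fromℕ-nonNegative k)) (x≤y⇒0≤y-x 1≤x))
             (solve 2 (λ x k → (# 123 :+ k) :* x
               := # 48 :* x :+ # 1 :+ (# 36 :* x :+ # 1 :+ (# 36 :* x :+ # 1 :+ k))
                  :+ (# 3 :+ k) :* (x :- # 1)) refl x (fromℕ k)) ⟩
      (fromℕ 123 + fromℕ k) * x
        ≈⟨ *-cong (sym (fromℕ-+ 123 k)) (solve 3 (λ s l q → s :* l :* q := q :* s :* l) refl √n logn q) ⟩
      fromℕ (123 ℕ.+ k) * (q * √n * logn) ∎
      where
      open ≤-Reasoning
      rounding-≤ : ∀ {y} t k → y ≈ fromℕ k * x → IsRounding y t → fromℕ t ≤ fromℕ k * x + 1#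
      rounding-≤ {y} t k y≈ (_ , t-y<1) = begin
        fromℕ t            ≈⟨ solve 2 (λ t y → t := y :+ (t :- y)) refl (fromℕ t) y ⟩
        y + (fromℕ t - y)  ≤⟨ +-mono-≤ (≤-reflexive y≈) (<⇒≤ t-y<1) ⟩
        fromℕ k * x + 1#   ∎

-- Space used by the program.

module Space {ℓ} (R : Reals ℓ) (n t₁ t₂ : ℕ) (θ : Reals.Carrier R) where
  open Streaming R
  open ThreePass R n t₁ t₂ θ

  maximum-≤ : ∀ {m b} (a : Fin m → ℕ) → (∀ i → a i ℕ.≤ b) → maximum a ℕ.≤ b
  maximum-≤ {zero}  a a≤b = ℕ.z≤n
  maximum-≤ {suc m} a a≤b = ℕ.⊔-lub (a≤b Fin.zero) (maximum-≤ (λ i → a (Fin.suc i)) (λ i → a≤b (Fin.suc i)))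

  -- The largest scratch demand is 9 words, for the update of `W-H` and for the mean in `finish`
  -- (when t₂ > 0); 10 is a round bound.
  ≤10 : ∀ k {_ : True (k ℕ.≤? 10)} → k ℕ.≤ 10
  ≤10 k {k≤10} = toWitness k≤10

  loop-≤10 : ∀ m j k {_ : True (j ℕ.+ k ℕ.≤? 10)} → j ℕ.+ maximum {m} (λ _ → k) ℕ.≤ 10
  loop-≤10 m j k {j+k≤10} = ℕ.≤-trans (ℕ.+-monoʳ-≤ j (maximum-≤ {m} (λ _ → k) (λ _ → ℕ.≤-refl))) (toWitness j+k≤10)

  reservoir-≤10 : ∀ m → 3 ℕ.⊔ (1 ℕ.+ maximum {m} (λ _ → 2)) ℕ.≤ 10
  reservoir-≤10 m = ℕ.⊔-lub {_} {3} {1 ℕ.+ maximum {m} (λ _ → 2)} (≤10 3) (loop-≤10 m 1 2)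

  scratch₂ : cmdScratch pass₂ ℕ.≤ 10
  scratch₂ = ℕ.⊔-lub {_} {2 ℕ.+ maximum {t₁} (λ _ → 1)} {9 ℕ.⊔ (3 ℕ.⊔ (1 ℕ.+ maximum {t₂} (λ _ → 2)))}
    (loop-≤10 t₁ 2 1)
    (ℕ.⊔-lub {_} {9} {3 ℕ.⊔ (1 ℕ.+ maximum {t₂} (λ _ → 2))} (≤10 9) (reservoir-≤10 t₂))

  scratch₄ : cmdScratch finish ℕ.≤ 10
  scratch₄ = ℕ.⊔-lub {_} {2} {7 ℕ.+ maximum {t₂} (λ _ → 2)} (≤10 2) (loop-≤10 t₂ 7 2)

  scratch-≤ : (cmdScratch pass₁ ℕ.⊔ (cmdScratch pass₂ ℕ.⊔ (cmdScratch pass₃ ℕ.⊔ (cmdScratch finish ℕ.⊔ 0))))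
              ℕ.⊔ 3 ℕ.≤ 10
  scratch-≤ =
    ℕ.⊔-lub {_} {cmdScratch pass₁ ℕ.⊔ (cmdScratch pass₂ ℕ.⊔ (cmdScratch pass₃ ℕ.⊔ (cmdScratch finish ℕ.⊔ 0)))} {3}
      (ℕ.⊔-lub {_} {cmdScratch pass₁} {cmdScratch pass₂ ℕ.⊔ (cmdScratch pass₃ ℕ.⊔ (cmdScratch finish ℕ.⊔ 0))}
        (reservoir-≤10 t₁)
        (ℕ.⊔-lub {_} {cmdScratch pass₂} {cmdScratch pass₃ ℕ.⊔ (cmdScratch finish ℕ.⊔ 0)} scratch₂
          (ℕ.⊔-lub {_} {cmdScratch pass₃} {cmdScratch finish ℕ.⊔ 0} (loop-≤10 t₂ 1 3)
            (ℕ.⊔-lub {_} {cmdScratch finish} {0} scratch₄ ℕ.z≤n))))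
      (≤10 3)

  -- The 16 words are five scalar cells, the arriving item and the scratch bound 10.
  space-≤ : space program ℕ.≤ t₁ ℕ.+ (t₂ ℕ.+ (t₂ ℕ.+ 16))
  space-≤ = ℕ.≤-trans (ℕ.+-monoʳ-≤ (t₁ ℕ.+ (t₂ ℕ.+ (t₂ ℕ.+ 5)) ℕ.+ 1) scratch-≤)
    (ℕ.≤-reflexive (solve 2 (λ a b → a :+ (b :+ (b :+ con 5)) :+ con 1 :+ con 10 := a :+ (b :+ (b :+ con 16)))
      ≡.refl t₁ t₂))
    where open +-*-Solver

-- The failure probability 4/n.

module FailureProbability {ℓ} (R : Reals ℓ) where
  open OrderedField R
  open Analysis R

  -- 2/n for each reservoir. The reciprocal of `0#` is unspecified, so the empty stream gets the
  -- trivial value `1#`.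
  failure : ℕ → Carrier
  failure zero    = 1#
  failure (suc m) = fromℕ 4 * fromℕ (suc m) ⁻¹

  failure⟶0 : failure ⟶ 0#
  failure⟶0 η 0<η with k , 4/η≤k ← archimedean (fromℕ 4 * η ⁻¹) =
    suc k , λ { (suc m) (ℕ.s≤s k≤m) →
      ≤-respˡ-≈ (sym (solve 1 (λ x → x :- # 0 := x) refl _)) (small k≤m 4/η≤k) ,
      ≤-trans (≤-by _ (0≤failure m) (solve 1 (λ x → # 0 := # 0 :- x :+ x) refl _)) (<⇒≤ 0<η) }
    where
    open ≤-Reasoning
    0≤failure : ∀ m → 0# ≤ failure (suc m)
    0≤failure m = *-nonNegative (fromℕ-nonNegative 4) (<⇒≤ (⁻¹-positive (fromℕ-suc-positive m)))
    small : ∀ {k m} → k ℕ.≤ m → fromℕ 4 * η ⁻¹ ≤ fromℕ k → failure (suc m) ≤ η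
    small {k} {m} k≤m 4/η≤k = *-cancelˡ-≤ (fromℕ-suc-positive m) (begin
      s * (fromℕ 4 * s ⁻¹)   ≈⟨ solve 3 (λ s f s′ → s :* (f :* s′) := f :* (s :* s′)) refl s (fromℕ 4) (s ⁻¹) ⟩
      fromℕ 4 * (s * s ⁻¹)   ≈⟨ *-congˡ (trans (*-inverse (fromℕ-suc-positive m)) (sym (*-inverse 0<η))) ⟩
      fromℕ 4 * (η * η ⁻¹)   ≈⟨ solve 3 (λ f e e′ → f :* (e :* e′) := f :* e′ :* e) refl (fromℕ 4) η (η ⁻¹) ⟩
      fromℕ 4 * η ⁻¹ * η     ≤⟨ *-monoʳ-≤ (<⇒≤ 0<η) (≤-trans 4/η≤k (fromℕ-mono-≤ (ℕ.≤-trans k≤m (ℕ.n≤1+n m)))) ⟩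
      s * η                  ∎)
      where s = fromℕ (suc m)

  1≤failure : ∀ {n} → n ℕ.< 4 → 1# ≤ failure n
  1≤failure {zero}  _   = ≤-refl
  1≤failure {suc m} n<4 = *-cancelˡ-≤ (fromℕ-suc-positive m) (begin
    s * 1#                 ≈⟨ *-identityʳ s ⟩
    s                      ≤⟨ fromℕ-mono-≤ (ℕ.<⇒≤ n<4) ⟩
    fromℕ 4                ≈⟨ trans (*-congˡ (*-inverse (fromℕ-suc-positive m))) (*-identityʳ _) ⟨
    fromℕ 4 * (s * s ⁻¹)   ≈⟨ solve 3 (λ s f s′ → f :* (s :* s′) := s :* (f :* s′)) refl s (fromℕ 4) (s ⁻¹) ⟩
    s * (fromℕ 4 * s ⁻¹)   ∎)
    where
    open ≤-Reasoning
    s = fromℕ (suc m)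

theorem1 : ∀ {ℓ} (R : Reals ℓ) →
  let open Reals R
      open Analysis R
      open Probability R
      open Similarity R
      open Streaming R
  in
  Σ (ℕ → Carrier) λ δ → Σ Carrier λ C → Σ ℕ λ n₀ →
    δ ⟶ 0# ×
    (∀ (n : ℕ) (ε √n logn : Carrier) (t₁ t₂ : ℕ) →
      let open Parameters R √n logn ε
          A = ThreePass.program R n t₁ t₂ threshold
      in
      0# < ε → ε < 1# →
      IsSqrt (fromℕ n) √n → IsLog (fromℕ n) logn →
      IsRounding size₁ t₁ → IsRounding size₂ t₂ →
      (∀ (U : Set ℓ) (f : U → U → Carrier) → IsSimilarity f → (σ : Vec U n) →
        IsApproximation ε (δ n) (diversityIndex f σ) (run f A σ)) ×
      passes A ≡ 3 ×
      (n₀ ℕ.≤ n → fromℕ (space A) ≤ C * ((ε * ε) ⁻¹ * √n * logn)))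
theorem1 {ℓ} R =
  -- 139 = 123 + 16 words. From n = 4 on, the logarithm is known to be at least 1.
  failure , fromℕ 139 , 4 , failure⟶0 ,
  λ n ε √n logn t₁ t₂ 0<ε ε<1 sqrt log rounding₁ rounding₂ →
    (λ U f similar σ → approximation n ε √n logn t₁ t₂ 0<ε ε<1 sqrt log rounding₁ rounding₂ f similar σ) ,
    ≡.refl ,
    (λ 4≤n → ≤-trans (fromℕ-mono-≤ (Space.space-≤ R n t₁ t₂ (Parameters.threshold R √n logn ε)))
       (ParameterBounds.Bounds.words-≤ R n ε √n logn t₁ t₂ 4≤n 0<ε ε<1 sqrt log rounding₁ rounding₂ 16))
  where
  open OrderedField R
  open Analysis R
  open Probability R
  open Similarity R
  open Streaming R
  open FailureProbability R

  approximation : ∀ n ε √n logn t₁ t₂ → let open Parameters R √n logn ε in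
    0# < ε → ε < 1# → IsSqrt (fromℕ n) √n → IsLog (fromℕ n) logn → IsRounding size₁ t₁ → IsRounding size₂ t₂ →
    ∀ {U : Set ℓ} (f : U → U → Carrier) → IsSimilarity f → (σ : Vec U n) →
    IsApproximation ε (failure n) (diversityIndex f σ) (run f (ThreePass.program R n t₁ t₂ threshold) σ)
  approximation n ε √n logn t₁ t₂ 0<ε ε<1 sqrt log rounding₁ rounding₂ f similar σ with 4 ℕ.≤? n
  -- Here `failure n` is at least 1, so it is enough that a probability is nonnegative.
  ... | no 4≰n = ≤-trans (≤-respʳ-≈ (-‿inverseʳ 1#) (+-monoʳ-≤ 1# (neg-mono-≤ (1≤failure (ℕ.≰⇒> 4≰n)))))
    (Outcome.Prob-nonNegative R n t₁ t₂ ε (Parameters.threshold R √n logn ε) f σ)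
  -- Matching on `suc m` lets `failure` reduce to 4/n.
  approximation (suc m) ε √n logn t₁ t₂ 0<ε ε<1 sqrt log rounding₁ rounding₂ f similar σ | yes 4≤n =
    Correctness.approximation R (suc m) t₁ t₂ ε (Parameters.threshold R √n logn ε) logn
      0<N 0<T₁ 0<T₂ 0<ε (<⇒≤ ε<1) 0<threshold (≤-trans 0≤1 1≤logn) (IsLog⇒≤exp 4≤n log) 64logn≤ 8θNlogn≤ f similar σ
    where
    open Exponential R using (IsLog⇒≤exp)
    open ParameterBounds.Bounds R (suc m) ε √n logn t₁ t₂ 4≤n 0<ε ε<1 sqrt log rounding₁ rounding₂
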